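{- Let $\mathbb{F}_q$ be any finite field and let $p$ be its characteristic. For every integer $n\ge 1$, $$\sum_{a\in\mathbb{F}_p^{\ast}} |S_a(n)|-(p-1)\,|S_0(n)|=\begin{cases}0, & \text{if } p\nmid n,\\ \sum_{a\in\mathbb{F}_p^{\ast}}|S_a(n/p)|, & \text{if } p\mid n.\end{cases}$$
   Context: $\mathcal{I}_q^n$ denotes the set of monic irreducible polynomials of degree $n$ in $\mathbb{F}_q[x]$. For $f\in\mathcal{I}_q^n$ with root $\alpha\in\mathbb{F}_{q^n}$, define $\operatorname{Tr}(f):=\operatorname{Tr}_{q^n/p}(\alpha)\in\mathbb{F}_p$, where $\operatorname{Tr}_{q^n/p}:\mathbb{F}_{q^n}\to\mathbb{F}_p$ is the absolute trace (this does not depend on the chosen root; if $f=x^n+\sum_{i=0}^{n-1}a_ix^i$, then $\operatorname{Tr}(f)=-\operatorname{Tr}_{q/p}(a_{n-1})$). For $a\in\mathbb{F}_p$ and $n\ge 1$, $S_a(n):=\{f\in\mathcal{I}_q^n\mid \operatorname{Tr}(f)=a\}$. -}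

module Defs where

open import Algebra.Apartness.Bundles using (HeytingField; HeytingCommutativeRing)
open import Algebra.Bundles using (CommutativeRing; Semiring)
open import Algebra.Bundles.Raw using (RawSemiring)
import Algebra.Definitions.RawSemiring as SemiringDefs
open import Algebra.Morphism.Structures using (IsRingHomomorphism)
open import Data.Fin using (Fin; toℕ; _≟_)
open import Data.List using (List; []; _∷_; map; filter; allFin; foldr)
open import Data.Nat as ℕ using (ℕ; zero; NonZero)
open import Data.Nat.DivMod using (_mod_)
open import Data.Nat.Divisibility using (_∣_)
open import Data.Nat.ListAction using (sum)
open import Data.Product using (_×_; proj₁)
open import Function.Bundles using (Inverse; _⇔_)
open import Level using (_⊔_; suc)
open import Relation.Binary.Bundles using (Setoid)
import Relation.Binary.Construct.On as On
open import Relation.Binary.PropositionalEquality as ≡ using (_≡_)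
open import Relation.Nullary.Decidable using (¬?)

HasCardinality : ∀ {a ℓ} → Setoid a ℓ → ℕ → Set (a ⊔ ℓ)
HasCardinality S N = Inverse S (≡.setoid (Fin N))

module Polynomial {c ℓ} (R : CommutativeRing c ℓ) where
  open CommutativeRing R

  -- a₀ ∷ a₁ ∷ … ∷ a_d ∷ [] is a₀ + a₁x + … + a_d x^d; trailing zeros are
  -- allowed, so equality is equality of all coefficients.
  Poly : Set c
  Poly = List Carrier

  coeff : Poly → ℕ → Carrier
  coeff []      _           = 0#
  coeff (a ∷ _) zero        = a
  coeff (_ ∷ f) (ℕ.suc i)   = coeff f i

  infix 4 _≈ᴾ_
  _≈ᴾ_ : Poly → Poly → Set ℓ
  f ≈ᴾ g = ∀ i → coeff f i ≈ coeff g i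

  polySetoid : Setoid c ℓ
  polySetoid = record
    { Carrier       = Poly
    ; _≈_           = _≈ᴾ_
    ; isEquivalence = record
      { refl  = λ _ → refl
      ; sym   = λ f≈g i → sym (f≈g i)
      ; trans = λ f≈g g≈h i → trans (f≈g i) (g≈h i)
      }
    }

  infixl 6 _+ᴾ_
  _+ᴾ_ : Poly → Poly → Poly
  []      +ᴾ g       = g
  (a ∷ f) +ᴾ []      = a ∷ f
  (a ∷ f) +ᴾ (b ∷ g) = (a + b) ∷ (f +ᴾ g)

  infixl 7 _*ᴾ_
  _*ᴾ_ : Poly → Poly → Poly
  []      *ᴾ g = []
  (a ∷ f) *ᴾ g = map (a *_) g +ᴾ (0# ∷ (f *ᴾ g))

  polyRawSemiring : RawSemiring c ℓ
  polyRawSemiring = record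
    { Carrier = Poly
    ; _≈_     = _≈ᴾ_
    ; _+_     = _+ᴾ_
    ; _*_     = _*ᴾ_
    ; 0#      = []
    ; 1#      = 1# ∷ []
    }

  open SemiringDefs polyRawSemiring public using (Irreducible)

  MonicOfDegree : ℕ → Poly → Set ℓ
  MonicOfDegree n f = coeff f n ≈ 1# × (∀ i → n ℕ.< i → coeff f i ≈ 0#)

module HomomorphicEvaluation {c₁ ℓ₁ c₂ ℓ₂} (R : CommutativeRing c₁ ℓ₁) (R′ : CommutativeRing c₂ ℓ₂)
  (φ : CommutativeRing.Carrier R → CommutativeRing.Carrier R′) where
  open CommutativeRing R′

  evalAt : Carrier → Polynomial.Poly R → Carrier
  evalAt α = foldr (λ a v → φ a + α * v) 0#

-- On a finite setoid the apartness of a Heyting field is just inequality, so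
-- a Heyting field with a cardinality is a finite field in the usual sense.
toRing : ∀ {c ℓ₁ ℓ₂} → HeytingField c ℓ₁ ℓ₂ → CommutativeRing c ℓ₁
toRing F = HeytingCommutativeRing.commutativeRing (HeytingField.heytingCommutativeRing F)

module _ {c ℓ} (R : CommutativeRing c ℓ) where
  open CommutativeRing R
  open SemiringDefs (Semiring.rawSemiring semiring) using (_^_) renaming (_×_ to _·_; sum to Σ)

  -- The image of the residue class a ∈ 𝔽ₚ in a ring of characteristic p.
  fromFin : ∀ {p} → Fin p → Carrier
  fromFin a = toℕ a · 1#

  HasCharacteristic : ℕ → Set ℓ
  HasCharacteristic p = ∀ m → m · 1# ≈ 0# ⇔ p ∣ m

  -- For a field with pᵏ elements this is the absolute trace: its Galois group
  -- over 𝔽ₚ consists of the maps α ↦ α ^ pⁱ, i < k.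
  absoluteTrace : (p k : ℕ) → Carrier → Carrier
  absoluteTrace p k α = Σ {k} (λ i → α ^ (p ℕ.^ toℕ i))

module _ {c ℓ₁ ℓ₂} (F : HeytingField c ℓ₁ ℓ₂) (q p : ℕ) where
  private R = toRing F
  open Polynomial R

  -- Tr(f) = a for f of degree n, where q = |F| and p = char F: some root α of f
  -- in a field K = 𝔽_{qⁿ} containing F has absolute trace a.  For irreducible f
  -- neither K (unique up to isomorphism over F) nor α (unique up to conjugation)
  -- matters.
  record HasTrace (n : ℕ) (f : Poly) (a : Fin p) : Set (suc (c ⊔ ℓ₁ ⊔ ℓ₂)) where
    field
      K : HeytingField c ℓ₁ ℓ₂

    R′ : CommutativeRing c ℓ₁
    R′ = toRing K

    open CommutativeRing R′ using (Carrier; _≈_; 0#; setoid)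

    field
      K-card : HasCardinality setoid (q ℕ.^ n)
      ι      : CommutativeRing.Carrier R → Carrier
      ι-hom  : IsRingHomomorphism (CommutativeRing.rawRing R) (CommutativeRing.rawRing R′) ι
      α      : Carrier
      α-root : HomomorphicEvaluation.evalAt R R′ ι α f ≈ 0#
      k      : ℕ
      [K:𝔽ₚ] : q ℕ.^ n ≡ p ℕ.^ k
      trace  : absoluteTrace R′ p k α ≈ fromFin R′ a

  S : Fin p → ℕ → Setoid (suc (c ⊔ ℓ₁ ⊔ ℓ₂)) ℓ₁
  S a n = On.setoid polySetoid
    (proj₁ {A = Poly} {B = λ f → MonicOfDegree n f × Irreducible f × HasTrace n f a})

𝟎 : ∀ {p} .{{_ : NonZero p}} → Fin p
𝟎 {p} = 0 mod p

sumNonzero : ∀ {p} .{{_ : NonZero p}} → (Fin p → ℕ) → ℕ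
sumNonzero {p} g = sum (map g (filter (λ a → ¬? (a ≟ 𝟎)) (allFin p)))

-- Count Λ(f) = ∑ deg g over the powers gᵏ, k ≥ 1, of monic irreducible g that
-- divide f: unique factorisation gives Λ(f) = deg f.  Summing this over all monic
-- f of degree N, and over those whose second coefficient has trace 0, the powers
-- gᵏ of degree < N contribute p times as much to the first sum as to the second,
-- because among the multiples of gᵏ the trace is equidistributed.  What is left,
-- the powers with k deg g = N, gives for all N
--     ∑_{kd = N} d I(d) = p ∑_{kd = N} d #{g ∈ I^d : k Tr g = 0},   I(d) = |I^d|.
-- Comparing this identity at N and at N / p, strong induction on N yields
-- |I^n| = p |S_0(n)| + [p ∣ n] ∑_{a ≠ 0} |S_a(n / p)|, which is the theorem.
--
-- For the trace of a root α of f in K, the conjugates α^(qⁱ), i < n, are distinct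
-- roots of f, so their sum is minus the second coefficient of f, and the absolute
-- trace of α is the trace of that sum from F to 𝔽ₚ.  The field K itself is F[x]/(f).
module Submission where

open import Defs
open import Algebra.Apartness.Bundles using (HeytingField)
open import Algebra.Bundles using (CommutativeRing; RawRing)
import Algebra.Definitions.RawMagma as MagmaDefs
import Algebra.Definitions.RawSemiring as SemiringDefs
open import Algebra.Morphism.Structures using (IsRingHomomorphism)
open import Data.Fin as Fin using (Fin; zero; suc; toℕ; fromℕ; fromℕ<; inject₁; finToFun; funToFin; punchIn)
open import Data.Fin.Permutation using (Permutation; permutation; _⟨$⟩ʳ_)
import Data.Fin.Properties as Fin
open import Data.List as List using (List; []; _∷_; map)
open import Data.Nat as ℕ using (ℕ; zero; suc; NonZero)
open import Data.Nat.Combinatorics using (nCn≡1; k![n∸k]!∣n!) renaming (_C_ to _choose_)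
open import Data.Nat.Combinatorics.Specification using (nCk≡n!/k![n-k]!)
import Data.Nat.DivMod as ℕ
open import Data.Nat.Divisibility using (_∣_; _∤_; divides; _∣?_)
import Data.Nat.Divisibility as ℕ
open import Data.Nat.Induction using (<-rec)
import Data.Nat.ListAction as ListAction
open import Data.Nat.Primality using (Prime; euclidsLemma; irreducible⇒prime; prime⇒nonTrivial)
import Data.Nat.Properties as ℕ
open import Data.Product using (_×_; _,_; proj₁; proj₂; ∃; Σ-syntax; ∃-syntax; ∃₂)
open import Data.Sum using (_⊎_; inj₁; inj₂; [_,_]′)
import Data.Vec.Functional as Vector
open import Function using (_∘_; Equivalence; Inverse; mk⇔)
open import Level using (Level; _⊔_; 0ℓ; Lift; lift)
open import Relation.Binary using (tri<; tri≈; tri>)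
open import Relation.Binary.Bundles using (Setoid)
open import Relation.Binary.PropositionalEquality as ≡ using (_≡_; _≢_)
open import Relation.Nullary using (¬_; Dec; yes; no; contradiction)
open import Relation.Nullary.Decidable using (map′; decidable-stable; _×-dec_; ¬?; False; toWitnessFalse; fromWitnessFalse)
open import Relation.Unary using (Decidable)

-- The comparison at N and N / p rests on the terms with p ∣ k. There k Tr g = 0 for every g, so
-- such a term counts p times on the right and once on the left. Writing k = p j turns the sum of
-- these terms into the whole left side at N / p; applying the identity there expresses the surplus
-- through the g of nonzero trace, with d replaced by p d. This is where n / p in the theorem comes
-- from. What remains relates sums over p ∤ k, in which degree N occurs only with k = 1, so the
-- induction can solve for it. All these identities live in ℕ and are therefore arranged without
-- subtraction. The hypotheses give q and p independently: that p is prime, that q = p^r and that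
-- some element has trace 1 must all be derived. Moreover `HasTrace` ranges over all fields K of the
-- right size, so membership in `S` cannot be decided as it stands; it is replaced by a condition on
-- one coefficient, after which every cardinality is a sum of indicators over coefficient vectors.

-- Ring identities and discrete fields

-- The solver's coefficients are formal differences m − n of naturals, so that it can cancel.
module RingSolver {c ℓ} (R : CommutativeRing c ℓ) where
  open CommutativeRing R
  open import Algebra.Properties.Semiring.Mult semiring using (×-homo-+; ×1-homo-*) renaming (_×_ to infixr 8 _·_)
  open import Algebra.Properties.Ring ring using (-‿distribˡ-*; -‿distribʳ-*; -‿involutive; -0#≈0#)
  open import Algebra.Properties.AbelianGroup +-abelianGroup using (⁻¹-∙-comm)
  open import Algebra.Properties.CommutativeSemigroup +-commutativeSemigroup using (interchange)
  open import Algebra.Solver.Ring.AlmostCommutativeRing using (fromCommutativeRing; _-Raw-AlmostCommutative⟶_)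
  open import Data.Maybe using (Maybe; just; nothing)
  open import Relation.Binary.Reasoning.Setoid setoid

  differences : RawRing 0ℓ 0ℓ
  differences = record
    { Carrier = ℕ × ℕ
    ; _≈_ = _≡_
    ; _+_ = λ (a , b) (c , d) → a ℕ.+ c , b ℕ.+ d
    ; _*_ = λ (a , b) (c , d) → a ℕ.* c ℕ.+ b ℕ.* d , a ℕ.* d ℕ.+ b ℕ.* c
    ; -_ = λ (a , b) → b , a
    ; 0# = 0 , 0
    ; 1# = 1 , 0
    }

  value : ℕ × ℕ → Carrier
  value (a , b) = a · 1# - b · 1#

  value-+ : ∀ a b c d → (a + c) - (b + d) ≈ (a - b) + (c - d)
  value-+ a b c d = trans (+-congˡ (sym (⁻¹-∙-comm b d))) (interchange a c (- b) (- d))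

  value-* : ∀ a b c d → (a * c + b * d) - (a * d + b * c) ≈ (a - b) * (c - d)
  value-* a b c d = begin
    (a * c + b * d) - (a * d + b * c)         ≈⟨ value-+ _ _ _ _ ⟩
    (a * c - a * d) + (b * d - b * c)         ≈⟨ +-cong (+-congˡ (-‿distribʳ-* a d)) (+-congʳ (sym (-‿involutive _))) ⟩
    (a * c + a * - d) + (- - (b * d) - b * c) ≈⟨ +-cong (sym (distribˡ a c (- d))) (+-comm _ _) ⟩
    a * (c - d) + (- (b * c) - - (b * d))     ≈⟨ +-congˡ (⁻¹-∙-comm _ _) ⟩
    a * (c - d) - (b * c - b * d)             ≈⟨ +-congˡ (-‿cong (trans (+-congˡ (-‿distribʳ-* b d)) (sym (distribˡ b c (- d))))) ⟩
    a * (c - d) - b * (c - d)                 ≈⟨ +-congˡ (-‿distribˡ-* b (c - d)) ⟩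
    a * (c - d) + - b * (c - d)               ≈⟨ distribʳ (c - d) a (- b) ⟨
    (a - b) * (c - d)                         ∎

  morphism : differences -Raw-AlmostCommutative⟶ fromCommutativeRing R
  morphism = record
    { ⟦_⟧ = value
    ; +-homo = λ (a , b) (c , d) → trans (+-cong (×-homo-+ 1# a c) (-‿cong (×-homo-+ 1# b d))) (value-+ _ _ _ _)
    ; *-homo = λ (a , b) (c , d) → trans
        (+-cong (trans (×-homo-+ 1# (a ℕ.* c) (b ℕ.* d)) (+-cong (×1-homo-* a c) (×1-homo-* b d)))
                (-‿cong (trans (×-homo-+ 1# (a ℕ.* d) (b ℕ.* c)) (+-cong (×1-homo-* a d) (×1-homo-* b c)))))
        (value-* _ _ _ _)
    ; -‿homo = λ (a , b) → sym (trans (sym (⁻¹-∙-comm _ _)) (trans (+-congˡ (-‿involutive _)) (+-comm _ _)))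
    ; 0-homo = -‿inverseʳ 0#
    ; 1-homo = trans (+-cong (+-identityʳ 1#) -0#≈0#) (+-identityʳ 1#)
    }

  -- One integer has many representations as a formal difference, so coefficients are compared by
  -- cross addition and not as pairs.
  value≟ : ∀ x y → Maybe (value x ≈ value y)
  value≟ (a , b) (c , d) with a ℕ.+ d ℕ.≟ c ℕ.+ b
  ... | no _ = nothing
  ... | yes a+d≡c+b = just (begin
    A - B             ≈⟨ +-congʳ (+-identityʳ A) ⟨
    A + 0# - B        ≈⟨ +-congʳ (+-congˡ (-‿inverseʳ D)) ⟨
    A + (D - D) - B   ≈⟨ +-congʳ (+-assoc A D (- D)) ⟨
    A + D - D - B     ≈⟨ +-congʳ (+-congʳ (trans (sym (×-homo-+ 1# a d)) (trans (reflexive (≡.cong (_· 1#) a+d≡c+b)) (×-homo-+ 1# c b)))) ⟩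
    C + B - D - B     ≈⟨ +-assoc _ _ _ ⟩
    C + B + (- D - B) ≈⟨ +-congˡ (⁻¹-∙-comm D B) ⟩
    C + B - (D + B)   ≈⟨ value-+ C D B B ⟩
    (C - D) + (B - B) ≈⟨ +-congˡ (-‿inverseʳ B) ⟩
    C - D + 0#        ≈⟨ +-identityʳ _ ⟩
    C - D             ∎)
    where
    A = a · 1#
    B = b · 1#
    C = c · 1#
    D = d · 1#

  open import Algebra.Solver.Ring differences (fromCommutativeRing R) morphism value≟ public
    using (solve; _:=_; _:+_; _:*_; _:-_; :-_)

-- Takes the place of the apartness relation: counting needs decidable equality, and inverses must
-- exist for every element that is merely unequal to zero.
record IsDiscreteField {c ℓ} (R : CommutativeRing c ℓ) : Set (c ⊔ ℓ) where
  open CommutativeRing R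
  infix 4 _≟_
  field
    _≟_ : ∀ x y → Dec (x ≈ y)
    1≉0 : ¬ 1# ≈ 0#
    inverse : ∀ {x} → ¬ x ≈ 0# → ∃[ y ] y * x ≈ 1#

module DiscreteField {c ℓ} (R : CommutativeRing c ℓ) (field? : IsDiscreteField R) where
  open CommutativeRing R public hiding (zero)
  open IsDiscreteField field? public
  open RingSolver R public using (solve; _:=_; _:+_; _:*_; _:-_; :-_)
  open import Algebra.Properties.Semiring.Sum semiring public using (sum; sum-cong-≋; ∑-distrib-+; ∑-comm; sum-permute; *-distribˡ-sum; sum-replicate)
  open import Algebra.Properties.Ring ring public using (-‿involutive; -0#≈0#) renaming (x∙y⁻¹≈ε⇒x≈y to x-y≈0⇒x≈y; x≈y⇒x∙y⁻¹≈ε to x≈y⇒x-y≈0)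
  open import Algebra.Properties.Semiring.Exp semiring public using (_^_; ^-congˡ; ^-assocʳ)
  open import Algebra.Properties.Semiring.Mult semiring public using (×-homo-+; ×1-homo-*) renaming (_×_ to infixr 8 _·_)
  open import Relation.Binary.Reasoning.Setoid setoid

  *-cancelʳ-nonZero : ∀ {x} y → ¬ x ≈ 0# → y * x ≈ 0# → y ≈ 0#
  *-cancelʳ-nonZero {x} y x≉0 yx≈0 with z , zx≈1 ← inverse x≉0 = begin
    y           ≈⟨ *-identityʳ y ⟨
    y * 1#      ≈⟨ *-congˡ zx≈1 ⟨
    y * (z * x) ≈⟨ solve 3 (λ x y z → y :* (z :* x) := z :* (y :* x)) refl x y z ⟩
    z * (y * x) ≈⟨ *-congˡ yx≈0 ⟩
    z * 0#      ≈⟨ zeroʳ z ⟩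
    0#          ∎

  ^-nonZero : ∀ {x} n → ¬ x ≈ 0# → ¬ x ^ n ≈ 0#
  ^-nonZero zero x≉0 = 1≉0
  ^-nonZero {x} (suc n) x≉0 eq = x≉0 (*-cancelʳ-nonZero x (^-nonZero n x≉0) eq)

-- Polynomial functions and the bound on their roots

module PolynomialFunctions {c ℓ} (R : CommutativeRing c ℓ) (field? : IsDiscreteField R) where
  open DiscreteField R field?
  open import Relation.Binary.Reasoning.Setoid setoid

  eval : ∀ {m} → (Fin m → Carrier) → Carrier → Carrier
  eval {zero} a x = 0#
  eval {suc m} a x = a zero + x * eval (a ∘ suc) x

  -- Synthetic division by x - z: the coefficients of the quotient are the values at z of the
  -- successive tails of `a`.
  divide : ∀ {m} → (Fin (suc m) → Carrier) → Carrier → Fin m → Carrier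
  divide {suc m} a z zero = eval (a ∘ suc) z
  divide {suc m} a z (suc i) = divide (a ∘ suc) z i

  eval-divide : ∀ {m} (a : Fin (suc m) → Carrier) z x → eval a x ≈ eval a z + (x - z) * eval (divide a z) x
  eval-divide {zero} a z x = trans (+-congˡ (trans (zeroʳ x) (sym (zeroʳ z)))) (sym (trans (+-congˡ (zeroʳ (x - z))) (+-identityʳ _)))
  eval-divide {suc m} a z x = begin
    a zero + x * eval (a ∘ suc) x ≈⟨ +-congˡ (*-congˡ (eval-divide (a ∘ suc) z x)) ⟩
    a zero + x * (e + (x - z) * d) ≈⟨ solve 5 (λ a x z e d → a :+ x :* (e :+ (x :- z) :* d) := (a :+ z :* e) :+ (x :- z) :* (e :+ x :* d)) refl (a zero) x z e d ⟩
    (a zero + z * e) + (x - z) * (e + x * d) ∎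
    where
    e = eval (a ∘ suc) z
    d = eval (divide (a ∘ suc) z) x

  -- Each coefficient is the value at z of one tail minus z times the value of the next tail. These
  -- values are the remainder and the entries of the quotient, all of them zero.
  divide-zero : ∀ {m} (a : Fin (suc m) → Carrier) z → eval a z ≈ 0# → (∀ i → divide a z i ≈ 0#) → ∀ i → a i ≈ 0#
  divide-zero {zero} a z az≈0 d≈0 zero = trans (sym (trans (+-congˡ (zeroʳ z)) (+-identityʳ _))) az≈0
  divide-zero {suc m} a z az≈0 d≈0 zero = trans (sym (trans (+-congˡ (trans (*-congˡ (d≈0 zero)) (zeroʳ z))) (+-identityʳ _))) az≈0
  divide-zero {suc m} a z az≈0 d≈0 (suc i) = divide-zero (a ∘ suc) z (d≈0 zero) (d≈0 ∘ suc) i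

  Distinct : ∀ {m} → (Fin m → Carrier) → Set ℓ
  Distinct ρ = ∀ i j → ρ i ≈ ρ j → i ≡ j

  -- Dividing by x - z for the first root z leaves one coefficient fewer, and the other roots are
  -- roots of the quotient because x - z is nonzero there and cancels.
  root-bound : ∀ {m} (a ρ : Fin m → Carrier) → Distinct ρ → (∀ i → eval a (ρ i) ≈ 0#) → ∀ i → a i ≈ 0#
  root-bound {suc m} a ρ distinct root = divide-zero a z (root zero)
    (root-bound (divide a z) (ρ ∘ suc) (λ i j eq → suc-injective (distinct (suc i) (suc j) eq)) root′)
    where
    open import Data.Fin.Properties using (suc-injective)
    z = ρ zero
    root′ : ∀ i → eval (divide a z) (ρ (suc i)) ≈ 0#
    root′ i = *-cancelʳ-nonZero _ x≉z (begin
      eval (divide a z) x * (x - z)              ≈⟨ *-comm _ _ ⟩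
      (x - z) * eval (divide a z) x              ≈⟨ +-identityˡ _ ⟨
      0# + (x - z) * eval (divide a z) x         ≈⟨ +-congʳ (root zero) ⟨
      eval a z + (x - z) * eval (divide a z) x   ≈⟨ eval-divide a z x ⟨
      eval a x                                   ≈⟨ root (suc i) ⟩
      0#                                         ∎)
      where
      x = ρ (suc i)
      x≉z : ¬ x - z ≈ 0#
      x≉z eq with () ← distinct (suc i) zero (x-y≈0⇒x≈y x z eq)

  snoc : ∀ {m} → (Fin m → Carrier) → Carrier → Fin (suc m) → Carrier
  snoc {zero} a t i = t
  snoc {suc m} a t zero = a zero
  snoc {suc m} a t (suc i) = snoc (a ∘ suc) t i

  snoc-last : ∀ {m} (a : Fin m → Carrier) t → snoc a t (fromℕ m) ≡ t
  snoc-last {zero} a t = ≡.refl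
  snoc-last {suc m} a t = snoc-last (a ∘ suc) t

  eval-snoc : ∀ {m} (a : Fin m → Carrier) t x → eval (snoc a t) x ≈ eval a x + t * x ^ m
  eval-snoc {zero} a t x = trans (trans (+-congˡ (zeroʳ x)) (+-identityʳ t)) (sym (trans (+-identityˡ _) (*-identityʳ t)))
  eval-snoc {suc m} a t x = begin
    a zero + x * eval (snoc (a ∘ suc) t) x ≈⟨ +-congˡ (*-congˡ (eval-snoc (a ∘ suc) t x)) ⟩
    a zero + x * (e + t * x ^ m)           ≈⟨ solve 5 (λ a x e t y → a :+ x :* (e :+ t :* y) := (a :+ x :* e) :+ t :* (x :* y)) refl (a zero) x e t (x ^ m) ⟩
    (a zero + x * e) + t * (x * x ^ m)     ∎
    where e = eval (a ∘ suc) x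

  -- Only an upper bound, witnessed by some coefficient vector. Over a finite field the vector is
  -- not determined by the function, so no exact degree of a function is used.
  Degree< : ℕ → (Carrier → Carrier) → Set (c ⊔ ℓ)
  Degree< m φ = Σ[ a ∈ (Fin m → Carrier) ] ∀ x → φ x ≈ eval a x

  degree<-resp : ∀ {m φ ψ} → (∀ x → ψ x ≈ φ x) → Degree< m φ → Degree< m ψ
  degree<-resp ψ≈φ (a , eq) = a , λ x → trans (ψ≈φ x) (eq x)

  degree<-0 : ∀ {m} → Degree< m (λ _ → 0#)
  degree<-0 {m} = (λ _ → 0#) , λ x → sym (eval-0 {m} x)
    where
    eval-0 : ∀ {m} x → eval {m} (λ _ → 0#) x ≈ 0#
    eval-0 {zero} x = refl
    eval-0 {suc m} x = trans (+-identityˡ _) (trans (*-congˡ (eval-0 {m} x)) (zeroʳ x))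

  degree<-+ : ∀ {m φ ψ} → Degree< m φ → Degree< m ψ → Degree< m (λ x → φ x + ψ x)
  degree<-+ (a , φ≈) (b , ψ≈) = (λ i → a i + b i) , λ x → trans (+-cong (φ≈ x) (ψ≈ x)) (eval-+ a b x)
    where
    eval-+ : ∀ {m} (a b : Fin m → Carrier) x → eval a x + eval b x ≈ eval (λ i → a i + b i) x
    eval-+ {zero} a b x = +-identityˡ 0#
    eval-+ {suc m} a b x = trans
      (solve 5 (λ a b x e f → (a :+ x :* e) :+ (b :+ x :* f) := (a :+ b) :+ x :* (e :+ f)) refl (a zero) (b zero) x _ _)
      (+-congˡ (*-congˡ (eval-+ (a ∘ suc) (b ∘ suc) x)))

  degree<-scale : ∀ {m φ} t → Degree< m φ → Degree< m (λ x → t * φ x)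
  degree<-scale t (a , φ≈) = (λ i → t * a i) , λ x → trans (*-congˡ (φ≈ x)) (eval-* a x)
    where
    eval-* : ∀ {m} (a : Fin m → Carrier) x → t * eval a x ≈ eval (λ i → t * a i) x
    eval-* {zero} a x = zeroʳ t
    eval-* {suc m} a x = trans
      (solve 4 (λ t a x e → t :* (a :+ x :* e) := t :* a :+ x :* (t :* e)) refl t (a zero) x _)
      (+-congˡ (*-congˡ (eval-* (a ∘ suc) x)))

  degree<-shift : ∀ {m φ} → Degree< m φ → Degree< (suc m) (λ x → x * φ x)
  degree<-shift {m} (a , φ≈) = b , λ x → trans (*-congˡ (φ≈ x)) (sym (+-identityˡ _))
    where
    b : Fin (suc m) → Carrier
    b zero = 0#
    b (suc i) = a i

  degree<-snoc : ∀ {m φ} t → Degree< m φ → Degree< (suc m) (λ x → φ x + t * x ^ m)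
  degree<-snoc t (a , φ≈) = snoc a t , λ x → trans (+-congʳ (φ≈ x)) (sym (eval-snoc a t x))

  degree<-≤ : ∀ {m n φ} → m ℕ.≤ n → Degree< m φ → Degree< n φ
  degree<-≤ {m} {φ = φ} m≤n deg = go (ℕ.≤⇒≤′ m≤n)
    where
    go : ∀ {n} → m ℕ.≤′ n → Degree< n φ
    go ℕ.≤′-refl = deg
    go (ℕ.≤′-step m≤n) = degree<-resp (λ x → sym (trans (+-congˡ (zeroˡ _)) (+-identityʳ _))) (degree<-snoc 0# (go m≤n))

  degree<-^ : ∀ j → Degree< (suc j) (_^ j)
  degree<-^ zero = (λ _ → 1#) , λ x → sym (trans (+-congˡ (zeroʳ x)) (+-identityʳ 1#))
  degree<-^ (suc j) = degree<-shift (degree<-^ j)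

  -- The root bound for a polynomial whose lower terms are known only up to degree. With `t` equal
  -- to `1#` it refutes the existence of too many roots; in `conjugates-sum` the unknown of interest
  -- is `t` itself.
  leading≈0 : ∀ {m φ t} (ρ : Fin (suc m) → Carrier) → Degree< m φ → Distinct ρ →
    (∀ i → φ (ρ i) + t * ρ i ^ m ≈ 0#) → t ≈ 0#
  leading≈0 {m} {t = t} ρ (a , φ≈) distinct root = trans (sym (reflexive (snoc-last a t)))
    (root-bound (snoc a t) ρ distinct
      (λ i → trans (eval-snoc a t (ρ i)) (trans (+-congʳ (sym (φ≈ (ρ i)))) (root i))) (fromℕ m))

  -- Vieta's formula for the second coefficient alone: `Π` is the product of the x - ρ i, and
  -- everything below the second coefficient is hidden in `ψ`.
  product-of-linear : ∀ {m} (ρ : Fin (suc m) → Carrier) → Σ[ Π ∈ (Carrier → Carrier) ] Σ[ ψ ∈ (Carrier → Carrier) ]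
    (∀ i → Π (ρ i) ≈ 0#) × Degree< m ψ × (∀ x → Π x + sum ρ * x ^ m ≈ x ^ suc m + ψ x)
  product-of-linear {zero} ρ = (λ x → x - ρ zero) , (λ _ → 0#) , (λ { zero → -‿inverseʳ _ }) , degree<-0 , eq
    where
    eq : ∀ x → (x - ρ zero) + (ρ zero + 0#) * 1# ≈ x * 1# + 0#
    eq x = begin
      (x - ρ zero) + (ρ zero + 0#) * 1# ≈⟨ +-congˡ (*-identityʳ _) ⟩
      (x - ρ zero) + (ρ zero + 0#)      ≈⟨ solve 3 (λ x r o → (x :- r) :+ (r :+ o) := x :+ o) refl x (ρ zero) 0# ⟩
      x + 0#                            ≈⟨ +-congʳ (*-identityʳ x) ⟨
      x * 1# + 0#                       ∎
  product-of-linear {suc m} ρ with Π , ψ , root , deg , eq ← product-of-linear (ρ ∘ suc) =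
    (λ x → (x - r) * Π x) , (λ x → x * ψ x + (- r) * ψ x + (r * s) * x ^ m)
    , (λ { zero → trans (*-congʳ (-‿inverseʳ r)) (zeroˡ _) ; (suc i) → trans (*-congˡ (root i)) (zeroʳ _) })
    , degree<-+ (degree<-+ (degree<-shift deg) (degree<-≤ (ℕ.n≤1+n m) (degree<-scale (- r) deg)))
                (degree<-scale (r * s) (degree<-^ m))
    , λ x → begin
        (x - r) * Π x + (r + s) * (x * x ^ m)
          ≈⟨ solve 5 (λ x r s P y → (x :- r) :* P :+ (r :+ s) :* (x :* y) := (x :- r) :* (P :+ s :* y) :+ (r :* s :* y :+ r :* (x :* y))) refl x r s (Π x) (x ^ m) ⟩
        (x - r) * (Π x + s * x ^ m) + (r * s * x ^ m + r * (x * x ^ m))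
          ≈⟨ +-congʳ (*-congˡ (eq x)) ⟩
        (x - r) * (x * x ^ m + ψ x) + (r * s * x ^ m + r * (x * x ^ m))
          ≈⟨ solve 5 (λ x r s P y → (x :- r) :* (x :* y :+ P) :+ (r :* s :* y :+ r :* (x :* y)) := x :* (x :* y) :+ (x :* P :+ (:- r) :* P :+ (r :* s) :* y)) refl x r s (ψ x) (x ^ m) ⟩
        x * (x * x ^ m) + (x * ψ x + (- r) * ψ x + (r * s) * x ^ m) ∎
    where
    r = ρ zero
    s = sum (ρ ∘ suc)

-- The Frobenius map and the absolute trace

prime∤! : ∀ {p} → Prime p → ∀ k → k ℕ.< p → p ∤ k ℕ.!
prime∤! {p} pr zero k<p p∣1 = ℕ.nonTrivial⇒≢1 {{prime⇒nonTrivial pr}} (ℕ.∣1⇒≡1 p∣1)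
prime∤! {p} pr (suc k) k<p p∣ with euclidsLemma (suc k) (k ℕ.!) pr p∣
... | inj₁ p∣k = ℕ.<⇒≱ k<p (ℕ.∣⇒≤ p∣k)
... | inj₂ p∣k! = prime∤! pr k (ℕ.<-trans (ℕ.n<1+n k) k<p) p∣k!

-- p divides p! = C(p, k) k! (p - k)!, but neither of the two factorials, whose factors are all
-- smaller than p.
prime∣binomial : ∀ {p} → Prime p → ∀ k → k ≢ 0 → k ℕ.< p → p ∣ p choose k
prime∣binomial {p} pr k k≢0 k<p = cases (euclidsLemma (p choose k) (k ℕ.! ℕ.* (p ℕ.∸ k) ℕ.!) pr p∣product)
  where
  instance _ = k ℕ.!* (p ℕ.∸ k) !≢0
  product≡ : (p choose k) ℕ.* (k ℕ.! ℕ.* (p ℕ.∸ k) ℕ.!) ≡ p ℕ.!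
  product≡ = ≡.trans (≡.cong (ℕ._* (k ℕ.! ℕ.* (p ℕ.∸ k) ℕ.!)) (nCk≡n!/k![n-k]! (ℕ.<⇒≤ k<p))) (ℕ.m/n*n≡m (k![n∸k]!∣n! (ℕ.<⇒≤ k<p)))
  n∣n! : ∀ n → 0 ℕ.< n → n ∣ n ℕ.!
  n∣n! (suc n) _ = ℕ.m∣m*n _
  p∣product : p ∣ (p choose k) ℕ.* (k ℕ.! ℕ.* (p ℕ.∸ k) ℕ.!)
  p∣product = ≡.subst (p ∣_) (≡.sym product≡) (n∣n! p (ℕ.≤-<-trans ℕ.z≤n k<p))
  cases : p ∣ p choose k ⊎ p ∣ k ℕ.! ℕ.* (p ℕ.∸ k) ℕ.! → p ∣ p choose k
  cases (inj₁ p∣C) = p∣C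
  cases (inj₂ p∣d) = contradiction (euclidsLemma (k ℕ.!) _ pr p∣d)
    [ prime∤! pr k k<p , prime∤! pr (p ℕ.∸ k) (ℕ.∸-monoʳ-< {p} {k} {0} (ℕ.n≢0⇒n>0 k≢0) (ℕ.<⇒≤ k<p)) ]′

module Frobenius {c ℓ} (R : CommutativeRing c ℓ) (field? : IsDiscreteField R) (p : ℕ) (p≢0 : NonZero p) (char : HasCharacteristic R p) where
  open DiscreteField R field?
  open import Relation.Binary.Reasoning.Setoid setoid

  ·1≈0⇒∣ : ∀ m → m · 1# ≈ 0# → p ∣ m
  ·1≈0⇒∣ m = Equivalence.to (char m)

  ∣⇒·1≈0 : ∀ m → p ∣ m → m · 1# ≈ 0#
  ∣⇒·1≈0 m = Equivalence.from (char m)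

  p≢1 : p ≢ 1
  p≢1 ≡.refl = 1≉0 (trans (sym (+-identityʳ 1#)) (∣⇒·1≈0 1 ℕ.∣-refl))

  -- Let p = k d. If d · 1 = 0 then p ∣ d. Otherwise d · 1 cancels from (k d) · 1 = 0, so p ∣ k and
  -- d = 1.
  p-prime : Prime p
  p-prime = irreducible⇒prime {{ℕ.n>1⇒nonTrivial (ℕ.≤∧≢⇒< (ℕ.>-nonZero⁻¹ p {{p≢0}}) (p≢1 ∘ ≡.sym))}} irreducible
    where
    irreducible : ∀ {d} → d ∣ p → d ≡ 1 ⊎ d ≡ p
    irreducible {d} d∣p@(divides k p≡kd) with d · 1# ≟ 0#
    ... | yes d≈0 = inj₂ (ℕ.∣-antisym d∣p (·1≈0⇒∣ d d≈0))
    ... | no d≉0 = inj₁ (ℕ.*-cancelˡ-≡ d 1 p {{p≢0}} (≡.trans (≡.cong (ℕ._* d) p≡k) (≡.trans (≡.sym p≡kd) (≡.sym (ℕ.*-identityʳ p)))))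
      where
      p≡k : p ≡ k
      p≡k = ℕ.∣-antisym
        (·1≈0⇒∣ k (*-cancelʳ-nonZero _ d≉0 (trans (sym (×1-homo-* k d)) (∣⇒·1≈0 (k ℕ.* d) (ℕ.∣-reflexive p≡kd)))))
        (≡.subst (k ∣_) (≡.sym p≡kd) (ℕ.m∣m*n d))

  ∣⇒·≈0 : ∀ m x → p ∣ m → m · x ≈ 0#
  ∣⇒·≈0 m x p∣m = begin
    m · x         ≈⟨ ×-congʳ m (*-identityˡ x) ⟨
    m · (1# * x)  ≈⟨ ×-assoc-* m 1# x ⟨
    (m · 1#) * x  ≈⟨ *-congʳ (∣⇒·1≈0 m p∣m) ⟩
    0# * x        ≈⟨ zeroˡ x ⟩
    0#            ∎
    where open import Algebra.Properties.Semiring.Mult semiring using (×-congʳ; ×-assoc-*)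

  frobenius-+ : ∀ x y → (x + y) ^ p ≈ x ^ p + y ^ p
  -- Replacing p by an equal variable n exposes its successor form, so that the outer terms of the
  -- binomial sum can be split off; the equation keeps the divisibility by p of the middle terms
  -- available.
  frobenius-+ x y = go p ≡.refl
    where
    open import Algebra.Properties.CommutativeSemiring.Binomial commutativeSemiring using (theorem; binomialTerm)
    open import Algebra.Properties.Semiring.Sum semiring using (sum-init-last; sum-replicate-zero)
    go : ∀ n → p ≡ n → (x + y) ^ n ≈ x ^ n + y ^ n
    go zero p≡0 = contradiction p≡0 (ℕ.≢-nonZero⁻¹ p {{p≢0}})
    go n@(suc m) p≡n = begin
      (x + y) ^ n                                      ≈⟨ theorem n x y ⟩
      t zero + sum (t ∘ suc)                           ≈⟨ +-congˡ (sum-init-last (t ∘ suc)) ⟩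
      t zero + (sum (t ∘ suc ∘ inject₁) + t (fromℕ n)) ≈⟨ +-congˡ (+-congʳ (trans (sum-cong-≋ middle) (sum-replicate-zero m))) ⟩
      t zero + (0# + t (fromℕ n))                      ≈⟨ +-cong first (trans (+-identityˡ _) last) ⟩
      y ^ n + x ^ n                                    ≈⟨ +-comm _ _ ⟩
      x ^ n + y ^ n                                    ∎
      where
      t = binomialTerm x y n
      first : t zero ≈ y ^ n
      first = trans (+-identityʳ _) (*-identityˡ _)
      last : t (fromℕ n) ≈ x ^ n
      last = begin
        (n choose toℕ (fromℕ n)) · (x ^ toℕ (fromℕ n) * y ^ (n ℕ.∸ toℕ (fromℕ n)))
          ≡⟨ ≡.cong (λ k → (n choose k) · (x ^ k * y ^ (n ℕ.∸ k))) (Fin.toℕ-fromℕ n) ⟩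
        (n choose n) · (x ^ n * y ^ (n ℕ.∸ n))
          ≡⟨ ≡.cong₂ (λ k l → k · (x ^ n * y ^ l)) (nCn≡1 n) (ℕ.n∸n≡0 n) ⟩
        1 · (x ^ n * 1#) ≈⟨ trans (+-identityʳ _) (*-identityʳ _) ⟩
        x ^ n ∎
      middle : ∀ i → t (suc (inject₁ i)) ≈ 0#
      middle i = ∣⇒·≈0 _ _ (≡.subst (λ n → p ∣ n choose k) p≡n (prime∣binomial p-prime k (λ ()) (≡.subst (k ℕ.<_) (≡.sym p≡n) k<n)))
        where
        k = suc (toℕ (inject₁ i))
        k<n : k ℕ.< n
        k<n = ℕ.s≤s (≡.subst (ℕ._< m) (≡.sym (Fin.toℕ-inject₁ i)) (Fin.toℕ<n i))

  frobenius-0 : 0# ^ p ≈ 0#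
  frobenius-0 = go p ≡.refl
    where
    go : ∀ n → p ≡ n → 0# ^ n ≈ 0#
    go zero p≡0 = contradiction p≡0 (ℕ.≢-nonZero⁻¹ p {{p≢0}})
    go (suc n) _ = zeroˡ _

  φ : ℕ → Carrier → Carrier
  φ j x = x ^ (p ℕ.^ j)

  φ-suc : ∀ j x → φ (suc j) x ≈ φ j (x ^ p)
  φ-suc j x = sym (^-assocʳ x p (p ℕ.^ j))

  φ-cong : ∀ j {x y} → x ≈ y → φ j x ≈ φ j y
  φ-cong j = ^-congˡ (p ℕ.^ j)

  φ-+ : ∀ j x y → φ j (x + y) ≈ φ j x + φ j y
  φ-+ zero x y = trans (*-identityʳ _) (+-cong (sym (*-identityʳ x)) (sym (*-identityʳ y)))
  φ-+ (suc j) x y = begin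
    φ (suc j) (x + y)             ≈⟨ φ-suc j _ ⟩
    φ j ((x + y) ^ p)             ≈⟨ φ-cong j (frobenius-+ x y) ⟩
    φ j (x ^ p + y ^ p)           ≈⟨ φ-+ j _ _ ⟩
    φ j (x ^ p) + φ j (y ^ p)     ≈⟨ +-cong (φ-suc j x) (φ-suc j y) ⟨
    φ (suc j) x + φ (suc j) y     ∎

  φ-0 : ∀ j → φ j 0# ≈ 0#
  φ-0 zero = zeroˡ 1#
  φ-0 (suc j) = trans (φ-suc j 0#) (trans (φ-cong j frobenius-0) (φ-0 j))

  φ-neg : ∀ j x → φ j (- x) ≈ - φ j x
  φ-neg j x = inverseˡ-unique _ _ (trans (sym (φ-+ j (- x) x)) (trans (φ-cong j (-‿inverseˡ x)) (φ-0 j)))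
    where open import Algebra.Properties.Group +-group using (inverseˡ-unique)

  φ-* : ∀ j x y → φ j (x * y) ≈ φ j x * φ j y
  φ-* j x y = ^-distrib-* x y (p ℕ.^ j)
    where open import Algebra.Properties.CommutativeSemiring.Exp commutativeSemiring using (^-distrib-*)

  1^ : ∀ n → 1# ^ n ≈ 1#
  1^ zero = refl
  1^ (suc n) = trans (*-identityˡ _) (1^ n)

  φ-1 : ∀ j → φ j 1# ≈ 1#
  φ-1 j = 1^ (p ℕ.^ j)

  φ-· : ∀ j m → φ j (m · 1#) ≈ m · 1#
  φ-· j zero = φ-0 j
  φ-· j (suc m) = trans (φ-+ j 1# (m · 1#)) (+-cong (φ-1 j) (φ-· j m))

  φ-injective : ∀ j {x y} → φ j x ≈ φ j y → x ≈ y
  φ-injective j {x} {y} eq with x - y ≟ 0#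
  ... | yes x-y≈0 = x-y≈0⇒x≈y x y x-y≈0
  ... | no x-y≉0 = contradiction (trans (φ-+ j x (- y)) (trans (+-congˡ (φ-neg j y)) (x≈y⇒x-y≈0 eq))) (^-nonZero (p ℕ.^ j) x-y≉0)

  fromFin-injective : ∀ (i j : Fin p) → fromFin R i ≈ fromFin R j → i ≡ j
  fromFin-injective i j eq = Fin.toℕ-injective ([ (λ i≤j → le i j i≤j eq) , (λ j≤i → ≡.sym (le j i j≤i (sym eq))) ]′ (ℕ.≤-total (toℕ i) (toℕ j)))
    where
    le : ∀ (i j : Fin p) → toℕ i ℕ.≤ toℕ j → fromFin R i ≈ fromFin R j → toℕ i ≡ toℕ j
    le i j i≤j eq with toℕ j ℕ.∸ toℕ i in d≡
    ... | zero = ℕ.≤-antisym i≤j (ℕ.m∸n≡0⇒m≤n d≡)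
    ... | suc d = contradiction (ℕ.∣⇒≤ (·1≈0⇒∣ (suc d) d≈0)) (ℕ.<⇒≱ (ℕ.≤-<-trans (≡.subst (ℕ._≤ toℕ j) d≡ (ℕ.m∸n≤m (toℕ j) (toℕ i))) (Fin.toℕ<n j)))
      where
      d≈0 : suc d · 1# ≈ 0#
      d≈0 = +-cancelˡ (toℕ i · 1#) _ _ (begin
        toℕ i · 1# + suc d · 1# ≈⟨ ×-homo-+ 1# (toℕ i) (suc d) ⟨
        (toℕ i ℕ.+ suc d) · 1#  ≡⟨ ≡.cong (λ d → (toℕ i ℕ.+ d) · 1#) d≡ ⟨
        (toℕ i ℕ.+ (toℕ j ℕ.∸ toℕ i)) · 1# ≡⟨ ≡.cong (_· 1#) (ℕ.m+[n∸m]≡n i≤j) ⟩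
        toℕ j · 1#              ≈⟨ eq ⟨
        toℕ i · 1#              ≈⟨ +-identityʳ _ ⟨
        toℕ i · 1# + 0#         ∎)
        where open import Algebra.Properties.Group +-group using () renaming (∙-cancelˡ to +-cancelˡ)

  -- The same sum as `absoluteTrace`, for an arbitrary length `k`. It takes values in the prime
  -- field only where `φ k x ≈ x`, which is the hypothesis of `trace-frobenius`.
  trace : ℕ → Carrier → Carrier
  trace k x = sum {k} (λ i → φ (toℕ i) x)

  trace-cong : ∀ k {x y} → x ≈ y → trace k x ≈ trace k y
  trace-cong k x≈y = sum-cong-≋ (λ (i : Fin k) → φ-cong (toℕ i) x≈y)

  trace-+ : ∀ k x y → trace k (x + y) ≈ trace k x + trace k y
  trace-+ k x y = trans (sum-cong-≋ (λ (i : Fin k) → φ-+ (toℕ i) x y)) (∑-distrib-+ {k} _ _)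

  trace-0 : ∀ k → trace k 0# ≈ 0#
  trace-0 k = +-cancelˡ (trace k 0#) _ _ (trans (sym (trace-+ k 0# 0#)) (trans (trace-cong k (+-identityʳ 0#)) (sym (+-identityʳ _))))
    where open import Algebra.Properties.Group +-group using () renaming (∙-cancelˡ to +-cancelˡ)

  trace-suc : ∀ k x → trace (suc k) x ≈ x + trace k (x ^ p)
  trace-suc k x = +-cong (*-identityʳ x) (sum-cong-≋ (λ (i : Fin k) → φ-suc (toℕ i) x))

  trace-init-last : ∀ k x → trace (suc k) x ≈ trace k x + φ k x
  trace-init-last k x = trans (sum-init-last (λ (i : Fin (suc k)) → φ (toℕ i) x))
    (+-cong (sum-cong-≋ (λ (i : Fin k) → reflexive (≡.cong (λ j → φ j x) (Fin.toℕ-inject₁ i))))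
            (reflexive (≡.cong (λ j → φ j x) (Fin.toℕ-fromℕ k))))
    where open import Algebra.Properties.Semiring.Sum semiring using (sum-init-last)

  trace-split : ∀ r m x → trace (r ℕ.+ m) x ≈ trace r x + trace m (φ r x)
  trace-split zero m x = trans (trace-cong m (sym (*-identityʳ x))) (sym (+-identityˡ _))
  trace-split (suc r) m x = begin
    trace (suc (r ℕ.+ m)) x                              ≈⟨ trace-suc (r ℕ.+ m) x ⟩
    x + trace (r ℕ.+ m) (x ^ p)                          ≈⟨ +-congˡ (trace-split r m (x ^ p)) ⟩
    x + (trace r (x ^ p) + trace m (φ r (x ^ p)))        ≈⟨ +-assoc _ _ _ ⟨
    x + trace r (x ^ p) + trace m (φ r (x ^ p))          ≈⟨ +-cong (trace-suc r x) (trace-cong m (φ-suc r x)) ⟨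
    trace (suc r) x + trace m (φ (suc r) x)              ∎

  frobenius-sum : ∀ {k} (f : Fin k → Carrier) → sum f ^ p ≈ sum (λ i → f i ^ p)
  frobenius-sum {zero} f = frobenius-0
  frobenius-sum {suc k} f = trans (frobenius-+ _ _) (+-congˡ (frobenius-sum (f ∘ suc)))

  -- The p-th power shifts the summands cyclically. In terms of `trace (suc k) x`, removing the
  -- first summand leaves `trace k (x ^ p)`, removing the last leaves `trace k x`, and the two
  -- removed summands agree.
  trace-frobenius : ∀ k x → φ k x ≈ x → trace k x ^ p ≈ trace k x
  trace-frobenius k x φx≈x = begin
    trace k x ^ p                          ≈⟨ frobenius-sum (λ (i : Fin k) → φ (toℕ i) x) ⟩
    sum (λ (i : Fin k) → φ (toℕ i) x ^ p)  ≈⟨ sum-cong-≋ (λ (i : Fin k) → ^-^-comm (p ℕ.^ toℕ i)) ⟩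
    trace k (x ^ p)                        ≈⟨ +-cancelˡ x _ _ (trans (sym (trace-suc k x)) (trans (trace-init-last k x) (trans (+-congˡ φx≈x) (+-comm _ _)))) ⟩
    trace k x                              ∎
    where
    open import Algebra.Properties.Group +-group using () renaming (∙-cancelˡ to +-cancelˡ)
    ^-^-comm : ∀ n → (x ^ n) ^ p ≈ (x ^ p) ^ n
    ^-^-comm n = trans (^-assocʳ x n p) (trans (reflexive (≡.cong (x ^_) (ℕ.*-comm n p))) (sym (^-assocʳ x p n)))

  φ-fixed : ∀ j {x} → x ^ p ≈ x → φ j x ≈ x
  φ-fixed zero xᵖ≈x = *-identityʳ _
  φ-fixed (suc j) {x} xᵖ≈x = trans (φ-suc j x) (trans (φ-cong j xᵖ≈x) (φ-fixed j xᵖ≈x))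

  trace-* : ∀ k {x} y → x ^ p ≈ x → trace k (x * y) ≈ x * trace k y
  trace-* k {x} y xᵖ≈x = trans
    (sum-cong-≋ (λ (i : Fin k) → trans (φ-* (toℕ i) x y) (*-congʳ (φ-fixed (toℕ i) xᵖ≈x))))
    (sym (*-distribˡ-sum x (λ (i : Fin k) → φ (toℕ i) y)))

  open PolynomialFunctions R field?

  -- `trace (suc k)` exceeds `trace k` by the single power p^k. The bound is sharp enough for
  -- `leading≈0` to treat this power as the leading term.
  trace-degree : ∀ k → Degree< (p ℕ.^ k) (trace k)
  trace-degree zero = degree<-0
  trace-degree (suc k) = degree<-resp (trace-init-last k)
    (degree<-+ (degree<-≤ (ℕ.<⇒≤ pᵏ<) (trace-degree k)) (degree<-≤ pᵏ< (degree<-^ (p ℕ.^ k))))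
    where
    pᵏ< : p ℕ.^ k ℕ.< p ℕ.^ suc k
    pᵏ< = ℕ.^-monoʳ-< p (ℕ.nonTrivial⇒n>1 p {{prime⇒nonTrivial p-prime}}) (ℕ.n<1+n k)

  -- x ^ p − x has at most p roots, and the p multiples of 1# are among them.
  prime-field : ∀ {x} → x ^ p ≈ x → ∃[ a ] x ≈ fromFin R {p} a
  prime-field {x} xᵖ≈x with Fin.any? (λ a → x ≟ fromFin R {p} a)
  ... | yes a = a
  ... | no x≉ = contradiction (leading≈0 ρ degree distinct root) 1≉0
    where
    ρ : Fin (suc p) → Carrier
    ρ zero = x
    ρ (suc a) = fromFin R {p} a
    degree : Degree< p (λ y → (- 1#) * (y ^ 1))
    degree = degree<-≤ (ℕ.nonTrivial⇒n>1 p {{prime⇒nonTrivial p-prime}}) (degree<-scale (- 1#) (degree<-^ 1))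
    distinct : Distinct ρ
    distinct zero zero eq = ≡.refl
    distinct zero (suc b) eq = contradiction (b , eq) x≉
    distinct (suc a) zero eq = contradiction (a , sym eq) x≉
    distinct (suc a) (suc b) eq = ≡.cong suc (fromFin-injective a b eq)
    fixed : ∀ i → ρ i ^ p ≈ ρ i
    fixed zero = xᵖ≈x
    fixed (suc a) = trans (reflexive (≡.cong (fromFin R a ^_) (≡.sym (ℕ.*-identityʳ p)))) (φ-· 1 (toℕ a))
    root : ∀ i → (- 1#) * (ρ i ^ 1) + 1# * ρ i ^ p ≈ 0#
    root i = begin
      (- 1#) * (y * 1#) + 1# * y ^ p ≈⟨ +-cong (*-congˡ (*-identityʳ y)) (*-congˡ (fixed i)) ⟩
      (- 1#) * y + 1# * y            ≈⟨ distribʳ y (- 1#) 1# ⟨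
      (- 1# + 1#) * y                ≈⟨ *-congʳ (-‿inverseˡ 1#) ⟩
      0# * y                         ≈⟨ zeroˡ y ⟩
      0#                             ∎
      where y = ρ i

  inverse-fixed : ∀ {x y} → y * x ≈ 1# → x ^ p ≈ x → y ^ p ≈ y
  inverse-fixed {x} {y} yx≈1 xᵖ≈x = begin
    y ^ p             ≈⟨ *-identityʳ _ ⟨
    y ^ p * 1#        ≈⟨ *-congˡ yx≈1 ⟨
    y ^ p * (y * x)   ≈⟨ solve 3 (λ z y x → z :* (y :* x) := y :* (z :* x)) refl (y ^ p) y x ⟩
    y * (y ^ p * x)   ≈⟨ *-congˡ (begin
      y ^ p * x         ≈⟨ *-congˡ xᵖ≈x ⟨
      y ^ p * x ^ p     ≈⟨ ^-distrib-* y x p ⟨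
      (y * x) ^ p       ≈⟨ ^-congˡ p yx≈1 ⟩
      1# ^ p            ≈⟨ 1^ p ⟩
      1#                ∎) ⟩
    y * 1#            ≈⟨ *-identityʳ y ⟩
    y                 ∎
    where open import Algebra.Properties.CommutativeSemiring.Exp commutativeSemiring using (^-distrib-*)

-- Finite fields: decidability, Fermat's identity, q = p^r and surjectivity of the trace

funToFin-cong : ∀ {m n} {f g : Fin m → Fin n} → (∀ i → f i ≡ g i) → funToFin f ≡ funToFin g
funToFin-cong {zero} f≗g = ≡.refl
funToFin-cong {suc m} f≗g = ≡.cong₂ Fin.combine (f≗g zero) (funToFin-cong (f≗g ∘ suc))

module Enumeration {c ℓ} (S : Setoid c ℓ) (N : ℕ) (card : HasCardinality S N) where
  open Setoid S
  open Inverse card public using () renaming (to to index; from to elem; to-cong to index-cong)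

  elem-index : ∀ x → elem (index x) ≈ x
  elem-index x = Inverse.strictlyInverseʳ card x

  index-elem : ∀ i → index (elem i) ≡ i
  index-elem i = Inverse.strictlyInverseˡ card i

  index-injective : ∀ {x y} → index x ≡ index y → x ≈ y
  index-injective eq = trans (sym (elem-index _)) (trans (reflexive (≡.cong elem eq)) (elem-index _))

  elem-injective : ∀ {i j} → elem i ≈ elem j → i ≡ j
  elem-injective eq = ≡.trans (≡.sym (index-elem _)) (≡.trans (index-cong eq) (index-elem _))

  finite-≟ : ∀ x y → Dec (x ≈ y)
  finite-≟ x y = map′ index-injective index-cong (index x Fin.≟ index y)

-- An inverse is searched for among the finitely many elements. If none exists, x cannot be apart
-- from 0, and tightness makes x equal to 0. The terms x - 0 appear because the Heyting axioms
-- invert differences.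
finite⇒discrete : ∀ {c ℓ₁ ℓ₂} (F : HeytingField c ℓ₁ ℓ₂) {q} → HasCardinality (CommutativeRing.setoid (toRing F)) q → IsDiscreteField (toRing F)
finite⇒discrete F {q} card = record
  { _≟_ = finite-≟
  ; 1≉0 = λ 1≈0 → #-irrefl 1≈0 1#0
  ; inverse = inverse
  }
  where
  open HeytingField F hiding (zero)
  open Enumeration (CommutativeRing.setoid (toRing F)) q card
  open import Algebra.Properties.Ring (CommutativeRing.ring (toRing F)) using (-0#≈0#)
  x-0≈x : ∀ x → x - 0# ≈ x
  x-0≈x x = trans (+-congˡ -0#≈0#) (+-identityʳ x)
  1#0 : 1# # 0#
  1#0 = invertible⇒# (1# , trans (*-identityˡ _) (x-0≈x 1#) , trans (*-identityʳ _) (x-0≈x 1#))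
  inverse : ∀ {x} → ¬ x ≈ 0# → ∃[ y ] y * x ≈ 1#
  inverse {x} x≉0 with Fin.any? (λ i → finite-≟ (elem i * x) 1#)
  ... | yes (i , eq) = elem i , eq
  ... | no ∄y = contradiction (proj₁ (tight x 0#) λ x#0 →
          let y , yx≈1 , _ = #⇒invertible x#0
          in ∄y (index y , trans (*-cong (elem-index y) (sym (x-0≈x x))) yx≈1)) x≉0

module FiniteField {c ℓ} (R : CommutativeRing c ℓ) (field? : IsDiscreteField R) (p : ℕ) (p≢0 : NonZero p) (char : HasCharacteristic R p)
  (q : ℕ) (card : HasCardinality (CommutativeRing.setoid R) q) where
  open DiscreteField R field?
  open PolynomialFunctions R field? using (leading≈0)
  open Frobenius R field? p p≢0 char public
  open Enumeration setoid q card public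
  open import Relation.Binary.Reasoning.Setoid setoid

  1<p : 1 ℕ.< p
  1<p = ℕ.nonTrivial⇒n>1 p {{prime⇒nonTrivial p-prime}}

  -- Multiplication by x permutes the non-zero elements, so x ^ (q − 1) fixes their product.
  fermat : ∀ x → x ^ q ≈ x
  fermat x with x ≟ 0#
  ... | yes x≈0 = trans (^-congˡ q x≈0) (trans (go q (index 0#)) (sym x≈0))
    where
    go : ∀ n → Fin n → 0# ^ n ≈ 0#
    go (suc n) _ = zeroˡ _
  ... | no x≉0 = go q ≡.refl
    where
    x⁻¹ = proj₁ (inverse x≉0)
    x⁻¹x≈1 : x⁻¹ * x ≈ 1#
    x⁻¹x≈1 = proj₂ (inverse x≉0)
    open import Data.Fin.Permutation using (Permutation; permutation)
    open import Algebra.Properties.CommutativeMonoid.Sum *-commutativeMonoid using (sum-remove)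
      renaming (sum to product; sum-permute to product-permute; sum-cong-≋ to product-cong; ∑-distrib-+ to product-*; sum-replicate to product-replicate)

    cancel : ∀ {u v} → u * v ≈ 1# → ∀ i → index (u * elem (index (v * elem i))) ≡ i
    cancel {u} {v} uv≈1 i = ≡.trans (index-cong (begin
      u * elem (index (v * elem i)) ≈⟨ *-congˡ (elem-index _) ⟩
      u * (v * elem i)              ≈⟨ *-assoc u v _ ⟨
      (u * v) * elem i              ≈⟨ *-congʳ uv≈1 ⟩
      1# * elem i                   ≈⟨ *-identityˡ _ ⟩
      elem i                        ∎)) (index-elem i)

    π : Permutation q q
    π = permutation (λ i → index (x * elem i)) (λ i → index (x⁻¹ * elem i))
      (cancel (trans (*-comm x x⁻¹) x⁻¹x≈1)) (cancel x⁻¹x≈1)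

    -- `unit u y` is u except at y = 0, where it is 1. Products over all q elements then give the
    -- product of the nonzero ones (u = y) and the power x^(q - 1) (u = x).
    unit : Carrier → Carrier → Carrier
    unit u y with y ≟ 0#
    ... | yes _ = 1#
    ... | no _ = u

    unit-zero : ∀ u {y} → y ≈ 0# → unit u y ≈ 1#
    unit-zero u {y} y≈0 with y ≟ 0#
    ... | yes _ = refl
    ... | no y≉0 = contradiction y≈0 y≉0

    unit-nonZero : ∀ u {y} → ¬ y ≈ 0# → unit u y ≈ u
    unit-nonZero u {y} y≉0 with y ≟ 0#
    ... | yes y≈0 = contradiction y≈0 y≉0
    ... | no _ = refl

    unit-*≉0 : ∀ y → ¬ unit y y ≈ 0#
    unit-*≉0 y with y ≟ 0#
    ... | yes _ = 1≉0
    ... | no y≉0 = y≉0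

    unit-* : ∀ y {z} → z ≈ x * y → unit z z ≈ unit x y * unit y y
    unit-* y {z} z≈xy with y ≟ 0#
    ... | yes y≈0 = trans (unit-zero z (trans z≈xy (trans (*-congˡ y≈0) (zeroʳ x)))) (sym (*-identityˡ 1#))
    ... | no y≉0 = trans (unit-nonZero z (λ z≈0 → x≉0 (*-cancelʳ-nonZero x y≉0 (trans (sym z≈xy) z≈0)))) z≈xy

    P : Carrier
    P = product {q} (λ i → unit (elem i) (elem i))

    product≉0 : ∀ {n} (f : Fin n → Carrier) → (∀ i → ¬ f i ≈ 0#) → ¬ product f ≈ 0#
    product≉0 {zero} f f≉0 = 1≉0
    product≉0 {suc n} f f≉0 eq = f≉0 zero (*-cancelʳ-nonZero _ (product≉0 (f ∘ suc) (f≉0 ∘ suc)) eq)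

    X : Carrier
    X = product {q} (λ i → unit x (elem i))

    P≈XP : P ≈ X * P
    P≈XP = trans (product-permute _ π) (trans (product-cong (λ i → unit-* (elem i) (elem-index (x * elem i)))) (product-* {q} _ _))

    X≈1 : X ≈ 1#
    X≈1 = x-y≈0⇒x≈y X 1# (*-cancelʳ-nonZero _ (product≉0 _ (λ i → unit-*≉0 (elem i)))
      (trans (distribʳ P X (- 1#)) (trans (+-cong (sym P≈XP) (-1*x≈-x P)) (-‿inverseʳ P))))
      where open import Algebra.Properties.Ring ring using (-1*x≈-x)

    go : ∀ n → q ≡ n → x ^ q ≈ x
    go zero ≡.refl with () ← index 0#
    go (suc n) ≡.refl = begin
      x * x ^ n   ≈⟨ *-congˡ (trans (trans (sym (product-replicate n)) (sym (product-cong rest))) (trans (sym (*-identityˡ _)) (*-congʳ (sym (unit-zero x (elem-index 0#)))))) ⟩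
      x * (unit x (elem i₀) * product (λ j → unit x (elem (punchIn i₀ j)))) ≈⟨ *-congˡ (sum-remove {i = i₀} (λ i → unit x (elem i))) ⟨
      x * X       ≈⟨ *-congˡ X≈1 ⟩
      x * 1#      ≈⟨ *-identityʳ x ⟩
      x           ∎
      where
      i₀ = index 0#
      rest : ∀ j → unit x (elem (punchIn i₀ j)) ≈ x
      rest j = unit-nonZero x λ eq → Fin.punchInᵢ≢i i₀ j (elem-injective (trans eq (sym (elem-index 0#))))

  1<q : 1 ℕ.< q
  1<q = Fin.injective⇒≤ {f = f} f-injective
    where
    f : Fin 2 → Fin q
    f zero = index 0#
    f (suc _) = index 1#
    f-injective : ∀ {i j} → f i ≡ f j → i ≡ j
    f-injective {zero} {zero} eq = ≡.refl
    f-injective {zero} {suc zero} eq = contradiction (sym (index-injective eq)) 1≉0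
    f-injective {suc zero} {zero} eq = contradiction (index-injective eq) 1≉0
    f-injective {suc zero} {suc zero} eq = ≡.refl

  fromFin-fixed : ∀ (a : Fin p) → fromFin R a ^ p ≈ fromFin R a
  fromFin-fixed a = trans (reflexive (≡.cong (fromFin R a ^_) (≡.sym (ℕ.*-identityʳ p)))) (φ-· 1 (toℕ a))

  -- The prime field as the fixed points of Frobenius. Closure under the field operations is
  -- immediate in this form, and `prime-field` converts back to residues.
  Fixed : Carrier → Set ℓ
  Fixed x = x ^ p ≈ x

  fixed-+ : ∀ {x y} → Fixed x → Fixed y → Fixed (x + y)
  fixed-+ {x} {y} x-fixed y-fixed = trans (frobenius-+ x y) (+-cong x-fixed y-fixed)

  fixed-neg : ∀ {x} → Fixed x → Fixed (- x)
  fixed-neg {x} x-fixed = trans (reflexive (≡.cong ((- x) ^_) (≡.sym (ℕ.*-identityʳ p))))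
    (trans (φ-neg 1 x) (-‿cong (trans (reflexive (≡.cong (x ^_) (ℕ.*-identityʳ p))) x-fixed)))

  fixed-* : ∀ {x y} → Fixed x → Fixed y → Fixed (x * y)
  fixed-* {x} {y} x-fixed y-fixed = trans (^-distrib-* x y p) (*-cong x-fixed y-fixed)
    where open import Algebra.Properties.CommutativeSemiring.Exp commutativeSemiring using (^-distrib-*)

  combination : ∀ {r} → (Fin r → Fin p) → (Fin r → Carrier) → Carrier
  combination a b = sum (λ i → fromFin R (a i) * b i)

  -- Linear independence over the prime field, stated as injectivity: the coefficients are bare
  -- elements of `Fin p`, and injectivity is what yields p^r ≤ q.
  Independent : ∀ {r} → (Fin r → Carrier) → Set ℓ
  Independent b = ∀ a a′ → combination a b ≈ combination a′ b → ∀ i → a i ≡ a′ i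

  fixed-combination : ∀ {r} (u b : Fin r → Carrier) → (∀ i → Fixed (u i)) → ∃[ a ] combination a b ≈ sum (λ i → u i * b i)
  fixed-combination u b fixed = (λ i → proj₁ (prime-field (fixed i))) , sum-cong-≋ (λ i → *-congʳ (sym (proj₂ (prime-field (fixed i)))))

  -- If u x + v = u′ x + v′ with u ≠ u′, then x = (v′ - v) / (u - u′). The scalars stay in the prime
  -- field, so x would be a combination of `b`. Hence u = u′, and independence of `b` does the rest.
  independent-extend : ∀ {r} (b : Fin r → Carrier) x → Independent b → (∀ a → ¬ combination a b ≈ x) →
    Independent (x Vector.∷ b)
  independent-extend {r} b x independent x∉ a a′ eq i with fromFin R (a zero) - fromFin R (a′ zero) ≟ 0#
  independent-extend {r} b x independent x∉ a a′ eq i | yes u≈0 = cases i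
    where
    u≈u′ : fromFin R (a zero) ≈ fromFin R (a′ zero)
    u≈u′ = x-y≈0⇒x≈y _ _ u≈0
    cases : ∀ i → a i ≡ a′ i
    cases zero = fromFin-injective (a zero) (a′ zero) u≈u′
    cases (suc i) = independent (a ∘ suc) (a′ ∘ suc) (+-cancelˡ _ _ _ (trans eq (+-congʳ (*-congʳ (sym u≈u′))))) i
      where open import Algebra.Properties.Group +-group using () renaming (∙-cancelˡ to +-cancelˡ)
  ... | no d≉0 = contradiction (trans a″≈ x≈) (x∉ a″)
    where
    u = fromFin R (a zero)
    u′ = fromFin R (a′ zero)
    v = combination (a ∘ suc) b
    v′ = combination (a′ ∘ suc) b
    e = proj₁ (inverse d≉0)
    ed≈1 : e * (u - u′) ≈ 1#
    ed≈1 = proj₂ (inverse d≉0)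
    e-fixed : Fixed e
    e-fixed = inverse-fixed ed≈1 (fixed-+ (fromFin-fixed (a zero)) (fixed-neg (fromFin-fixed (a′ zero))))
    w : Fin r → Carrier
    w i = e * (fromFin R (a′ (suc i)) - fromFin R (a (suc i)))
    w-combination = fixed-combination w b (λ i → fixed-* e-fixed (fixed-+ (fromFin-fixed (a′ (suc i))) (fixed-neg (fromFin-fixed (a (suc i))))))
    a″ = proj₁ w-combination
    a″≈ : combination a″ b ≈ sum (λ i → w i * b i)
    a″≈ = proj₂ w-combination
    x≈ : sum (λ i → w i * b i) ≈ x
    x≈ = begin
      sum (λ i → w i * b i)
        ≈⟨ sum-cong-≋ (λ i → solve 4 (λ e s t b → e :* (s :- t) :* b := e :* (s :* b) :+ (:- e) :* (t :* b)) refl e (fromFin R (a′ (suc i))) (fromFin R (a (suc i))) (b i)) ⟩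
      sum (λ i → e * (fromFin R (a′ (suc i)) * b i) + (- e) * (fromFin R (a (suc i)) * b i))
        ≈⟨ ∑-distrib-+ {r} _ _ ⟩
      sum (λ i → e * (fromFin R (a′ (suc i)) * b i)) + sum (λ i → (- e) * (fromFin R (a (suc i)) * b i))
        ≈⟨ +-cong (*-distribˡ-sum e (λ i → fromFin R (a′ (suc i)) * b i)) (*-distribˡ-sum (- e) (λ i → fromFin R (a (suc i)) * b i)) ⟨
      e * v′ + (- e) * v
        ≈⟨ solve 5 (λ e v v′ u′ x → e :* v′ :+ (:- e) :* v := e :* (u′ :* x :+ v′) :- e :* (u′ :* x :+ v)) refl e v v′ u′ x ⟩
      e * (u′ * x + v′) - e * (u′ * x + v)
        ≈⟨ +-congʳ (*-congˡ eq) ⟨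
      e * (u * x + v) - e * (u′ * x + v)
        ≈⟨ solve 5 (λ e v u u′ x → e :* (u :* x :+ v) :- e :* (u′ :* x :+ v) := (e :* (u :- u′)) :* x) refl e v u u′ x ⟩
      e * (u - u′) * x ≈⟨ trans (*-congʳ ed≈1) (*-identityˡ x) ⟩
      x ∎

  combination-cong : ∀ {r} {a a′ : Fin r → Fin p} b → (∀ i → a i ≡ a′ i) → combination a b ≈ combination a′ b
  combination-cong b a≗a′ = sum-cong-≋ (λ i → *-congʳ (reflexive (≡.cong (fromFin R) (a≗a′ i))))

  -- A maximal independent family over the prime field is a basis.
  q≡pʳ : ∃[ r ] q ≡ p ℕ.^ r
  q≡pʳ = go q zero (λ ()) (λ _ _ _ ()) (ℕ.m≤m+n q 0)
    where
    pʳ≤q : ∀ r (b : Fin r → Carrier) → Independent b → p ℕ.^ r ℕ.≤ q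
    pʳ≤q r b independent = Fin.injective⇒≤ {f = λ j → index (combination (finToFun {p} {r} j) b)} λ {i} {j} eq →
      ≡.trans (≡.sym (Fin.funToFin-finToFin {r} {p} i)) (≡.trans (funToFin-cong (independent _ _ (index-injective eq))) (Fin.funToFin-finToFin {r} {p} j))
    r<pʳ : ∀ r → r ℕ.< p ℕ.^ r
    r<pʳ zero = ℕ.z<s
    r<pʳ (suc r) = ℕ.≤-<-trans (r<pʳ r) (ℕ.^-monoʳ-< p 1<p (ℕ.n<1+n r))
    -- An independent family of size r satisfies r < p^r ≤ q, so the invariant q ≤ gas + r is
    -- contradictory once the gas is used up.
    go : ∀ gas r (b : Fin r → Carrier) → Independent b → q ℕ.≤ gas ℕ.+ r → ∃[ r ] q ≡ p ℕ.^ r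
    go gas r b independent q≤ with Fin.all? (λ i → Fin.any? (λ j → combination (finToFun {p} {r} j) b ≟ elem i))
    ... | yes spans = r , ℕ.≤-antisym (Fin.injective⇒≤ {f = λ i → proj₁ (spans i)}
            (λ {i} {j} eq → elem-injective (trans (sym (proj₂ (spans i))) (trans (reflexive (≡.cong (λ k → combination (finToFun {p} {r} k) b) eq)) (proj₂ (spans j))))))
            (pʳ≤q r b independent)
    go zero r b independent q≤r | no _ = contradiction q≤r (ℕ.<⇒≱ (ℕ.<-≤-trans (r<pʳ r) (pʳ≤q r b independent)))
    go (suc gas) r b independent q≤ | no ¬spans with i , ¬∃ ← Fin.¬∀⟶∃¬ q _ (λ i → Fin.any? (λ j → combination (finToFun {p} {r} j) b ≟ elem i)) ¬spans =
      go gas (suc r) (elem i Vector.∷ b) (independent-extend b (elem i) independent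
        (λ a eq → ¬∃ (funToFin a , trans (combination-cong b (Fin.finToFun-funToFin a)) eq)))
        (≡.subst (q ℕ.≤_) (≡.sym (ℕ.+-suc gas r)) q≤)

  r : ℕ
  r = proj₁ q≡pʳ

  Tr : Carrier → Carrier
  Tr = trace r

  φʳ-id : ∀ x → φ r x ≈ x
  φʳ-id x = trans (reflexive (≡.cong (x ^_) (≡.sym (proj₂ q≡pʳ)))) (fermat x)

  Tr-fixed : ∀ x → Fixed (Tr x)
  Tr-fixed x = trace-frobenius r x (φʳ-id x)

  -- As a polynomial function the trace is monic of degree q / p, so it cannot vanish on all q elements.
  Tr≉0 : ∃[ x ] ¬ Tr x ≈ 0#
  Tr≉0 with Fin.all? (λ i → Tr (elem i) ≟ 0#)
  ... | no ¬all = let i , ≉0 = Fin.¬∀⟶∃¬ q _ (λ i → Tr (elem i) ≟ 0#) ¬all in elem i , ≉0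
  ... | yes all = contradiction (go r (proj₂ q≡pʳ) all) 1≉0
    where
    go : ∀ k → q ≡ p ℕ.^ k → (∀ i → trace k (elem i) ≈ 0#) → 1# ≈ 0#
    go zero q≡1 _ = contradiction q≡1 (ℕ.>⇒≢ 1<q)
    go (suc k) q≡pᵏ⁺¹ root = leading≈0 ρ (trace-degree k)
      (λ i j eq → Fin.inject≤-injective pᵏ<q pᵏ<q i j (elem-injective eq))
      (λ i → trans (+-congˡ (*-identityˡ _)) (trans (sym (trace-init-last k _)) (root (Fin.inject≤ i pᵏ<q))))
      where
      pᵏ<q : p ℕ.^ k ℕ.< q
      pᵏ<q = ≡.subst (p ℕ.^ k ℕ.<_) (≡.sym q≡pᵏ⁺¹) (ℕ.^-monoʳ-< p 1<p (ℕ.n<1+n k))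
      ρ : Fin (suc (p ℕ.^ k)) → Carrier
      ρ i = elem (Fin.inject≤ i pᵏ<q)

  -- A nonzero value of the trace lies in the prime field, and so does its inverse, which can be
  -- moved inside by linearity. The element of trace 1 is what later shifts the trace of a
  -- polynomial.
  Tr-surjective : ∃[ x ] Tr x ≈ 1#
  Tr-surjective with x , Trx≉0 ← Tr≉0 with y , y*Trx≈1 ← inverse Trx≉0 =
    y * x , trans (trace-* r x (inverse-fixed y*Trx≈1 (Tr-fixed x))) y*Trx≈1

-- The ring of polynomials

module PolynomialRing {c ℓ} (R : CommutativeRing c ℓ) where
  open CommutativeRing R hiding (zero)
  open Polynomial R
  open import Algebra.Properties.CommutativeSemigroup +-commutativeSemigroup using (interchange)
  open import Algebra.Properties.Ring ring using (-0#≈0#)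

  -- As a record, equality of polynomials does not unfold, and Agda can infer its two sides.
  infix 4 _≋_
  record _≋_ (f g : Poly) : Set ℓ where
    constructor coeffs
    infix 8 _at_
    field _at_ : f ≈ᴾ g
  open _≋_ public

  ≋-setoid : Setoid c ℓ
  ≋-setoid = record
    { Carrier = Poly
    ; _≈_ = _≋_
    ; isEquivalence = record
      { refl = coeffs λ _ → refl
      ; sym = λ f≋g → coeffs λ i → sym (f≋g at i)
      ; trans = λ f≋g g≋h → coeffs λ i → trans (f≋g at i) (g≋h at i)
      }
    }
  module P = Setoid ≋-setoid
  open import Relation.Binary.Reasoning.Setoid ≋-setoid

  infixr 7 _•_
  _•_ : Carrier → Poly → Poly
  a • f = map (a *_) f

  -ᴾ_ : Poly → Poly
  -ᴾ f = map -_ f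

  x*_ : Poly → Poly
  x* f = 0# ∷ f

  coeff-+ : ∀ f g i → coeff (f +ᴾ g) i ≈ coeff f i + coeff g i
  coeff-+ [] g i = sym (+-identityˡ _)
  coeff-+ (a ∷ f) [] i = sym (+-identityʳ _)
  coeff-+ (a ∷ f) (b ∷ g) zero = refl
  coeff-+ (a ∷ f) (b ∷ g) (suc i) = coeff-+ f g i

  coeff-• : ∀ a f i → coeff (a • f) i ≈ a * coeff f i
  coeff-• a [] i = sym (zeroʳ a)
  coeff-• a (b ∷ f) zero = refl
  coeff-• a (b ∷ f) (suc i) = coeff-• a f i

  coeff-neg : ∀ f i → coeff (-ᴾ f) i ≈ - coeff f i
  coeff-neg [] i = sym -0#≈0#
  coeff-neg (a ∷ f) zero = refl
  coeff-neg (a ∷ f) (suc i) = coeff-neg f i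

  ∷-cong : ∀ {a b f g} → a ≈ b → f ≋ g → a ∷ f ≋ b ∷ g
  ∷-cong a≈b f≈g = coeffs λ { zero → a≈b ; (suc i) → f≈g at i }

  tail-≋ : ∀ {a b f g} → a ∷ f ≋ b ∷ g → f ≋ g
  tail-≋ eq = coeffs λ i → eq at suc i

  tail-≋0 : ∀ {a f} → a ∷ f ≋ [] → f ≋ []
  tail-≋0 eq = coeffs λ i → eq at suc i

  0∷[]≈[] : x* [] ≋ []
  0∷[]≈[] = coeffs λ { zero → refl ; (suc i) → refl }

  +ᴾ-cong : ∀ {f f′ g g′} → f ≋ f′ → g ≋ g′ → f +ᴾ g ≋ f′ +ᴾ g′
  +ᴾ-cong {f} {f′} {g} {g′} f≈f′ g≈g′ = coeffs λ i → trans (coeff-+ f g i) (trans (+-cong (f≈f′ at i) (g≈g′ at i)) (sym (coeff-+ f′ g′ i)))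

  •-cong : ∀ {a b f g} → a ≈ b → f ≋ g → a • f ≋ b • g
  •-cong {a} {b} {f} {g} a≈b f≈g = coeffs λ i → trans (coeff-• a f i) (trans (*-cong a≈b (f≈g at i)) (sym (coeff-• b g i)))

  +ᴾ-assoc : ∀ f g h → (f +ᴾ g) +ᴾ h ≋ f +ᴾ (g +ᴾ h)
  +ᴾ-assoc f g h = coeffs λ i → trans (trans (coeff-+ (f +ᴾ g) h i) (+-congʳ (coeff-+ f g i)))
    (trans (+-assoc _ _ _) (sym (trans (coeff-+ f (g +ᴾ h) i) (+-congˡ (coeff-+ g h i)))))

  +ᴾ-comm : ∀ f g → f +ᴾ g ≋ g +ᴾ f
  +ᴾ-comm f g = coeffs λ i → trans (coeff-+ f g i) (trans (+-comm _ _) (sym (coeff-+ g f i)))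

  +ᴾ-identityʳ : ∀ f → f +ᴾ [] ≋ f
  +ᴾ-identityʳ f = coeffs λ i → trans (coeff-+ f [] i) (+-identityʳ _)

  +ᴾ-inverseʳ : ∀ f → f +ᴾ (-ᴾ f) ≋ []
  +ᴾ-inverseʳ f = coeffs λ i → trans (coeff-+ f (-ᴾ f) i) (trans (+-congˡ (coeff-neg f i)) (-‿inverseʳ _))

  neg-cong : ∀ {f g} → f ≋ g → -ᴾ f ≋ -ᴾ g
  neg-cong {f} {g} f≈g = coeffs λ i → trans (coeff-neg f i) (trans (-‿cong (f≈g at i)) (sym (coeff-neg g i)))

  +ᴾ-interchange : ∀ f g h k → (f +ᴾ g) +ᴾ (h +ᴾ k) ≋ (f +ᴾ h) +ᴾ (g +ᴾ k)
  +ᴾ-interchange f g h k = coeffs λ i → trans (expand f g h k i) (trans (interchange _ _ _ _) (sym (expand f h g k i)))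
    where
    expand : ∀ f g h k i → coeff ((f +ᴾ g) +ᴾ (h +ᴾ k)) i ≈ (coeff f i + coeff g i) + (coeff h i + coeff k i)
    expand f g h k i = trans (coeff-+ (f +ᴾ g) (h +ᴾ k) i) (+-cong (coeff-+ f g i) (coeff-+ h k i))

  •-distribˡ : ∀ a f g → a • (f +ᴾ g) ≋ a • f +ᴾ a • g
  •-distribˡ a f g = coeffs λ i → trans (coeff-• a (f +ᴾ g) i) (trans (*-congˡ (coeff-+ f g i)) (trans (distribˡ _ _ _)
    (sym (trans (coeff-+ (a • f) (a • g) i) (+-cong (coeff-• a f i) (coeff-• a g i))))))

  •-distribʳ : ∀ a b f → (a + b) • f ≋ a • f +ᴾ b • f
  •-distribʳ a b f = coeffs λ i → trans (coeff-• (a + b) f i) (trans (distribʳ _ _ _)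
    (sym (trans (coeff-+ (a • f) (b • f) i) (+-cong (coeff-• a f i) (coeff-• b f i)))))

  •-assoc : ∀ a b f → (a * b) • f ≋ a • b • f
  •-assoc a b f = coeffs λ i → trans (coeff-• (a * b) f i) (trans (*-assoc a b _) (sym (trans (coeff-• a (b • f) i) (*-congˡ (coeff-• b f i)))))

  •-zero : ∀ {a} f → a ≈ 0# → a • f ≋ []
  •-zero {a} f a≈0 = coeffs λ i → trans (coeff-• a f i) (trans (*-congʳ a≈0) (zeroˡ _))

  •-one : ∀ f → 1# • f ≋ f
  •-one f = coeffs λ i → trans (coeff-• 1# f i) (*-identityˡ _)

  x*-+ : ∀ f g → x* (f +ᴾ g) ≋ x* f +ᴾ x* g
  x*-+ f g = ∷-cong (sym (+-identityˡ 0#)) (P.refl)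

  *ᴾ-zeroˡ : ∀ f g → f ≋ [] → f *ᴾ g ≋ []
  *ᴾ-zeroˡ [] g f≈0 = P.refl
  *ᴾ-zeroˡ (a ∷ f) g f≈0 = begin
    a • g +ᴾ x* (f *ᴾ g) ≈⟨ +ᴾ-cong (•-zero g (f≈0 at 0)) (∷-cong refl (*ᴾ-zeroˡ f g (tail-≋0 f≈0))) ⟩
    x* []                ≈⟨ 0∷[]≈[] ⟩
    []                   ∎

  *ᴾ-congʳ : ∀ {f f′} g → f ≋ f′ → f *ᴾ g ≋ f′ *ᴾ g
  *ᴾ-congʳ {[]} {f′} g eq = P.sym (*ᴾ-zeroˡ f′ g (P.sym eq))
  *ᴾ-congʳ {a ∷ f} {[]} g eq = *ᴾ-zeroˡ (a ∷ f) g eq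
  *ᴾ-congʳ {a ∷ f} {b ∷ f′} g eq = +ᴾ-cong {a • g} {b • g} (•-cong (eq at 0) (P.refl)) (∷-cong refl (*ᴾ-congʳ {f} {f′} g (tail-≋ eq)))

  *ᴾ-congˡ : ∀ f {g g′} → g ≋ g′ → f *ᴾ g ≋ f *ᴾ g′
  *ᴾ-congˡ [] eq = P.refl
  *ᴾ-congˡ (a ∷ f) {g} {g′} eq = +ᴾ-cong {a • g} {a • g′} (•-cong refl eq) (∷-cong refl (*ᴾ-congˡ f eq))

  *ᴾ-distribʳ : ∀ h f g → (f +ᴾ g) *ᴾ h ≋ f *ᴾ h +ᴾ g *ᴾ h
  *ᴾ-distribʳ h [] g = P.refl
  *ᴾ-distribʳ h (a ∷ f) [] = P.sym (+ᴾ-identityʳ ((a ∷ f) *ᴾ h))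
  *ᴾ-distribʳ h (a ∷ f) (b ∷ g) = begin
    (a + b) • h +ᴾ x* ((f +ᴾ g) *ᴾ h)
      ≈⟨ +ᴾ-cong (•-distribʳ a b h) (P.trans (∷-cong refl (*ᴾ-distribʳ h f g)) (x*-+ (f *ᴾ h) (g *ᴾ h))) ⟩
    (a • h +ᴾ b • h) +ᴾ (x* (f *ᴾ h) +ᴾ x* (g *ᴾ h)) ≈⟨ +ᴾ-interchange (a • h) (b • h) (x* (f *ᴾ h)) (x* (g *ᴾ h)) ⟩
    (a ∷ f) *ᴾ h +ᴾ (b ∷ g) *ᴾ h ∎

  •-* : ∀ a f g → (a • f) *ᴾ g ≋ a • (f *ᴾ g)
  •-* a [] g = P.refl
  •-* a (b ∷ f) g = begin
    (a * b) • g +ᴾ x* ((a • f) *ᴾ g)  ≈⟨ +ᴾ-cong (•-assoc a b g) (∷-cong (sym (zeroʳ a)) (•-* a f g)) ⟩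
    a • b • g +ᴾ a • x* (f *ᴾ g)      ≈⟨ •-distribˡ a (b • g) (x* (f *ᴾ g)) ⟨
    a • (b • g +ᴾ x* (f *ᴾ g))        ∎

  x*-* : ∀ f g → (x* f) *ᴾ g ≋ x* (f *ᴾ g)
  x*-* f g = +ᴾ-cong {0# • g} {[]} (•-zero g refl) (P.refl)

  *ᴾ-zeroʳ : ∀ f → f *ᴾ [] ≋ []
  *ᴾ-zeroʳ [] = P.refl
  *ᴾ-zeroʳ (a ∷ f) = P.trans (∷-cong refl (*ᴾ-zeroʳ f)) 0∷[]≈[]

  -- The product is defined by recursion on its left factor; this is the mirrored recursion on the
  -- right one, from which commutativity follows by induction.
  *ᴾ-∷ : ∀ g b f → g *ᴾ (b ∷ f) ≋ b • g +ᴾ x* (g *ᴾ f)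
  *ᴾ-∷ [] b f = P.sym 0∷[]≈[]
  *ᴾ-∷ (a ∷ g) b f = ∷-cong (+-congʳ (*-comm a b)) (begin
    a • f +ᴾ g *ᴾ (b ∷ f)               ≈⟨ +ᴾ-cong (P.refl) (*ᴾ-∷ g b f) ⟩
    a • f +ᴾ (b • g +ᴾ x* (g *ᴾ f))     ≈⟨ +ᴾ-assoc (a • f) (b • g) (x* (g *ᴾ f)) ⟨
    (a • f +ᴾ b • g) +ᴾ x* (g *ᴾ f)     ≈⟨ +ᴾ-cong (+ᴾ-comm (a • f) (b • g)) (P.refl) ⟩
    (b • g +ᴾ a • f) +ᴾ x* (g *ᴾ f)     ≈⟨ +ᴾ-assoc (b • g) (a • f) (x* (g *ᴾ f)) ⟩
    b • g +ᴾ (a • f +ᴾ x* (g *ᴾ f))     ∎)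

  *ᴾ-comm : ∀ f g → f *ᴾ g ≋ g *ᴾ f
  *ᴾ-comm [] g = P.sym (*ᴾ-zeroʳ g)
  *ᴾ-comm (a ∷ f) g = begin
    a • g +ᴾ x* (f *ᴾ g) ≈⟨ +ᴾ-cong (P.refl) (∷-cong refl (*ᴾ-comm f g)) ⟩
    a • g +ᴾ x* (g *ᴾ f) ≈⟨ *ᴾ-∷ g a f ⟨
    g *ᴾ (a ∷ f)         ∎

  *ᴾ-assoc : ∀ f g h → (f *ᴾ g) *ᴾ h ≋ f *ᴾ (g *ᴾ h)
  *ᴾ-assoc [] g h = P.refl
  *ᴾ-assoc (a ∷ f) g h = begin
    (a • g +ᴾ x* (f *ᴾ g)) *ᴾ h           ≈⟨ *ᴾ-distribʳ h (a • g) (x* (f *ᴾ g)) ⟩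
    (a • g) *ᴾ h +ᴾ (x* (f *ᴾ g)) *ᴾ h    ≈⟨ +ᴾ-cong (•-* a g h) (P.trans (x*-* (f *ᴾ g) h) (∷-cong refl (*ᴾ-assoc f g h))) ⟩
    a • (g *ᴾ h) +ᴾ x* (f *ᴾ (g *ᴾ h))    ∎

  *ᴾ-identityˡ : ∀ f → (1# ∷ []) *ᴾ f ≋ f
  *ᴾ-identityˡ f = begin
    1# • f +ᴾ x* []   ≈⟨ +ᴾ-cong (•-one f) 0∷[]≈[] ⟩
    f +ᴾ []           ≈⟨ +ᴾ-identityʳ f ⟩
    f                 ∎

  polynomialRing : CommutativeRing c ℓ
  polynomialRing = record
    { Carrier = Poly ; _≈_ = _≋_ ; _+_ = _+ᴾ_ ; _*_ = _*ᴾ_ ; -_ = -ᴾ_ ; 0# = [] ; 1# = 1# ∷ []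
    ; isCommutativeRing = record
      { isRing = record
        { +-isAbelianGroup = record
          { isGroup = record
            { isMonoid = record
              { isSemigroup = record
                { isMagma = record { isEquivalence = P.isEquivalence ; ∙-cong = λ {f} {f′} {g} {g′} → +ᴾ-cong {f} {f′} {g} {g′} }
                ; assoc = +ᴾ-assoc }
              ; identity = (λ f → P.refl) , +ᴾ-identityʳ }
            ; inverse = (λ f → P.trans (+ᴾ-comm (-ᴾ f) f) (+ᴾ-inverseʳ f)) , +ᴾ-inverseʳ
            ; ⁻¹-cong = λ {f} {g} → neg-cong {f} {g} }
          ; comm = +ᴾ-comm }
        ; *-cong = λ {f} {f′} {g} {g′} f≈f′ g≈g′ → P.trans (*ᴾ-congʳ {f} {f′} g f≈f′) (*ᴾ-congˡ f′ g≈g′)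
        ; *-assoc = *ᴾ-assoc
        ; *-identity = *ᴾ-identityˡ , λ f → P.trans (*ᴾ-comm f (1# ∷ [])) (*ᴾ-identityˡ f)
        ; distrib = (λ f g h → begin
            f *ᴾ (g +ᴾ h)      ≈⟨ *ᴾ-comm f (g +ᴾ h) ⟩
            (g +ᴾ h) *ᴾ f      ≈⟨ *ᴾ-distribʳ f g h ⟩
            g *ᴾ f +ᴾ h *ᴾ f   ≈⟨ +ᴾ-cong (*ᴾ-comm g f) (*ᴾ-comm h f) ⟩
            f *ᴾ g +ᴾ f *ᴾ h   ∎) , *ᴾ-distribʳ
        }
      ; *-comm = *ᴾ-comm }
    }

  Degreeᴾ< : ℕ → Poly → Set ℓ
  Degreeᴾ< m f = ∀ i → m ℕ.≤ i → coeff f i ≈ 0#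

  degreeᴾ<-* : ∀ {m n} f g → Degreeᴾ< (suc m) f → Degreeᴾ< (suc n) g → Degreeᴾ< (suc (m ℕ.+ n)) (f *ᴾ g)
  -- The degrees are only bounded and the top coefficients may vanish. With nonzero ones in a field
  -- this becomes additivity of degrees.
  coeff-*-top : ∀ {m n} f g → Degreeᴾ< (suc m) f → Degreeᴾ< (suc n) g → coeff (f *ᴾ g) (m ℕ.+ n) ≈ coeff f m * coeff g n

  degreeᴾ<-* [] g _ _ i _ = refl
  degreeᴾ<-* {m} {n} (a ∷ f) g deg-f deg-g (suc i) (ℕ.s≤s m+n≤i) = trans (coeff-+ (a • g) (x* (f *ᴾ g)) (suc i))
    (trans (+-cong (trans (coeff-• a g (suc i)) (trans (*-congˡ (deg-g (suc i) (ℕ.s≤s (ℕ.≤-trans (ℕ.m≤n+m n m) m+n≤i)))) (zeroʳ a))) (tail m deg-f m+n≤i)) (+-identityˡ 0#))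
    where
    tail : ∀ m → Degreeᴾ< (suc m) (a ∷ f) → m ℕ.+ n ℕ.≤ i → coeff (f *ᴾ g) i ≈ 0#
    tail zero deg _ = *ᴾ-zeroˡ f g (coeffs λ i → deg (suc i) (ℕ.s≤s ℕ.z≤n)) at i
    tail (suc m) deg m+n<i = degreeᴾ<-* f g (λ i m<i → deg (suc i) (ℕ.s≤s m<i)) deg-g i m+n<i

  coeff-*-top {m} [] g _ _ = sym (zeroˡ _)
  coeff-*-top {zero} {n} (a ∷ f) g deg-f deg-g = trans (coeff-+ (a • g) (x* (f *ᴾ g)) n)
    (trans (+-cong (coeff-• a g n) (P.trans (∷-cong refl (*ᴾ-zeroˡ f g (coeffs λ i → deg-f (suc i) (ℕ.s≤s ℕ.z≤n)))) 0∷[]≈[] at n)) (+-identityʳ _))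
  coeff-*-top {suc m} {n} (a ∷ f) g deg-f deg-g = trans (coeff-+ (a • g) (x* (f *ᴾ g)) (suc (m ℕ.+ n)))
    (trans (+-cong (trans (coeff-• a g _) (trans (*-congˡ (deg-g _ (ℕ.s≤s (ℕ.m≤n+m n m)))) (zeroʳ a)))
                   (coeff-*-top f g (λ i m<i → deg-f (suc i) (ℕ.s≤s m<i)) deg-g)) (+-identityˡ _))

-- Division with remainder, greatest common divisors and irreducibility

module PolynomialDivision {c ℓ} (R : CommutativeRing c ℓ) (field? : IsDiscreteField R) where
  open DiscreteField R field? hiding (solve; _:=_; _:+_; _:*_; _:-_; :-_)
  open Polynomial R public
  open PolynomialRing R public
  open RingSolver polynomialRing using (solve; _:=_; _:+_; _:*_; _:-_; :-_)
  module PR = CommutativeRing polynomialRing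
  open import Relation.Binary.Reasoning.Setoid ≋-setoid

  infix 4 _∣ᴾ_
  _∣ᴾ_ : Poly → Poly → Set (c ⊔ ℓ)
  g ∣ᴾ f = ∃[ h ] h *ᴾ g ≋ f

  C : Carrier → Poly
  C a = a ∷ []

  1ᴾ : Poly
  1ᴾ = C 1#

  C-* : ∀ a f → C a *ᴾ f ≋ a • f
  C-* a f = P.trans (+ᴾ-cong (P.refl {a • f}) 0∷[]≈[]) (+ᴾ-identityʳ (a • f))

  C-inverse : ∀ {a b} f → b * a ≈ 1# → C b *ᴾ (C a *ᴾ f) ≋ f
  C-inverse {a} {b} f ba≈1 = begin
    C b *ᴾ (C a *ᴾ f) ≈⟨ PR.*-assoc (C b) (C a) f ⟨
    C b *ᴾ C a *ᴾ f   ≈⟨ PR.*-congʳ (P.trans (C-* b (C a)) (∷-cong ba≈1 P.refl)) ⟩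
    1ᴾ *ᴾ f           ≈⟨ PR.*-identityˡ f ⟩
    f                 ∎

  coeff-- : ∀ f g i → coeff (f +ᴾ (-ᴾ g)) i ≈ coeff f i - coeff g i
  coeff-- f g i = trans (coeff-+ f (-ᴾ g) i) (+-congˡ (coeff-neg g i))

  degreeᴾ<-resp : ∀ {n f g} → f ≋ g → Degreeᴾ< n f → Degreeᴾ< n g
  degreeᴾ<-resp f≋g deg i n≤i = trans (sym (f≋g at i)) (deg i n≤i)

  degreeᴾ<-- : ∀ {n} f g → Degreeᴾ< n f → Degreeᴾ< n g → Degreeᴾ< n (f +ᴾ (-ᴾ g))
  degreeᴾ<-- f g deg-f deg-g i n≤i = trans (coeff-- f g i) (trans (+-cong (deg-f i n≤i) (trans (-‿cong (deg-g i n≤i)) -0#≈0#)) (+-identityʳ 0#))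

  monic-resp : ∀ {n f g} → f ≋ g → MonicOfDegree n f → MonicOfDegree n g
  monic-resp f≋g (top , deg) = trans (sym (f≋g at _)) top , λ i n<i → trans (sym (f≋g at i)) (deg i n<i)

  -- Long division digit by digit: x times the remainder for the tail, plus the new coefficient, has
  -- degree at most n, so subtracting one scalar multiple of `h` repairs it, and that scalar `t` is
  -- the next digit of the quotient.
  divMod : ∀ {n} h → MonicOfDegree n h → ∀ g → Σ[ quot ∈ Poly ] Σ[ rem ∈ Poly ] g ≋ quot *ᴾ h +ᴾ rem × Degreeᴾ< n rem
  divMod h monic [] = [] , [] , P.refl , λ _ _ → refl
  divMod {n} h monic@(top , deg) (a ∷ g) with quot , rem , g≋ , deg-rem ← divMod h monic g =
    t ∷ quot , s +ᴾ (-ᴾ (t • h)) , eq , deg′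
    where
    s = a ∷ rem
    t = coeff s n
    deg′ : Degreeᴾ< n (s +ᴾ (-ᴾ (t • h)))
    deg′ i n≤i = trans (coeff-- s (t • h) i) (trans (+-congˡ (-‿cong (coeff-• t h i))) (x≈y⇒x-y≈0 (cases (ℕ.m≤n⇒m<n∨m≡n n≤i))))
      where
      s≈0 : ∀ i → n ℕ.< i → coeff s i ≈ 0#
      s≈0 (suc i) (ℕ.s≤s n≤i) = deg-rem i n≤i
      cases : n ℕ.< i ⊎ n ≡ i → coeff s i ≈ t * coeff h i
      cases (inj₁ n<i) = trans (s≈0 i n<i) (sym (trans (*-congˡ (deg i n<i)) (zeroʳ t)))
      cases (inj₂ ≡.refl) = sym (trans (*-congˡ top) (*-identityʳ t))
    eq : a ∷ g ≋ (t ∷ quot) *ᴾ h +ᴾ (s +ᴾ (-ᴾ (t • h)))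
    eq = begin
      a ∷ g                                            ≈⟨ ∷-cong (sym (+-identityˡ a)) g≋ ⟩
      x* (quot *ᴾ h) +ᴾ s                              ≈⟨ solve 3 (λ u v w → u :+ v := (w :+ u) :+ (v :- w)) P.refl (x* (quot *ᴾ h)) s (t • h) ⟩
      (t • h +ᴾ x* (quot *ᴾ h)) +ᴾ (s +ᴾ (-ᴾ (t • h))) ∎

  -- Trailing zeros make the length of a list meaningless as a degree; the true leading position is
  -- found by testing coefficients.
  data Leading (f : Poly) : Set ℓ where
    null : f ≋ [] → Leading f
    lead : ∀ n → ¬ coeff f n ≈ 0# → Degreeᴾ< (suc n) f → Leading f

  leading : ∀ f → Leading f
  leading [] = null P.refl
  leading (a ∷ f) with leading f
  ... | lead n f≉0 deg = lead (suc n) f≉0 λ { (suc i) (ℕ.s≤s n<i) → deg i n<i }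
  ... | null f≋0 with a ≟ 0#
  ...   | yes a≈0 = null (P.trans (∷-cong a≈0 f≋0) 0∷[]≈[])
  ...   | no a≉0 = lead 0 a≉0 λ { (suc i) _ → f≋0 at i }

  _≋[]? : ∀ f → Dec (f ≋ [])
  f ≋[]? with leading f
  ... | null f≋0 = yes f≋0
  ... | lead n f≉0 _ = no λ f≋0 → f≉0 (f≋0 at n)

  normalise : ∀ {n} f → ¬ coeff f n ≈ 0# → Degreeᴾ< (suc n) f →
    ∃₂ λ a g → MonicOfDegree n g × g ≋ C a *ᴾ f × ∃[ b ] f ≋ C b *ᴾ g
  normalise {n} f f≉0 deg with b , bt≈1 ← inverse f≉0 = b , g , (top , λ i n<i → trans (at-i i) (trans (*-congˡ (deg i n<i)) (zeroʳ b)))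
    , P.refl , coeff f n , P.sym (C-inverse f (trans (*-comm _ _) bt≈1))
    where
    g = C b *ᴾ f
    at-i : ∀ i → coeff g i ≈ b * coeff f i
    at-i i = trans (C-* b f at i) (coeff-• b f i)
    top : coeff g n ≈ 1#
    top = trans (at-i n) bt≈1

  monic-top : ∀ {m n} f → MonicOfDegree m f → ¬ coeff f n ≈ 0# → Degreeᴾ< (suc n) f → m ≡ n
  monic-top {m} {n} f (top , deg) f≉0 deg′ with ℕ.<-cmp m n
  ... | tri< m<n _ _ = contradiction (deg n m<n) f≉0
  ... | tri≈ _ m≡n _ = m≡n
  ... | tri> _ _ n<m = contradiction (trans (sym top) (deg′ m n<m)) 1≉0

  monic-degree : ∀ {m n f} → MonicOfDegree m f → MonicOfDegree n f → m ≡ n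
  monic-degree {f = f} monic (top , deg) = monic-top f monic (λ eq → 1≉0 (trans (sym top) eq)) deg

  monic≉0 : ∀ {n f} → MonicOfDegree n f → ¬ f ≋ []
  monic≉0 (top , _) f≋0 = 1≉0 (trans (sym top) (f≋0 at _))

  monic-1 : MonicOfDegree 0 1ᴾ
  monic-1 = refl , λ { (suc i) _ → refl }

  monic-* : ∀ {m n} f g → MonicOfDegree m f → MonicOfDegree n g → MonicOfDegree (m ℕ.+ n) (f *ᴾ g)
  monic-* f g (top-f , deg-f) (top-g , deg-g) =
    trans (coeff-*-top f g deg-f deg-g) (trans (*-cong top-f top-g) (*-identityˡ 1#)) , degreeᴾ<-* f g deg-f deg-g

  cofactor-monic : ∀ {m n} f g → MonicOfDegree m f → MonicOfDegree n (g *ᴾ f) → ∃[ k ] k ℕ.+ m ≡ n × MonicOfDegree k g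
  cofactor-monic {m} f g (top-f , deg-f) monic with leading g
  ... | null g≋0 = contradiction (*ᴾ-zeroˡ g f g≋0) (monic≉0 monic)
  ... | lead k g≉0 deg-g = k , k+m≡n , trans (sym top) (≡.subst (λ n → coeff (g *ᴾ f) n ≈ 1#) (≡.sym k+m≡n) (proj₁ monic)) , deg-g
    where
    top : coeff (g *ᴾ f) (k ℕ.+ m) ≈ coeff g k
    top = trans (coeff-*-top g f deg-g deg-f) (trans (*-congˡ top-f) (*-identityʳ _))
    k+m≡n = ≡.sym (monic-top (g *ᴾ f) monic (λ eq → g≉0 (trans (sym top) eq)) (degreeᴾ<-* g f deg-g deg-f))

  divisor-small : ∀ {n f g} → MonicOfDegree n f → f ∣ᴾ g → Degreeᴾ< n g → g ≋ []
  divisor-small {n} {f} {g} (top-f , deg-f) (h , hf≋g) deg with leading h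
  ... | null h≋0 = P.trans (P.sym hf≋g) (*ᴾ-zeroˡ h f h≋0)
  ... | lead k h≉0 deg-h = contradiction
    (trans (sym (trans (coeff-*-top h f deg-h deg-f) (trans (*-congˡ top-f) (*-identityʳ _)))) (trans (hf≋g at _) (deg _ (ℕ.m≤n+m n k)))) h≉0

  ∣ᴾ-refl : ∀ {f} → f ∣ᴾ f
  ∣ᴾ-refl {f} = 1ᴾ , PR.*-identityˡ f

  ∣ᴾ-trans : ∀ {f g h} → f ∣ᴾ g → g ∣ᴾ h → f ∣ᴾ h
  ∣ᴾ-trans {f} (a , af≋g) (b , bg≋h) = b *ᴾ a , P.trans (PR.*-assoc b a f) (P.trans (PR.*-congˡ {b} af≋g) bg≋h)

  ∣ᴾ-resp : ∀ {f g h} → g ≋ h → f ∣ᴾ g → f ∣ᴾ h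
  ∣ᴾ-resp g≋h (a , af≋g) = a , P.trans af≋g g≋h

  ∣ᴾ-* : ∀ {f g} h → f ∣ᴾ g → f ∣ᴾ h *ᴾ g
  ∣ᴾ-* {f} h (a , af≋g) = h *ᴾ a , P.trans (PR.*-assoc h a f) (PR.*-congˡ {h} af≋g)

  ∣ᴾ-+ : ∀ {f g h} → f ∣ᴾ g → f ∣ᴾ h → f ∣ᴾ g +ᴾ h
  ∣ᴾ-+ {f} (a , af≋g) (b , bf≋h) = a +ᴾ b , P.trans (PR.distribʳ f a b) (+ᴾ-cong af≋g bf≋h)

  ∣ᴾ-neg : ∀ {f g} → f ∣ᴾ g → f ∣ᴾ -ᴾ g
  ∣ᴾ-neg {f} (a , af≋g) = -ᴾ a , P.trans (P.sym (-‿distribˡ-* a f)) (neg-cong af≋g)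
    where open import Algebra.Properties.Ring PR.ring using (-‿distribˡ-*)

  rem≋0⇔∣ᴾ : ∀ {n f} (monic : MonicOfDegree n f) g → let rem = proj₁ (proj₂ (divMod f monic g)) in (rem ≋ [] → f ∣ᴾ g) × (f ∣ᴾ g → rem ≋ [])
  rem≋0⇔∣ᴾ {n} {f} monic g with quot , rem , g≋ , deg ← divMod f monic g =
    (λ rem≋0 → quot , P.sym (P.trans g≋ (P.trans (+ᴾ-cong P.refl rem≋0) (+ᴾ-identityʳ _)))) ,
    λ f∣g → divisor-small monic (∣ᴾ-resp rem≋ (∣ᴾ-+ f∣g (∣ᴾ-neg (quot , P.refl)))) deg
    where
    rem≋ : g +ᴾ (-ᴾ (quot *ᴾ f)) ≋ rem
    rem≋ = P.trans (+ᴾ-cong g≋ P.refl) (solve 2 (λ u v → u :+ v :- u := v) P.refl (quot *ᴾ f) rem)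

  monic-∣ᴾ? : ∀ {n f} → MonicOfDegree n f → ∀ g → Dec (f ∣ᴾ g)
  monic-∣ᴾ? {f = f} monic g = map′ (proj₁ (rem≋0⇔∣ᴾ monic g)) (proj₂ (rem≋0⇔∣ᴾ monic g)) (proj₁ (proj₂ (divMod f monic g)) ≋[]?)

  ∤1 : ∀ {n f} → MonicOfDegree n f → n ≢ 0 → ¬ f ∣ᴾ 1ᴾ
  ∤1 {n} {f} monic n≢0 (g , gf≋1) with k , k+n≡0 , _ ← cofactor-monic f g monic (monic-resp (P.sym gf≋1) monic-1) = n≢0 (ℕ.m+n≡0⇒n≡0 k k+n≡0)

  record GCD (f g : Poly) : Set (c ⊔ ℓ) where
    field
      d u v : Poly
      bezout : u *ᴾ f +ᴾ v *ᴾ g ≋ d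
      d∣f : d ∣ᴾ f
      d∣g : d ∣ᴾ g

  -- Euclid's algorithm by strong induction on the degree of `f`. Since `divMod` divides only by
  -- monic polynomials, every nonzero remainder is first scaled to a monic one, which accounts for
  -- the constants in the Bézout coefficients.
  extended-gcd : ∀ n f → MonicOfDegree n f → ∀ g → GCD f g
  extended-gcd = <-rec _ step
    where
    step : ∀ n → (∀ {m} → m ℕ.< n → ∀ f → MonicOfDegree m f → ∀ g → GCD f g) → ∀ f → MonicOfDegree n f → ∀ g → GCD f g
    step n rec f monic g with quot , rem , g≋ , deg-rem ← divMod f monic g with leading rem
    ... | null rem≋0 = record { d = f ; u = 1ᴾ ; v = [] ; bezout = P.trans (+ᴾ-identityʳ _) (PR.*-identityˡ f) ; d∣f = ∣ᴾ-refl
      ; d∣g = quot , P.sym (P.trans g≋ (P.trans (+ᴾ-cong P.refl rem≋0) (+ᴾ-identityʳ _))) }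
    ... | lead m rem≉0 deg with a , h , monic-h , h≋ , b , rem≋ ← normalise rem rem≉0 deg =
      record { d = d ; u = v +ᴾ (-ᴾ (u *ᴾ (C a *ᴾ quot))) ; v = u *ᴾ C a
        ; bezout = begin
            (v +ᴾ (-ᴾ (u *ᴾ (C a *ᴾ quot)))) *ᴾ f +ᴾ u *ᴾ C a *ᴾ g
              ≈⟨ +ᴾ-cong (P.refl {(v +ᴾ (-ᴾ (u *ᴾ (C a *ᴾ quot)))) *ᴾ f}) (PR.*-congˡ {u *ᴾ C a} g≋) ⟩
            (v +ᴾ (-ᴾ (u *ᴾ (C a *ᴾ quot)))) *ᴾ f +ᴾ u *ᴾ C a *ᴾ (quot *ᴾ f +ᴾ rem)
              ≈⟨ solve 6 (λ v u c q f r → (v :- u :* (c :* q)) :* f :+ u :* c :* (q :* f :+ r) := u :* (c :* r) :+ v :* f) P.refl v u (C a) quot f rem ⟩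
            u *ᴾ (C a *ᴾ rem) +ᴾ v *ᴾ f ≈⟨ +ᴾ-cong (PR.*-congˡ {u} h≋) P.refl ⟨
            u *ᴾ h +ᴾ v *ᴾ f            ≈⟨ bezout ⟩
            d                           ∎
        ; d∣f = d∣g
        ; d∣g = ∣ᴾ-resp (P.sym g≋) (∣ᴾ-+ (∣ᴾ-* quot d∣g) (∣ᴾ-resp (P.sym rem≋) (∣ᴾ-* (C b) d∣f))) }
      where
      open GCD (rec (ℕ.≰⇒> (λ n≤m → rem≉0 (deg-rem m n≤m))) h monic-h f)


  raw : ∀ {f g} → f ∣ᴾ g → SemiringDefs._∣_ polyRawSemiring f g
  raw (h , eq) = MagmaDefs._,_ h (_≋_._at_ eq)

  unraw : ∀ {f g} → SemiringDefs._∣_ polyRawSemiring f g → f ∣ᴾ g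
  unraw (h MagmaDefs., eq) = h , coeffs eq

  irreducible-resp : ∀ {f g} → f ≋ g → Irreducible f → Irreducible g
  irreducible-resp f≋g irreducible = record
    { p∤1 = λ g∣1 → let h , eq = unraw g∣1 in p∤1 (raw (h , P.trans (PR.*-congˡ {h} f≋g) eq))
    ; split-∣1 = λ {x} {y} eq → split-∣1 {x} {y} (P.trans f≋g (coeffs {g = x *ᴾ y} eq) at_)
    }
    where open SemiringDefs.Irreducible irreducible

  module _ {n : ℕ} {f : Poly} (monic : MonicOfDegree n f) (irreducible : Irreducible f) where
    private module I = SemiringDefs.Irreducible irreducible

    irreducible-split : ∀ g h → g *ᴾ h ≋ f → g ∣ᴾ 1ᴾ ⊎ h ∣ᴾ 1ᴾ
    irreducible-split g h eq = [ inj₁ ∘ unraw , inj₂ ∘ unraw ]′ (I.split-∣1 {g} {h} (P.sym eq at_))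

    irreducible-degree : n ≢ 0
    irreducible-degree ≡.refl = I.p∤1 (raw (1ᴾ , coeffs λ { zero → trans (PR.*-identityˡ f at 0) (proj₁ monic) ; (suc i) → trans (PR.*-identityˡ f at suc i) (proj₂ monic (suc i) ℕ.z<s) }))

    -- Write f = e d with d the greatest common divisor. If e is a unit, f divides d and hence g; if
    -- d is a unit, the Bézout identity can be scaled to 1. Euclid's lemma, inverses modulo f and
    -- minimality of f for its roots all come from this alternative.
    irreducible-bezout : ∀ g → f ∣ᴾ g ⊎ ∃₂ λ u v → u *ᴾ f +ᴾ v *ᴾ g ≋ 1ᴾ
    irreducible-bezout g = cases d∣f
      where
      open GCD (extended-gcd n f monic g)
      cases : d ∣ᴾ f → f ∣ᴾ g ⊎ ∃₂ λ u v → u *ᴾ f +ᴾ v *ᴾ g ≋ 1ᴾ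
      cases (e , ed≋f) with irreducible-split e d ed≋f
      ... | inj₁ (w , we≋1) = inj₁ (∣ᴾ-trans (w , (begin
        w *ᴾ f        ≈⟨ PR.*-congˡ {w} ed≋f ⟨
        w *ᴾ (e *ᴾ d) ≈⟨ PR.*-assoc w e d ⟨
        w *ᴾ e *ᴾ d   ≈⟨ PR.*-congʳ we≋1 ⟩
        1ᴾ *ᴾ d       ≈⟨ PR.*-identityˡ d ⟩
        d             ∎)) d∣g)
      ... | inj₂ (w , wd≋1) = inj₂ (w *ᴾ u , w *ᴾ v , (begin
        w *ᴾ u *ᴾ f +ᴾ w *ᴾ v *ᴾ g   ≈⟨ solve 5 (λ w u v f g → w :* u :* f :+ w :* v :* g := w :* (u :* f :+ v :* g)) P.refl w u v f g ⟩
        w *ᴾ (u *ᴾ f +ᴾ v *ᴾ g)      ≈⟨ PR.*-congˡ {w} bezout ⟩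
        w *ᴾ d                       ≈⟨ wd≋1 ⟩
        1ᴾ                           ∎))

    euclid : ∀ g h → f ∣ᴾ g *ᴾ h → f ∣ᴾ g ⊎ f ∣ᴾ h
    euclid g h f∣gh with irreducible-bezout g
    ... | inj₁ f∣g = inj₁ f∣g
    ... | inj₂ (u , v , eq) = inj₂ (∣ᴾ-resp (begin
      h *ᴾ (u *ᴾ f) +ᴾ v *ᴾ (g *ᴾ h)   ≈⟨ solve 5 (λ h u f v g → h :* (u :* f) :+ v :* (g :* h) := (u :* f :+ v :* g) :* h) P.refl h u f v g ⟩
      (u *ᴾ f +ᴾ v *ᴾ g) *ᴾ h          ≈⟨ PR.*-congʳ eq ⟩
      1ᴾ *ᴾ h                          ≈⟨ PR.*-identityˡ h ⟩
      h                                ∎) (∣ᴾ-+ (∣ᴾ-* h (∣ᴾ-* u ∣ᴾ-refl)) (∣ᴾ-* v f∣gh)))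

    irreducible-∤ : ∀ {m g} → MonicOfDegree m g → m ≢ 0 → m ≢ n → ¬ g ∣ᴾ f
    irreducible-∤ {m} {g} monic-g m≢0 m≢n (h , hg≋f) with irreducible-split h g hg≋f | cofactor-monic g h monic-g (monic-resp (P.sym hg≋f) monic)
    ... | inj₂ g∣1 | _ = ∤1 monic-g m≢0 g∣1
    ... | inj₁ h∣1 | k , k+m≡n , monic-h = ∤1 monic-h (λ { ≡.refl → m≢n k+m≡n }) h∣1

  -- Reducibility in a searchable form: over a finite field there are finitely many monic candidates
  -- of degree strictly between 0 and n, so irreducibility becomes decidable.
  ProperFactor : ℕ → Poly → Set (c ⊔ ℓ)
  ProperFactor n f = Σ[ m ∈ ℕ ] m ≢ 0 × m ℕ.< n × Σ[ g ∈ Poly ] MonicOfDegree m g × g ∣ᴾ f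

  irreducible⇒¬properFactor : ∀ {n f} → MonicOfDegree n f → Irreducible f → ¬ ProperFactor n f
  irreducible⇒¬properFactor monic irreducible (m , m≢0 , m<n , g , monic-g , g∣f) =
    irreducible-∤ monic irreducible monic-g m≢0 (ℕ.<⇒≢ m<n) g∣f

  constant-unit : ∀ {f} → ¬ coeff f 0 ≈ 0# → Degreeᴾ< 1 f → f ∣ᴾ 1ᴾ
  constant-unit {f} f≉0 deg with b , bt≈1 ← inverse f≉0 = C b , coeffs λ where
    zero → trans (C-* b f at 0) (trans (coeff-• b f 0) bt≈1)
    (suc i) → trans (C-* b f at suc i) (trans (coeff-• b f (suc i)) (trans (*-congˡ (deg (suc i) ℕ.z<s)) (zeroʳ b)))

  ¬properFactor⇒irreducible : ∀ {n f} → MonicOfDegree n f → n ≢ 0 → ¬ ProperFactor n f → Irreducible f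
  ¬properFactor⇒irreducible {n} {f} monic n≢0 ¬factor = record
    { p∤1 = ∤1 monic n≢0 ∘ unraw
    ; split-∣1 = λ {g} {h} eq → split g h (coeffs eq) (leading g) (leading h)
    }
    where
    split : ∀ g h → f ≋ g *ᴾ h → Leading g → Leading h → SemiringDefs._∣_ polyRawSemiring g 1ᴾ ⊎ SemiringDefs._∣_ polyRawSemiring h 1ᴾ
    split g h eq (null g≋0) _ = contradiction (P.trans eq (*ᴾ-zeroˡ g h g≋0)) (monic≉0 monic)
    split g h eq (lead _ _ _) (null h≋0) = contradiction (P.trans eq (P.trans (PR.*-congˡ {g} h≋0) (*ᴾ-zeroʳ g))) (monic≉0 monic)
    split g h eq (lead zero g≉0 deg-g) (lead _ _ _) = inj₁ (raw (constant-unit g≉0 deg-g))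
    split g h eq (lead (suc _) _ _) (lead zero h≉0 deg-h) = inj₂ (raw (constant-unit h≉0 deg-h))
    split g h eq (lead m@(suc _) g≉0 deg-g) (lead k@(suc _) h≉0 deg-h)
      with a , g′ , monic-g′ , g′≋ , b , g≋ ← normalise g g≉0 deg-g =
      contradiction (m , (λ ()) , m<n , g′ , monic-g′ , g′∣f) ¬factor
      where
      n≡m+k : n ≡ m ℕ.+ k
      n≡m+k = monic-top f monic
        (λ eq′ → g≉0 (*-cancelʳ-nonZero _ h≉0 (trans (sym (coeff-*-top g h deg-g deg-h)) (trans (sym (eq at _)) eq′))))
        (degreeᴾ<-resp (P.sym eq) (degreeᴾ<-* g h deg-g deg-h))
      m<n : m ℕ.< n
      m<n = ≡.subst (m ℕ.<_) (≡.sym n≡m+k) (ℕ.m<m+n m ℕ.z<s)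
      g′∣f : g′ ∣ᴾ f
      g′∣f = ∣ᴾ-resp (P.sym (P.trans eq (P.trans (PR.*-comm g h) (PR.*-congˡ {h} g≋)))) (∣ᴾ-* h (∣ᴾ-* (C b) ∣ᴾ-refl))

  -- `low` and `monicPoly` list representatives by coefficient vectors of length n: the former the
  -- residues modulo a polynomial of degree n, the latter the monic polynomials of degree n. Over F
  -- there are q^n of each.
  low : ∀ {n} → (Fin n → Carrier) → Poly
  low {zero} a = []
  low {suc n} a = a zero ∷ low (a ∘ suc)

  monicPoly : ∀ {n} → (Fin n → Carrier) → Poly
  monicPoly {zero} a = 1ᴾ
  monicPoly {suc n} a = a zero ∷ monicPoly (a ∘ suc)

  coeff-low : ∀ {n} (a : Fin n → Carrier) i → coeff (low a) (toℕ i) ≡ a i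
  coeff-low a zero = ≡.refl
  coeff-low a (suc i) = coeff-low (a ∘ suc) i

  degree-low : ∀ {n} (a : Fin n → Carrier) → Degreeᴾ< n (low a)
  degree-low {zero} a i _ = refl
  degree-low {suc n} a (suc i) (ℕ.s≤s n≤i) = degree-low (a ∘ suc) i n≤i

  low-coeff : ∀ {n} f (a : Fin n → Carrier) → Degreeᴾ< n f → (∀ i → a i ≈ coeff f (toℕ i)) → low a ≋ f
  low-coeff {zero} f a deg eq = coeffs λ i → sym (deg i ℕ.z≤n)
  low-coeff {suc n} [] a deg eq = P.trans (∷-cong (eq zero) (low-coeff [] (a ∘ suc) (λ _ _ → refl) (eq ∘ suc))) 0∷[]≈[]
  low-coeff {suc n} (b ∷ f) a deg eq = ∷-cong (eq zero) (low-coeff f (a ∘ suc) (λ i n≤i → deg (suc i) (ℕ.s≤s n≤i)) (eq ∘ suc))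

  coeff-monicPoly : ∀ {n} (a : Fin n → Carrier) i → coeff (monicPoly a) (toℕ i) ≡ a i
  coeff-monicPoly a zero = ≡.refl
  coeff-monicPoly a (suc i) = coeff-monicPoly (a ∘ suc) i

  monicPoly-monic : ∀ {n} (a : Fin n → Carrier) → MonicOfDegree n (monicPoly a)
  monicPoly-monic {zero} a = monic-1
  monicPoly-monic {suc n} a with top , deg ← monicPoly-monic (a ∘ suc) = top , λ { (suc i) (ℕ.s≤s n<i) → deg i n<i }

  monicPoly-coeff : ∀ {n} f (a : Fin n → Carrier) → MonicOfDegree n f → (∀ i → a i ≈ coeff f (toℕ i)) → monicPoly a ≋ f
  monicPoly-coeff {zero} f a (top , deg) eq = coeffs λ { zero → sym top ; (suc i) → sym (deg (suc i) ℕ.z<s) }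
  monicPoly-coeff {suc n} [] a (top , deg) eq = contradiction (sym top) 1≉0
  monicPoly-coeff {suc n} (b ∷ f) a (top , deg) eq = ∷-cong (eq zero) (monicPoly-coeff f (a ∘ suc) (top , λ i n<i → deg (suc i) (ℕ.s≤s n<i)) (eq ∘ suc))

-- The field F[x]/(f)

module QuotientField {c ℓ} (R : CommutativeRing c ℓ) (field? : IsDiscreteField R) (f : Polynomial.Poly R) (n : ℕ)
  (monic : Polynomial.MonicOfDegree R n f) (irreducible : Polynomial.Irreducible R f) where
  open PolynomialDivision R field?
  private
    module F = DiscreteField R field?
  open RingSolver polynomialRing using (solve; _:=_; _:+_; _:*_; _:-_; :-_)
  open F using (0#; 1#)

  remainder : Poly → Poly
  remainder g = proj₁ (proj₂ (divMod f monic g))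

  infix 4 _∼_
  -- Congruence modulo f, expressed by a vanishing remainder. Divisibility quantifies over
  -- polynomials and would raise the universe level, whereas `HasTrace` requires the equality of K
  -- at the level of that of F.
  record _∼_ (g h : Poly) : Set ℓ where
    constructor mk∼
    field remainder≋0 : remainder (g +ᴾ (-ᴾ h)) ≋ []
  open _∼_

  ∣⇒∼ : ∀ {g h} → f ∣ᴾ g +ᴾ (-ᴾ h) → g ∼ h
  ∣⇒∼ {g} {h} f∣ = mk∼ (proj₂ (rem≋0⇔∣ᴾ monic (g +ᴾ (-ᴾ h))) f∣)

  ∼⇒∣ : ∀ {g h} → g ∼ h → f ∣ᴾ g +ᴾ (-ᴾ h)
  ∼⇒∣ {g} {h} (mk∼ eq) = proj₁ (rem≋0⇔∣ᴾ monic (g +ᴾ (-ᴾ h))) eq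

  _∼?_ : ∀ g h → Dec (g ∼ h)
  g ∼? h = map′ mk∼ remainder≋0 (remainder (g +ᴾ (-ᴾ h)) ≋[]?)

  ≋⇒∼ : ∀ {g h} → g ≋ h → g ∼ h
  ≋⇒∼ {g} {h} g≋h = ∣⇒∼ ([] , P.sym (P.trans (+ᴾ-cong g≋h P.refl) (+ᴾ-inverseʳ h)))

  ∼-trans : ∀ {g h k} → g ∼ h → h ∼ k → g ∼ k
  ∼-trans {g} {h} {k} g∼h h∼k = ∣⇒∼ (∣ᴾ-resp (solve 3 (λ g h k → (g :- h) :+ (h :- k) := g :- k) P.refl g h k) (∣ᴾ-+ (∼⇒∣ g∼h) (∼⇒∣ h∼k)))

  ∼-sym : ∀ {g h} → g ∼ h → h ∼ g
  ∼-sym {g} {h} g∼h = ∣⇒∼ (∣ᴾ-resp (solve 2 (λ g h → :- (g :- h) := h :- g) P.refl g h) (∣ᴾ-neg (∼⇒∣ g∼h)))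

  ∼-+ : ∀ {g g′ h h′} → g ∼ g′ → h ∼ h′ → g +ᴾ h ∼ g′ +ᴾ h′
  ∼-+ {g} {g′} {h} {h′} g∼g′ h∼h′ = ∣⇒∼ (∣ᴾ-resp
    (solve 4 (λ g g′ h h′ → (g :- g′) :+ (h :- h′) := (g :+ h) :- (g′ :+ h′)) P.refl g g′ h h′) (∣ᴾ-+ (∼⇒∣ g∼g′) (∼⇒∣ h∼h′)))

  ∼-* : ∀ {g g′ h h′} → g ∼ g′ → h ∼ h′ → g *ᴾ h ∼ g′ *ᴾ h′
  ∼-* {g} {g′} {h} {h′} g∼g′ h∼h′ = ∣⇒∼ (∣ᴾ-resp
    (solve 4 (λ g g′ h h′ → h :* (g :- g′) :+ g′ :* (h :- h′) := g :* h :- g′ :* h′) P.refl g g′ h h′)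
    (∣ᴾ-+ (∣ᴾ-* h (∼⇒∣ g∼g′)) (∣ᴾ-* g′ (∼⇒∣ h∼h′))))

  ∼-neg : ∀ {g h} → g ∼ h → -ᴾ g ∼ -ᴾ h
  ∼-neg {g} {h} g∼h = ∣⇒∼ (∣ᴾ-resp (solve 2 (λ g h → :- (g :- h) := (:- g) :- (:- h)) P.refl g h) (∣ᴾ-neg (∼⇒∣ g∼h)))

  quotientRing : CommutativeRing c ℓ
  quotientRing = record
    { Carrier = Poly ; _≈_ = _∼_ ; _+_ = _+ᴾ_ ; _*_ = _*ᴾ_ ; -_ = -ᴾ_ ; 0# = [] ; 1# = 1ᴾ
    ; isCommutativeRing = record
      { isRing = record
        { +-isAbelianGroup = record
          { isGroup = record
            { isMonoid = record
              { isSemigroup = record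
                { isMagma = record { isEquivalence = record { refl = ≋⇒∼ P.refl ; sym = ∼-sym ; trans = ∼-trans } ; ∙-cong = ∼-+ }
                ; assoc = λ g h k → ≋⇒∼ (PR.+-assoc g h k) }
              ; identity = (λ g → ≋⇒∼ (PR.+-identityˡ g)) , λ g → ≋⇒∼ (PR.+-identityʳ g) }
            ; inverse = (λ g → ≋⇒∼ (PR.-‿inverseˡ g)) , λ g → ≋⇒∼ (PR.-‿inverseʳ g)
            ; ⁻¹-cong = ∼-neg }
          ; comm = λ g h → ≋⇒∼ (PR.+-comm g h) }
        ; *-cong = ∼-*
        ; *-assoc = λ g h k → ≋⇒∼ (PR.*-assoc g h k)
        ; *-identity = (λ g → ≋⇒∼ (PR.*-identityˡ g)) , λ g → ≋⇒∼ (PR.*-identityʳ g)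
        ; distrib = (λ g h k → ≋⇒∼ (PR.distribˡ g h k)) , λ g h k → ≋⇒∼ (PR.distribʳ g h k)
        }
      ; *-comm = λ g h → ≋⇒∼ (PR.*-comm g h) }
    }

  ∼0⇒∣ : ∀ {g} → g ∼ [] → f ∣ᴾ g
  ∼0⇒∣ {g} g∼0 = ∣ᴾ-resp (PR.+-identityʳ g) (∼⇒∣ g∼0)

  ∣⇒∼0 : ∀ {g} → f ∣ᴾ g → g ∼ []
  ∣⇒∼0 {g} f∣g = ∣⇒∼ (∣ᴾ-resp (P.sym (PR.+-identityʳ g)) f∣g)

  invertible : ∀ g → ¬ g ∼ [] → ∃[ h ] h *ᴾ g ∼ 1ᴾ
  invertible g g≁0 with irreducible-bezout monic irreducible g
  ... | inj₁ f∣g = contradiction (∣⇒∼0 f∣g) g≁0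
  ... | inj₂ (u , v , eq) = v , ∼-trans
    (∣⇒∼ (∣ᴾ-resp (solve 2 (λ a b → :- a := b :- (a :+ b)) P.refl (u *ᴾ f) (v *ᴾ g)) (∣ᴾ-neg (u , P.refl)))) (≋⇒∼ eq)

  1≁0 : ¬ 1ᴾ ∼ []
  1≁0 1∼0 = ∤1 monic (irreducible-degree monic irreducible) (∼0⇒∣ 1∼0)

  module _ (ℓ₂ : Level) where
    infix 4 _♯_
    -- Inequality has the level of the equality, but the apartness must live at the prescribed level
    -- ℓ₂. Deciding the congruence first turns its negation into a small type, which can be lifted
    -- to any level.
    _♯_ : Poly → Poly → Set ℓ₂
    g ♯ h = Lift ℓ₂ (False (g ∼? h))

    ♯⇒≁ : ∀ {g h} → g ♯ h → ¬ g ∼ h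
    ♯⇒≁ (lift g♯h) = toWitnessFalse g♯h

    ≁⇒♯ : ∀ {g h} → ¬ g ∼ h → g ♯ h
    ≁⇒♯ g≁h = lift (fromWitnessFalse g≁h)

    ∼⇒-∼0 : ∀ {g h} → g ∼ h → g +ᴾ (-ᴾ h) ∼ []
    ∼⇒-∼0 g∼h = ∣⇒∼0 (∼⇒∣ g∼h)

    quotientField : HeytingField c ℓ ℓ₂
    quotientField = record
      { Carrier = Poly ; _≈_ = _∼_ ; _#_ = _♯_ ; _+_ = _+ᴾ_ ; _*_ = _*ᴾ_ ; -_ = -ᴾ_ ; 0# = [] ; 1# = 1ᴾ
      ; isHeytingField = record
        { isHeytingCommutativeRing = record
          { isCommutativeRing = CommutativeRing.isCommutativeRing quotientRing
          ; isApartnessRelation = record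
            { irrefl = λ g∼h g♯h → ♯⇒≁ g♯h g∼h
            ; sym = λ g♯h → ≁⇒♯ (λ h∼g → ♯⇒≁ g♯h (∼-sym h∼g))
            ; cotrans = cotrans
            }
          ; #⇒invertible = λ {g} {h} g♯h →
              let k , eq = invertible (g +ᴾ (-ᴾ h)) (λ g-h∼0 → ♯⇒≁ g♯h (∣⇒∼ (∼0⇒∣ g-h∼0)))
              in k , eq , ∼-trans (≋⇒∼ (PR.*-comm (g +ᴾ (-ᴾ h)) k)) eq
          ; invertible⇒# = λ {g} {h} (k , eq , _) → ≁⇒♯ λ g∼h → 1≁0
              (∼-trans (∼-sym eq) (∼-trans (∼-* {k} (≋⇒∼ P.refl) (∼⇒-∼0 g∼h)) (≋⇒∼ (PR.zeroʳ k))))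
          }
        ; tight = λ g h → (λ ¬g♯h → decidable-stable (g ∼? h) (λ g≁h → ¬g♯h (≁⇒♯ g≁h))) , λ g∼h g♯h → ♯⇒≁ g♯h g∼h
        }
      }
      where
      cotrans : ∀ {g h} → g ♯ h → ∀ k → g ♯ k ⊎ k ♯ h
      cotrans {g} {h} g♯h k = cases (g ∼? k)
        where
        cases : Dec (g ∼ k) → g ♯ k ⊎ k ♯ h
        cases (no g≁k) = inj₁ (≁⇒♯ g≁k)
        cases (yes g∼k) = inj₂ (≁⇒♯ λ k∼h → ♯⇒≁ g♯h (∼-trans g∼k k∼h))

  C-homomorphism : IsRingHomomorphism (CommutativeRing.rawRing R) (CommutativeRing.rawRing quotientRing) C
  C-homomorphism = record
    { isSemiringHomomorphism = record
      { isNearSemiringHomomorphism = record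
        { +-isMonoidHomomorphism = record
          { isMagmaHomomorphism = record
            { isRelHomomorphism = record { cong = λ a≈b → ≋⇒∼ (∷-cong a≈b P.refl) }
            ; homo = λ a b → ≋⇒∼ P.refl }
          ; ε-homo = ≋⇒∼ 0∷[]≈[] }
        ; *-homo = λ a b → ≋⇒∼ (P.sym (C-* a (C b))) }
      ; 1#-homo = ≋⇒∼ P.refl }
    ; -‿homo = λ a → ≋⇒∼ P.refl }

  X : Poly
  X = x* 1ᴾ

  -- Evaluation at the variable returns the polynomial itself, already before reduction, and f is
  -- zero modulo f.
  X-root : HomomorphicEvaluation.evalAt R quotientRing C X f ∼ []
  X-root = ∼-trans (≋⇒∼ (eval-X f)) (∣⇒∼0 ∣ᴾ-refl)
    where
    eval-X : ∀ g → HomomorphicEvaluation.evalAt R quotientRing C X g ≋ g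
    eval-X [] = P.refl
    eval-X (a ∷ g) = begin
      C a +ᴾ X *ᴾ h                ≈⟨ +ᴾ-cong (P.refl {C a}) (P.trans (x*-* 1ᴾ h) (∷-cong F.refl (P.trans (PR.*-identityˡ h) (eval-X g)))) ⟩
      (a F.+ 0#) ∷ g               ≈⟨ ∷-cong (F.+-identityʳ a) P.refl ⟩
      a ∷ g                        ∎
      where
      h = HomomorphicEvaluation.evalAt R quotientRing C X g
      open import Relation.Binary.Reasoning.Setoid ≋-setoid

  module _ (q : ℕ) (card : HasCardinality (CommutativeRing.setoid R) q) where
    open Enumeration (CommutativeRing.setoid R) q card

    remainder-degree : ∀ g → Degreeᴾ< n (remainder g)
    remainder-degree g = proj₂ (proj₂ (proj₂ (divMod f monic g)))

    remainder-∼ : ∀ g → remainder g ∼ g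
    remainder-∼ g = let quot , rem , g≋ , _ = divMod f monic g in
      ∼-sym (∣⇒∼ (quot , P.sym (P.trans (+ᴾ-cong g≋ P.refl) (solve 2 (λ u v → u :+ v :- v := u) P.refl (quot *ᴾ f) rem))))

    small-∼ : ∀ {g h} → Degreeᴾ< n g → Degreeᴾ< n h → g ∼ h → g ≋ h
    small-∼ {g} {h} deg-g deg-h g∼h = x∙y⁻¹≈ε⇒x≈y g h (divisor-small monic (∼⇒∣ g∼h) (degreeᴾ<-- g h deg-g deg-h))
      where open import Algebra.Properties.Ring PR.ring using (x∙y⁻¹≈ε⇒x≈y)

    toFin : Poly → Fin (q ℕ.^ n)
    toFin g = funToFin {n} (λ i → index (coeff (remainder g) (toℕ i)))

    fromFin′ : Fin (q ℕ.^ n) → Poly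
    fromFin′ i = low (elem ∘ finToFun {q} {n} i)

    -- Remainders represent the classes, uniquely so: a difference of two of them that is divisible
    -- by f has degree below n and is zero.
    quotient-cardinality : HasCardinality (CommutativeRing.setoid quotientRing) (q ℕ.^ n)
    quotient-cardinality = record
      { to = toFin
      ; from = fromFin′
      ; to-cong = toFin-cong
      ; from-cong = λ { ≡.refl → ≋⇒∼ P.refl }
      ; inverse = (λ {i} g∼ → ≡.trans (toFin-cong g∼) (toFin-fromFin i)) , λ { {g} ≡.refl → fromFin-toFin g }
      }
      where
      remainder-cong : ∀ {g h} → g ∼ h → remainder g ≋ remainder h
      remainder-cong {g} {h} g∼h = small-∼ (remainder-degree g) (remainder-degree h) (∼-trans (remainder-∼ g) (∼-trans g∼h (∼-sym (remainder-∼ h))))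
      toFin-cong : ∀ {g h} → g ∼ h → toFin g ≡ toFin h
      toFin-cong g∼h = funToFin-cong {n} (λ i → index-cong (remainder-cong g∼h at toℕ i))
      toFin-fromFin : ∀ i → toFin (fromFin′ i) ≡ i
      toFin-fromFin i = ≡.trans (funToFin-cong {n} (λ j → ≡.trans
          (index-cong (F.trans (small-∼ (remainder-degree (low a)) (degree-low a) (remainder-∼ (low a)) at toℕ j) (F.reflexive (coeff-low a j))))
          (index-elem _)))
        (Fin.funToFin-finToFin {n} {q} i)
        where
        a : Fin n → F.Carrier
        a = elem ∘ finToFun {q} {n} i
      fromFin-toFin : ∀ g → fromFin′ (toFin g) ∼ g
      fromFin-toFin g = ∼-trans (≋⇒∼ (low-coeff (remainder g) _ (remainder-degree g)
        (λ i → F.trans (F.reflexive (≡.cong elem (Fin.finToFun-funToFin {n} {q} _ i))) (elem-index _)))) (remainder-∼ g)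

-- Evaluation in an extension field and the trace of a root

module FieldExtension {c ℓ c′ ℓ′} (R : CommutativeRing c ℓ) (R-field : IsDiscreteField R) (K : CommutativeRing c′ ℓ′) (K-field : IsDiscreteField K)
  (ι : CommutativeRing.Carrier R → CommutativeRing.Carrier K)
  (ι-hom : IsRingHomomorphism (CommutativeRing.rawRing R) (CommutativeRing.rawRing K) ι) where
  open DiscreteField K K-field
  open PolynomialFunctions K K-field
  private module F = DiscreteField R R-field
  open PolynomialDivision R R-field using (coeff; _≋_; _at_; coeffs; tail-≋; tail-≋0; _•_; _+ᴾ_; _*ᴾ_; Degreeᴾ<; module P; 1ᴾ)
  open HomomorphicEvaluation R K ι public
  open IsRingHomomorphism ι-hom using (+-homo; *-homo; 0#-homo; 1#-homo) renaming (⟦⟧-cong to ι-cong)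
  open import Relation.Binary.Reasoning.Setoid setoid

  ι-injective : ∀ {x} → ι x ≈ 0# → x F.≈ F.0#
  ι-injective {x} ιx≈0 with x F.≟ F.0#
  ... | yes x≈0 = x≈0
  ... | no x≉0 = let y , yx≈1 = F.inverse x≉0 in contradiction (begin
    1#           ≈⟨ 1#-homo ⟨
    ι F.1#       ≈⟨ ι-cong yx≈1 ⟨
    ι (y F.* x)  ≈⟨ *-homo y x ⟩
    ι y * ι x    ≈⟨ *-congˡ ιx≈0 ⟩
    ι y * 0#     ≈⟨ zeroʳ _ ⟩
    0#           ∎) 1≉0

  ι-· : ∀ m → ι (m F.· F.1#) ≈ m · 1#
  ι-· zero = 0#-homo
  ι-· (suc m) = trans (+-homo _ _) (+-cong 1#-homo (ι-· m))

  ι-^ : ∀ x m → ι (x F.^ m) ≈ ι x ^ m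
  ι-^ x zero = 1#-homo
  ι-^ x (suc m) = trans (*-homo _ _) (*-congˡ (ι-^ x m))

  ι-sum : ∀ {m} (f : Fin m → F.Carrier) → ι (F.sum f) ≈ sum (ι ∘ f)
  ι-sum {zero} f = 0#-homo
  ι-sum {suc m} f = trans (+-homo _ _) (+-congˡ (ι-sum (f ∘ suc)))

  characteristic : ∀ {p} → HasCharacteristic R p → HasCharacteristic K p
  characteristic char m = mk⇔
    (λ m≈0 → Equivalence.to (char m) (ι-injective (trans (ι-· m) m≈0)))
    (λ p∣m → trans (sym (ι-· m)) (trans (ι-cong (Equivalence.from (char m) p∣m)) 0#-homo))

  evalAt-0 : ∀ x {g} → g ≋ [] → evalAt x g ≈ 0#
  evalAt-0 x {[]} _ = refl
  evalAt-0 x {a ∷ g} g≋0 = trans (+-cong (trans (ι-cong (g≋0 at 0)) 0#-homo) (trans (*-congˡ (evalAt-0 x {g} (tail-≋0 g≋0))) (zeroʳ x))) (+-identityʳ 0#)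

  evalAt-cong : ∀ x {g h} → g ≋ h → evalAt x g ≈ evalAt x h
  evalAt-cong x {[]} {h} eq = sym (evalAt-0 x (P.sym eq))
  evalAt-cong x {a ∷ g} {[]} eq = evalAt-0 x eq
  evalAt-cong x {a ∷ g} {b ∷ h} eq = +-cong (ι-cong (eq at 0)) (*-congˡ (evalAt-cong x {g} {h} (tail-≋ eq)))

  evalAt-+ : ∀ x g h → evalAt x (g +ᴾ h) ≈ evalAt x g + evalAt x h
  evalAt-+ x [] h = sym (+-identityˡ _)
  evalAt-+ x (a ∷ g) [] = sym (+-identityʳ _)
  evalAt-+ x (a ∷ g) (b ∷ h) = trans (+-cong (+-homo a b) (*-congˡ (evalAt-+ x g h)))
    (solve 5 (λ a b x g h → (a :+ b) :+ x :* (g :+ h) := (a :+ x :* g) :+ (b :+ x :* h)) refl (ι a) (ι b) x _ _)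

  evalAt-• : ∀ x a g → evalAt x (a • g) ≈ ι a * evalAt x g
  evalAt-• x a [] = sym (zeroʳ _)
  evalAt-• x a (b ∷ g) = trans (+-cong (*-homo a b) (*-congˡ (evalAt-• x a g)))
    (solve 4 (λ a b x g → a :* b :+ x :* (a :* g) := a :* (b :+ x :* g)) refl (ι a) (ι b) x _)

  evalAt-* : ∀ x g h → evalAt x (g *ᴾ h) ≈ evalAt x g * evalAt x h
  evalAt-* x [] h = sym (zeroˡ _)
  evalAt-* x (a ∷ g) h = begin
    evalAt x (a • h +ᴾ (F.0# ∷ g *ᴾ h))                      ≈⟨ evalAt-+ x (a • h) (F.0# ∷ g *ᴾ h) ⟩
    evalAt x (a • h) + (ι F.0# + x * evalAt x (g *ᴾ h))      ≈⟨ +-cong (evalAt-• x a h) (trans (+-congʳ 0#-homo) (trans (+-identityˡ _) (*-congˡ (evalAt-* x g h)))) ⟩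
    ι a * evalAt x h + x * (evalAt x g * evalAt x h)         ≈⟨ solve 4 (λ a h x g → a :* h :+ x :* (g :* h) := (a :+ x :* g) :* h) refl (ι a) (evalAt x h) x (evalAt x g) ⟩
    (ι a + x * evalAt x g) * evalAt x h                      ∎

  evalAt-1 : ∀ x → evalAt x 1ᴾ ≈ 1#
  evalAt-1 x = trans (+-cong 1#-homo (zeroʳ x)) (+-identityʳ 1#)

  -- Splits off the two highest coefficients in the same shape as `product-of-linear`, so that the
  -- two expansions can be subtracted inside `leading≈0`.
  evalAt-leading : ∀ m g → Degreeᴾ< (suc (suc m)) g →
    ∃[ θ ] Degree< m θ × (∀ x → evalAt x g ≈ θ x + ι (coeff g m) * x ^ m + ι (coeff g (suc m)) * x ^ suc m)
  evalAt-leading m [] deg = (λ _ → 0#) , degree<-0 , λ x → sym (trans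
    (+-cong (trans (+-identityˡ _) (ι0*≈0 _)) (ι0*≈0 _)) (+-identityʳ 0#))
    where
    ι0*≈0 : ∀ y → ι F.0# * y ≈ 0#
    ι0*≈0 y = trans (*-congʳ 0#-homo) (zeroˡ y)
  evalAt-leading zero (a ∷ g) deg = (λ _ → 0#) , degree<-0 , λ x → begin
    ι a + x * evalAt x g                          ≈⟨ +-congˡ (*-congˡ (evalAt-cong x {g} {coeff g 0 ∷ []} (coeffs λ { zero → F.refl ; (suc i) → deg (suc (suc i)) (ℕ.s≤s (ℕ.s≤s ℕ.z≤n)) }))) ⟩
    ι a + x * (ι (coeff g 0) + x * 0#)            ≈⟨ +-cong (trans (sym (*-identityʳ _)) (sym (+-identityˡ _))) (trans (*-congˡ (trans (+-congˡ (zeroʳ x)) (+-identityʳ _))) (trans (*-comm _ _) (*-congˡ (sym (*-identityʳ x))))) ⟩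
    0# + ι a * 1# + ι (coeff g 0) * (x * 1#)      ∎
  evalAt-leading (suc m) (a ∷ g) deg with θ , deg-θ , eq ← evalAt-leading m g (λ i m<i → deg (suc i) (ℕ.s≤s m<i)) =
    (λ x → ι a * x ^ 0 + x * θ x) , degree<-+ (degree<-≤ (ℕ.s≤s ℕ.z≤n) (degree<-scale (ι a) (degree<-^ 0))) (degree<-shift deg-θ) , λ x → begin
    ι a + x * evalAt x g                          ≈⟨ +-cong (sym (*-identityʳ _)) (*-congˡ (eq x)) ⟩
    ι a * 1# + x * (θ x + ι (coeff g m) * x ^ m + ι (coeff g (suc m)) * x ^ suc m)
      ≈⟨ solve 7 (λ a x t b y d z → a :+ x :* (t :+ b :* y :+ d :* z) := (a :+ x :* t) :+ b :* (x :* y) :+ d :* (x :* z)) refl (ι a * 1#) x (θ x) (ι (coeff g m)) (x ^ m) (ι (coeff g (suc m))) (x ^ suc m) ⟩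
    (ι a * 1# + x * θ x) + ι (coeff g m) * x ^ suc m + ι (coeff g (suc m)) * x ^ suc (suc m) ∎

module TraceOfRoot {c ℓ c′ ℓ′} (R : CommutativeRing c ℓ) (R-field : IsDiscreteField R) (p : ℕ) (p≢0 : NonZero p) (char : HasCharacteristic R p)
  (q : ℕ) (card : HasCardinality (CommutativeRing.setoid R) q) (K : CommutativeRing c′ ℓ′) (K-field : IsDiscreteField K)
  (ι : CommutativeRing.Carrier R → CommutativeRing.Carrier K)
  (ι-hom : IsRingHomomorphism (CommutativeRing.rawRing R) (CommutativeRing.rawRing K) ι) where
  open DiscreteField K K-field
  open PolynomialFunctions K K-field
  open FieldExtension R R-field K K-field ι ι-hom
  private
    module F where
      open DiscreteField R R-field public
      open FiniteField R R-field p p≢0 char q card public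
  open Frobenius K K-field p p≢0 (characteristic char)
  open F using (r; elem)
  open PolynomialDivision R R-field using (Poly; coeff; _≋_; _at_; _+ᴾ_; _*ᴾ_; -ᴾ_; Degreeᴾ<; MonicOfDegree; Irreducible; 1ᴾ;
    irreducible-bezout; irreducible-degree; divisor-small; low; degree-low; coeff-low; degreeᴾ<--)
  open IsRingHomomorphism ι-hom using (1#-homo) renaming (⟦⟧-cong to ι-cong; -‿homo to ι-neg)
  open import Relation.Binary.Reasoning.Setoid setoid

  φ-∘ : ∀ j k x → φ (j ℕ.+ k) x ≈ φ k (φ j x)
  φ-∘ j k x = trans (reflexive (≡.cong (x ^_) (ℕ.^-distribˡ-+-* p j k))) (sym (^-assocʳ x (p ℕ.^ j) (p ℕ.^ k)))

  φʳⁱ-ι : ∀ i a → φ (i ℕ.* r) (ι a) ≈ ι a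
  φʳⁱ-ι zero a = *-identityʳ _
  φʳⁱ-ι (suc i) a = trans (φ-∘ r (i ℕ.* r) (ι a)) (trans (φ-cong (i ℕ.* r) (trans (sym (ι-^ a (p ℕ.^ r))) (ι-cong (F.φʳ-id a)))) (φʳⁱ-ι i a))

  -- Raising to the power qⁱ is a ring homomorphism that fixes the image of F, hence commutes with
  -- evaluation and sends roots to roots.
  evalAt-φ : ∀ i x g → evalAt (φ (i ℕ.* r) x) g ≈ φ (i ℕ.* r) (evalAt x g)
  evalAt-φ i x [] = sym (φ-0 (i ℕ.* r))
  evalAt-φ i x (a ∷ g) = begin
    ι a + φ j x * evalAt (φ j x) g        ≈⟨ +-cong (sym (φʳⁱ-ι i a)) (*-congˡ (evalAt-φ i x g)) ⟩
    φ j (ι a) + φ j x * φ j (evalAt x g)  ≈⟨ +-congˡ (φ-* j x _) ⟨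
    φ j (ι a) + φ j (x * evalAt x g)      ≈⟨ φ-+ j _ _ ⟨
    φ j (ι a + x * evalAt x g)            ∎
    where j = i ℕ.* r

  trace-sum : ∀ k {m} (f : Fin m → Carrier) → trace k (sum f) ≈ sum (trace k ∘ f)
  trace-sum k {zero} f = trace-0 k
  trace-sum k {suc m} f = trans (trace-+ k _ _) (+-congˡ (trace-sum k (f ∘ suc)))

  -- Transitivity of the trace: the exponents below n r are grouped into n blocks of length r, one
  -- for each conjugate.
  trace-conjugates : ∀ n x → trace (n ℕ.* r) x ≈ trace r (sum {n} (λ i → φ (toℕ i ℕ.* r) x))
  trace-conjugates n x = trans (split n x) (sym (trace-sum r (λ (i : Fin n) → φ (toℕ i ℕ.* r) x)))
    where
    split : ∀ n x → trace (n ℕ.* r) x ≈ sum {n} (λ i → trace r (φ (toℕ i ℕ.* r) x))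
    split zero x = refl
    split (suc n) x = trans (trace-split r (n ℕ.* r) x) (+-cong (trace-cong r (sym (*-identityʳ x)))
      (trans (split n (φ r x)) (sum-cong-≋ (λ (i : Fin n) → trace-cong r (sym (φ-∘ r (toℕ i ℕ.* r) x))))))

  q^≡ : ∀ m → q ℕ.^ m ≡ p ℕ.^ (m ℕ.* r)
  q^≡ m = ≡.trans (≡.cong (ℕ._^ m) (proj₂ F.q≡pʳ)) (≡.trans (ℕ.^-*-assoc p r m) (≡.cong (p ℕ.^_) (ℕ.*-comm r m)))

  module _ (n : ℕ) (f : Poly) (monic : MonicOfDegree n f) (irreducible : Irreducible f) (α : Carrier) (α-root : evalAt α f ≈ 0#) where

    -- f is the minimal polynomial of α: if f did not divide g, evaluating a Bézout identity at α
    -- would give 1 = 0.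
    small-root : ∀ g → Degreeᴾ< n g → evalAt α g ≈ 0# → g ≋ []
    small-root g deg root with irreducible-bezout monic irreducible g
    ... | inj₁ f∣g = divisor-small monic f∣g deg
    ... | inj₂ (u , v , eq) = contradiction (begin
      1#                                                   ≈⟨ evalAt-1 α ⟨
      evalAt α 1ᴾ                                          ≈⟨ evalAt-cong α eq ⟨
      evalAt α (u *ᴾ f +ᴾ v *ᴾ g)                          ≈⟨ evalAt-+ α (u *ᴾ f) (v *ᴾ g) ⟩
      evalAt α (u *ᴾ f) + evalAt α (v *ᴾ g)                ≈⟨ +-cong (evalAt-* α u f) (evalAt-* α v g) ⟩
      evalAt α u * evalAt α f + evalAt α v * evalAt α g    ≈⟨ +-cong (trans (*-congˡ α-root) (zeroʳ _)) (trans (*-congˡ root) (zeroʳ _)) ⟩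
      0# + 0#                                              ≈⟨ +-identityʳ 0# ⟩
      0#                                                   ∎) 1≉0

    element : Fin (q ℕ.^ n) → Carrier
    element i = evalAt α (low (elem ∘ finToFun {q} {n} i))

    element-injective : ∀ i j → element i ≈ element j → i ≡ j
    element-injective i j eq = ≡.trans (≡.sym (Fin.funToFin-finToFin {n} {q} i)) (≡.trans
      (funToFin-cong {n} (λ k → F.elem-injective (≡.subst₂ F._≈_ (coeff-low (a i) k) (coeff-low (a j) k) (low≋ at toℕ k))))
      (Fin.funToFin-finToFin {n} {q} j))
      where
      open import Algebra.Properties.Ring (CommutativeRing.ring (PolynomialRing.polynomialRing R)) using (x∙y⁻¹≈ε⇒x≈y)
      a : Fin (q ℕ.^ n) → Fin n → F.Carrier
      a i = elem ∘ finToFun {q} {n} i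
      low≋ : low (a i) ≋ low (a j)
      low≋ = x∙y⁻¹≈ε⇒x≈y _ _ (small-root (low (a i) +ᴾ (-ᴾ low (a j))) (degreeᴾ<-- (low (a i)) (low (a j)) (degree-low (a i)) (degree-low (a j)))
        (trans (evalAt-+ α (low (a i)) (-ᴾ low (a j))) (trans (+-cong eq (evalAt-neg α (low (a j)))) (-‿inverseʳ _))))
        where
        evalAt-neg : ∀ x g → evalAt x (-ᴾ g) ≈ - evalAt x g
        evalAt-neg x g = inverseˡ-unique _ _ (trans (sym (evalAt-+ x (-ᴾ g) g)) (evalAt-0 x (CommutativeRing.-‿inverseˡ (PolynomialRing.polynomialRing R) g)))
          where open import Algebra.Properties.Group +-group using (inverseˡ-unique)

    -- If φ (m r) fixes α then it fixes all qⁿ elements of F[α], yet it has at most qᵐ fixed points.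
    no-small-period : ∀ m → m ≢ 0 → m ℕ.< n → ¬ φ (m ℕ.* r) α ≈ α
    no-small-period m m≢0 m<n fixed = 1≉0 (leading≈0 ρ degree
      (λ i j eq → Fin.inject≤-injective qᵐ<qⁿ qᵐ<qⁿ i j (element-injective _ _ eq)) root)
      where
      Q = p ℕ.^ (m ℕ.* r)
      qᵐ<qⁿ : Q ℕ.< q ℕ.^ n
      qᵐ<qⁿ = ≡.subst (ℕ._< q ℕ.^ n) (q^≡ m) (ℕ.^-monoʳ-< q F.1<q m<n)
      ρ : Fin (suc Q) → Carrier
      ρ i = element (Fin.inject≤ i qᵐ<qⁿ)
      1<Q : 1 ℕ.< Q
      1<Q = ≡.subst (1 ℕ.<_) (q^≡ m) (ℕ.^-monoʳ-< q F.1<q (ℕ.n≢0⇒n>0 m≢0))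
      degree : Degree< Q (λ y → (- 1#) * (y ^ 1))
      degree = degree<-≤ 1<Q (degree<-scale (- 1#) (degree<-^ 1))
      element-fixed : ∀ i → φ (m ℕ.* r) (element i) ≈ element i
      element-fixed i = trans (sym (evalAt-φ m α g)) (evalAt-point g fixed)
        where
        g = low (elem ∘ finToFun {q} {n} i)
        evalAt-point : ∀ {x y} g → x ≈ y → evalAt x g ≈ evalAt y g
        evalAt-point [] x≈y = refl
        evalAt-point (a ∷ g) x≈y = +-congˡ (*-cong x≈y (evalAt-point g x≈y))
      root : ∀ i → (- 1#) * (ρ i ^ 1) + 1# * ρ i ^ Q ≈ 0#
      root i = begin
        (- 1#) * (y * 1#) + 1# * y ^ Q ≈⟨ +-cong (*-congˡ (*-identityʳ y)) (*-congˡ (element-fixed _)) ⟩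
        (- 1#) * y + 1# * y            ≈⟨ distribʳ y (- 1#) 1# ⟨
        (- 1# + 1#) * y                ≈⟨ *-congʳ (-‿inverseˡ 1#) ⟩
        0# * y                         ≈⟨ zeroˡ y ⟩
        0#                             ∎
        where y = ρ i

    conjugate : Fin n → Carrier
    conjugate i = φ (toℕ i ℕ.* r) α

    conjugate-root : ∀ i → evalAt (conjugate i) f ≈ 0#
    conjugate-root i = trans (evalAt-φ (toℕ i) α f) (trans (φ-cong (toℕ i ℕ.* r) α-root) (φ-0 (toℕ i ℕ.* r)))

    -- Frobenius is injective, so the common power qⁱ cancels and leaves a period j - i of α, which
    -- is positive and smaller than n.
    conjugate-≉ : ∀ {i j : Fin n} → toℕ i ℕ.< toℕ j → ¬ conjugate i ≈ conjugate j
    conjugate-≉ {i} {j} i<j eq = no-small-period m (ℕ.m>n⇒m∸n≢0 i<j) (ℕ.≤-<-trans (ℕ.m∸n≤m (toℕ j) (toℕ i)) (Fin.toℕ<n j))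
      (φ-injective (toℕ i ℕ.* r) (begin
        φ (toℕ i ℕ.* r) (φ (m ℕ.* r) α)       ≈⟨ φ-∘ (m ℕ.* r) (toℕ i ℕ.* r) α ⟨
        φ (m ℕ.* r ℕ.+ toℕ i ℕ.* r) α         ≡⟨ ≡.cong (λ k → φ k α) (ℕ.*-distribʳ-+ r m (toℕ i)) ⟨
        φ ((m ℕ.+ toℕ i) ℕ.* r) α             ≡⟨ ≡.cong (λ k → φ (k ℕ.* r) α) (ℕ.m∸n+n≡m (ℕ.<⇒≤ i<j)) ⟩
        conjugate j                           ≈⟨ eq ⟨
        conjugate i                           ∎))
      where m = toℕ j ℕ.∸ toℕ i

    conjugate-distinct : Distinct conjugate
    conjugate-distinct i j eq with ℕ.<-cmp (toℕ i) (toℕ j)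
    ... | tri≈ _ i≡j _ = Fin.toℕ-injective i≡j
    ... | tri< i<j _ _ = contradiction eq (conjugate-≉ i<j)
    ... | tri> _ _ j<i = contradiction (sym eq) (conjugate-≉ j<i)

  -- f and the product of the x − conjugate i differ by a polynomial of degree < n with n roots.
  conjugates-sum : ∀ m f (monic : MonicOfDegree (suc m) f) (irreducible : Irreducible f) α (α-root : evalAt α f ≈ 0#) →
    sum (conjugate (suc m) f monic irreducible α α-root) ≈ - ι (coeff f m)
  conjugates-sum m f monic@(top , deg) irreducible α α-root =
    inverseʳ-unique (ι (coeff f m)) s (leading≈0 ρ (degree<-+ deg-θ (degree<-scale (- 1#) deg-ψ)) (conjugate-distinct (suc m) f monic irreducible α α-root) root)
    where
    open import Algebra.Properties.Group +-group using (inverseʳ-unique)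
    open import Algebra.Properties.Ring ring using (-1*x≈-x)
    ρ = conjugate (suc m) f monic irreducible α α-root
    s = sum ρ
    product = product-of-linear ρ
    ψ = proj₁ (proj₂ product)
    deg-ψ = proj₁ (proj₂ (proj₂ (proj₂ product)))
    f-split = evalAt-leading m f deg
    θ = proj₁ f-split
    deg-θ = proj₁ (proj₂ f-split)
    root : ∀ i → (θ (ρ i) + (- 1#) * ψ (ρ i)) + (ι (coeff f m) + s) * ρ i ^ m ≈ 0#
    root i = begin
      (θ x + (- 1#) * ψ x) + (ι (coeff f m) + s) * x ^ m
        ≈⟨ +-congʳ (+-congˡ (-1*x≈-x (ψ x))) ⟩
      (θ x - ψ x) + (ι (coeff f m) + s) * x ^ m
        ≈⟨ solve 6 (λ t u a s y z → (t :- u) :+ (a :+ s) :* y := (t :+ a :* y :+ z) :+ (s :* y :- (z :+ u))) refl (θ x) (ψ x) (ι (coeff f m)) s (x ^ m) (x ^ suc m) ⟩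
      (θ x + ι (coeff f m) * x ^ m + x ^ suc m) + (s * x ^ m - (x ^ suc m + ψ x))
        ≈⟨ +-cong f≈0 (x≈y⇒x-y≈0 Π≈) ⟩
      0# + 0#
        ≈⟨ +-identityʳ 0# ⟩
      0# ∎
      where
      x = ρ i
      f≈0 : θ x + ι (coeff f m) * x ^ m + x ^ suc m ≈ 0#
      f≈0 = trans (+-congˡ (sym (trans (*-congʳ (trans (ι-cong top) 1#-homo)) (*-identityˡ _))))
        (trans (sym (proj₂ (proj₂ f-split) x)) (conjugate-root (suc m) f monic irreducible α α-root i))
      Π≈ : s * x ^ m ≈ x ^ suc m + ψ x
      Π≈ = trans (trans (sym (+-identityˡ _)) (+-congʳ (sym (proj₁ (proj₂ (proj₂ product)) i)))) (proj₂ (proj₂ (proj₂ (proj₂ product))) x)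

  -- `HasTrace` brings its own k with qⁿ = pᵏ; this identifies it with n r, the length for which the
  -- trace splits over the conjugates.
  exponent-unique : ∀ {j k} → p ℕ.^ j ≡ p ℕ.^ k → j ≡ k
  exponent-unique {j} {k} eq with ℕ.<-cmp j k
  ... | tri< j<k _ _ = contradiction eq (ℕ.<⇒≢ (ℕ.^-monoʳ-< p F.1<p j<k))
  ... | tri≈ _ j≡k _ = j≡k
  ... | tri> _ _ k<j = contradiction (≡.sym eq) (ℕ.<⇒≢ (ℕ.^-monoʳ-< p F.1<p k<j))

  -- Apart from the embedding ι the right side involves only f. This is what frees the condition
  -- Tr(f) = a from the choice of K, α and k.
  trace-root : ∀ n f → MonicOfDegree n f → Irreducible f → ∀ α → evalAt α f ≈ 0# → ∀ k → q ℕ.^ n ≡ p ℕ.^ k →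
    trace k α ≈ ι (F.Tr (F.- coeff f (ℕ.pred n)))
  trace-root zero f monic irreducible = contradiction ≡.refl (irreducible-degree monic irreducible)
  trace-root n@(suc m) f monic irreducible α α-root k qⁿ≡pᵏ with ≡.refl ← exponent-unique {n ℕ.* r} {k} (≡.trans (≡.sym (q^≡ n)) qⁿ≡pᵏ) = begin
    trace (n ℕ.* r) α                                              ≈⟨ trace-conjugates n α ⟩
    trace r (sum (conjugate n f monic irreducible α α-root))       ≈⟨ trace-cong r (trans (conjugates-sum m f monic irreducible α α-root) (sym (ι-neg _))) ⟩
    trace r (ι (F.- coeff f m))                                    ≈⟨ sum-cong-≋ (λ (i : Fin r) → sym (ι-^ (F.- coeff f m) (p ℕ.^ toℕ i))) ⟩
    sum (λ (i : Fin r) → ι (F.φ (toℕ i) (F.- coeff f m)))          ≈⟨ ι-sum (λ (i : Fin r) → F.φ (toℕ i) (F.- coeff f m)) ⟨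
    ι (F.Tr (F.- coeff f m))                                       ∎

-- Sums of indicators and cardinalities

module ℕSum where
  open import Algebra.Properties.Semiring.Sum ℕ.+-*-semiring public
    using (sum; ∑-distrib-+; ∑-comm; sum-permute; *-distribˡ-sum; *-distribʳ-sum; sum-replicate-zero; sum-init-last) renaming (sum-cong-≗ to sum-cong)

  sum-zero : ∀ {n} {f : Fin n → ℕ} → (∀ i → f i ≡ 0) → sum f ≡ 0
  sum-zero {n} f≡0 = ≡.trans (sum-cong f≡0) (sum-replicate-zero n)

  sum-const : ∀ n {f : Fin n → ℕ} {k} → (∀ i → f i ≡ k) → sum f ≡ n ℕ.* k
  sum-const zero eq = ≡.refl
  sum-const (suc n) eq = ≡.cong₂ ℕ._+_ (eq zero) (sum-const n (eq ∘ suc))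

  sum-single : ∀ {n} (f : Fin n → ℕ) j → (∀ i → i ≢ j → f i ≡ 0) → sum f ≡ f j
  sum-single f zero else≡0 = ≡.trans (≡.cong (f zero ℕ.+_) (sum-zero (λ i → else≡0 (suc i) (λ ())))) (ℕ.+-identityʳ _)
  sum-single f (suc j) else≡0 = ≡.trans (≡.cong (ℕ._+ sum (f ∘ suc)) (else≡0 zero (λ ())))
    (sum-single (f ∘ suc) j (λ i i≢j → else≡0 (suc i) (i≢j ∘ Fin.suc-injective)))

  𝟙 : ∀ {a} {A : Set a} → Dec A → ℕ
  𝟙 (yes _) = 1
  𝟙 (no _) = 0

  𝟙-yes : ∀ {a} {A : Set a} (A? : Dec A) → A → 𝟙 A? ≡ 1
  𝟙-yes (yes _) _ = ≡.refl
  𝟙-yes (no ¬a) a = contradiction a ¬a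

  𝟙-no : ∀ {a} {A : Set a} (A? : Dec A) → ¬ A → 𝟙 A? ≡ 0
  𝟙-no (no _) _ = ≡.refl
  𝟙-no (yes a) ¬a = contradiction a ¬a

  𝟙-⇔ : ∀ {a b} {A : Set a} {B : Set b} (A? : Dec A) (B? : Dec B) → (A → B) → (B → A) → 𝟙 A? ≡ 𝟙 B?
  𝟙-⇔ (yes a) B? f g = ≡.sym (𝟙-yes B? (f a))
  𝟙-⇔ (no ¬a) B? f g = ≡.sym (𝟙-no B? (¬a ∘ g))

  𝟙-× : ∀ {a b} {A : Set a} {B : Set b} (A? : Dec A) (B? : Dec B) → 𝟙 (A? ×-dec B?) ≡ 𝟙 A? ℕ.* 𝟙 B?
  𝟙-× (yes a) (yes b) = ≡.refl
  𝟙-× (yes a) (no ¬b) = ≡.refl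
  𝟙-× (no ¬a) B? = ≡.refl

  unrank : ∀ {n a} {P : Fin n → Set a} (P? : ∀ i → Dec (P i)) → Fin (sum (λ i → 𝟙 (P? i))) → ∃ P
  unrank {suc n} P? j with P? zero
  unrank {suc n} P? zero | yes p = zero , p
  unrank {suc n} P? (suc j) | yes p with i , pᵢ ← unrank (P? ∘ suc) j = suc i , pᵢ
  unrank {suc n} P? j | no ¬p with i , pᵢ ← unrank (P? ∘ suc) j = suc i , pᵢ

  rank : ∀ {n a} {P : Fin n → Set a} (P? : ∀ i → Dec (P i)) i → P i → ∃[ j ] proj₁ (unrank P? j) ≡ i
  rank {suc n} P? zero p with P? zero
  ... | yes _ = zero , ≡.refl
  ... | no ¬p = contradiction p ¬p
  rank {suc n} P? (suc i) p with P? zero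
  ... | yes _ = let j , eq = rank (P? ∘ suc) i p in suc j , ≡.cong suc eq
  ... | no _ = let j , eq = rank (P? ∘ suc) i p in j , ≡.cong suc eq

  unrank-injective : ∀ {n a} {P : Fin n → Set a} (P? : ∀ i → Dec (P i)) j k → proj₁ (unrank P? j) ≡ proj₁ (unrank P? k) → j ≡ k
  unrank-injective {suc n} P? j k eq with P? zero
  unrank-injective {suc n} P? zero zero eq | yes p = ≡.refl
  unrank-injective {suc n} P? (suc j) (suc k) eq | yes p = ≡.cong suc (unrank-injective (P? ∘ suc) j k (Fin.suc-injective eq))
  unrank-injective {suc n} P? j k eq | no ¬p = unrank-injective (P? ∘ suc) j k (Fin.suc-injective eq)

  module _ {a ℓ : Level} (S : Setoid a ℓ) where
    open Setoid S using (Carrier; _≈_)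

    -- An element of `S` carries a field and a root that its equality ignores, so it is counted
    -- through a code `i x` in `Fin n`. The cardinality is the number of codes that satisfy P;
    -- `complete` chooses an element for each of them.
    subset-cardinality : ∀ {b n} {P : Fin n → Set b} (P? : ∀ i → Dec (P i)) (i : Carrier → Fin n) →
      (∀ {x y} → x ≈ y → i x ≡ i y) → (∀ {x y} → i x ≡ i y → x ≈ y) → (∀ x → P (i x)) → (∀ j → P j → ∃[ x ] i x ≡ j) →
      HasCardinality S (sum (λ j → 𝟙 (P? j)))
    subset-cardinality P? i i-cong i-injective sound complete = record
      { to = to
      ; from = from
      ; to-cong = λ x≈y → unrank-injective P? _ _ (≡.trans (unrank-to _) (≡.trans (i-cong x≈y) (≡.sym (unrank-to _))))
      ; from-cong = λ { ≡.refl → Setoid.refl S }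
      ; inverse = (λ {j} {x} x≈ → unrank-injective P? _ _ (≡.trans (unrank-to x) (≡.trans (i-cong x≈) (i-from j))))
                , λ { {x} ≡.refl → i-injective (≡.trans (i-from (to x)) (unrank-to x)) }
      }
      where
      to = λ x → proj₁ (rank P? (i x) (sound x))
      from = λ j → proj₁ (complete (proj₁ (unrank P? j)) (proj₂ (unrank P? j)))
      unrank-to : ∀ x → proj₁ (unrank P? (to x)) ≡ i x
      unrank-to x = proj₂ (rank P? (i x) (sound x))
      i-from : ∀ j → i (from j) ≡ proj₁ (unrank P? j)
      i-from j = proj₂ (complete (proj₁ (unrank P? j)) (proj₂ (unrank P? j)))

  -- The index k stands for the exponent k + 1, so that sums over `Fin B` range over positive
  -- exponents.
  hit : ℕ → ℕ → ℕ → ℕ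
  hit N d k = 𝟙 (suc k ℕ.* d ℕ.≟ N)

  -- The sum over k d = N, with 1 ≤ k ≤ B and d < B.
  factorSum : ℕ → ℕ → (ℕ → ℕ → ℕ) → ℕ
  factorSum B N t = sum {B} (λ d → sum {B} (λ k → hit N (toℕ d) (toℕ k) ℕ.* t (suc (toℕ k)) (toℕ d)))

-- Irreducible powers dividing a polynomial

module IrreduciblePolynomials {c ℓ} (R : CommutativeRing c ℓ) (field? : IsDiscreteField R) (q : ℕ) (card : HasCardinality (CommutativeRing.setoid R) q) where
  open PolynomialDivision R field? public
  open Enumeration (CommutativeRing.setoid R) q card
  open ℕSum
  private module F = DiscreteField R field?
  open RingSolver polynomialRing using (solve; _:=_; _:*_; _:-_)
  open import Algebra.Properties.Semiring.Exp PR.semiring public using (_^_)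

  mon : ∀ n → Fin (q ℕ.^ n) → Poly
  mon n i = monicPoly (elem ∘ finToFun {q} {n} i)

  mon-monic : ∀ n i → MonicOfDegree n (mon n i)
  mon-monic n i = monicPoly-monic (elem ∘ finToFun {q} {n} i)

  idx : ∀ n → Poly → Fin (q ℕ.^ n)
  idx n f = funToFin {n} (λ i → index (coeff f (toℕ i)))

  idx-cong : ∀ n {f g} → f ≋ g → idx n f ≡ idx n g
  idx-cong n f≋g = funToFin-cong {n} (λ i → index-cong (f≋g at toℕ i))

  mon-idx : ∀ {n f} → MonicOfDegree n f → mon n (idx n f) ≋ f
  mon-idx {n} {f} monic = monicPoly-coeff f _ monic λ i →
    F.trans (F.reflexive (≡.cong elem (Fin.finToFun-funToFin {n} {q} _ i))) (elem-index _)

  idx-mon : ∀ n i → idx n (mon n i) ≡ i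
  idx-mon n i = ≡.trans
    (funToFin-cong {n} (λ j → ≡.trans (index-cong (F.reflexive (coeff-monicPoly (elem ∘ finToFun {q} {n} i) j))) (index-elem _)))
    (Fin.funToFin-finToFin {n} {q} i)

  ∣ᴾ-cong : ∀ {f f′ g} → f ≋ f′ → f ∣ᴾ g → f′ ∣ᴾ g
  ∣ᴾ-cong f≋f′ (h , hf≋g) = h , P.trans (PR.*-congˡ {h} (P.sym f≋f′)) hf≋g

  abstract
    properFactor? : ∀ n f → Dec (ProperFactor n f)
    properFactor? n f = map′ found search (Fin.any? (λ (m : Fin n) → ¬? (toℕ m ℕ.≟ 0) ×-dec Fin.any? (λ i → monic-∣ᴾ? (mon-monic (toℕ m) i) f)))
      where
      found : (∃[ m ] toℕ {n} m ≢ 0 × ∃[ i ] mon (toℕ m) i ∣ᴾ f) → ProperFactor n f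
      found (m , m≢0 , i , mon∣f) = toℕ m , m≢0 , Fin.toℕ<n m , mon (toℕ m) i , mon-monic (toℕ m) i , mon∣f
      search : ProperFactor n f → ∃[ m ] toℕ {n} m ≢ 0 × ∃[ i ] mon (toℕ m) i ∣ᴾ f
      search (m , m≢0 , m<n , g , monic , g∣f) rewrite ≡.sym (Fin.toℕ-fromℕ< m<n) =
        Fin.fromℕ< m<n , m≢0 , idx (toℕ (Fin.fromℕ< m<n)) g , ∣ᴾ-cong (P.sym (mon-idx monic)) g∣f

  irreducible? : ∀ {n f} → MonicOfDegree n f → Dec (Irreducible f)
  irreducible? {zero} monic = no λ irreducible → irreducible-degree monic irreducible ≡.refl
  irreducible? {n@(suc _)} {f} monic with properFactor? n f
  ... | yes factor = no λ irreducible → irreducible⇒¬properFactor monic irreducible factor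
  ... | no ¬factor = yes (¬properFactor⇒irreducible monic (λ ()) ¬factor)

  record Factorisation (n : ℕ) (f : Poly) : Set (c ⊔ ℓ) where
    field
      k m : ℕ
      g h : Poly
      k+m≡n : k ℕ.+ m ≡ n
      g-monic : MonicOfDegree k g
      h-monic : MonicOfDegree m h
      h-irreducible : Irreducible h
      gh≋f : g *ᴾ h ≋ f

  -- Splitting off a single irreducible factor suffices, because the valuation is computed by
  -- induction on the degree of the cofactor. The factor is found inside a proper factor, if there
  -- is one.
  factorise : ∀ n f → MonicOfDegree n f → n ≢ 0 → Factorisation n f
  factorise = <-rec _ step
    where
    step : ∀ n → (∀ {m} → m ℕ.< n → ∀ f → MonicOfDegree m f → m ≢ 0 → Factorisation m f) → ∀ f → MonicOfDegree n f → n ≢ 0 → Factorisation n f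
    step n rec f monic n≢0 with properFactor? n f
    ... | no ¬factor = record { g-monic = monic-1 ; h-monic = monic ; k+m≡n = ≡.refl ; gh≋f = PR.*-identityˡ f
      ; h-irreducible = ¬properFactor⇒irreducible monic n≢0 ¬factor }
    ... | yes (m′ , m′≢0 , m′<n , g′ , g′-monic , a , ag′≋f) =
      let k , k+m≡n , kh-monic = cofactor-monic h (a *ᴾ g) h-monic (monic-resp (P.sym agh≋f) monic) in
      record { g = a *ᴾ g ; g-monic = kh-monic ; h-monic = h-monic ; h-irreducible = h-irreducible ; k+m≡n = k+m≡n ; gh≋f = agh≋f }
      where
      open Factorisation (rec m′<n g′ g′-monic m′≢0) using (g; h; h-monic; h-irreducible; gh≋f)
      agh≋f : a *ᴾ g *ᴾ h ≋ f
      agh≋f = P.trans (PR.*-assoc a g h) (P.trans (PR.*-congˡ {a} gh≋f) ag′≋f)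

  monic-cancelʳ : ∀ {n f} g h → MonicOfDegree n f → g *ᴾ f ≋ h *ᴾ f → g ≋ h
  monic-cancelʳ {n} {f} g h monic@(top , deg) eq with leading (g +ᴾ (-ᴾ h))
  ... | null g-h≋0 = x∙y⁻¹≈ε⇒x≈y g h g-h≋0
    where open import Algebra.Properties.Ring PR.ring using (x∙y⁻¹≈ε⇒x≈y)
  ... | lead m ≉0 deg′ = contradiction
    (F.trans (F.sym (F.trans (coeff-*-top (g +ᴾ (-ᴾ h)) f deg′ deg) (F.trans (F.*-congˡ top) (F.*-identityʳ _)))) (product≋0 at _)) ≉0
    where
    open import Algebra.Properties.Ring PR.ring using (x≈y⇒x∙y⁻¹≈ε)
    product≋0 : (g +ᴾ (-ᴾ h)) *ᴾ f ≋ []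
    product≋0 = P.trans (solve 3 (λ g h f → (g :- h) :* f := g :* f :- h :* f) P.refl g h f) (x≈y⇒x∙y⁻¹≈ε eq)

  ∣ᴾ-cancelʳ : ∀ {n f g h} → MonicOfDegree n f → g *ᴾ f ∣ᴾ h *ᴾ f → g ∣ᴾ h
  ∣ᴾ-cancelʳ {f = f} {g} {h} monic (a , eq) = a , monic-cancelʳ (a *ᴾ g) h monic (P.trans (PR.*-assoc a g f) eq)

  monic-^ : ∀ {m} f k → MonicOfDegree m f → MonicOfDegree (k ℕ.* m) (f ^ k)
  monic-^ f zero monic = monic-1
  monic-^ f (suc k) monic = monic-* f (f ^ k) monic (monic-^ f k monic)

  irreducible-∣ : ∀ {m n f g} → MonicOfDegree m f → MonicOfDegree n g → Irreducible f → Irreducible g → f ∣ᴾ g → f ≋ g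
  irreducible-∣ {m} {n} {f} {g} f-monic g-monic f-irr g-irr f∣g@(h , hf≋g) with irreducible-split g-monic g-irr h f hf≋g
  ... | inj₂ f∣1 = contradiction f∣1 (∤1 f-monic (irreducible-degree f-monic f-irr))
  ... | inj₁ h∣1 with cofactor-monic f h f-monic (monic-resp (P.sym hf≋g) g-monic)
  ...   | suc k , _ , h-monic = contradiction h∣1 (∤1 h-monic λ ())
  ...   | zero , _ , h-top , h-deg = P.trans (P.sym (P.trans (PR.*-congʳ h≋1) (PR.*-identityˡ f))) hf≋g
    where
    h≋1 : h ≋ 1ᴾ
    h≋1 = coeffs λ { zero → h-top ; (suc i) → h-deg (suc i) ℕ.z<s }

  -- Euclid's lemma moves one factor f into g, where it is cancelled on both sides; the remaining
  -- power is treated by induction.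
  ^-coprime : ∀ {n f} (monic : MonicOfDegree n f) (irreducible : Irreducible f) {h} → ¬ f ∣ᴾ h → ∀ k g → f ^ k ∣ᴾ g *ᴾ h → f ^ k ∣ᴾ g
  ^-coprime monic irreducible f∤h zero g _ = g , PR.*-identityʳ g
  ^-coprime {f = f} monic irreducible {h} f∤h (suc k) g (a , eq) with euclid monic irreducible g h (∣ᴾ-resp eq (∣ᴾ-* a (f ^ k , PR.*-comm (f ^ k) f)))
  ... | inj₂ f∣h = contradiction f∣h f∤h
  ... | inj₁ (g′ , g′f≋g) with b , bfᵏ≋g′ ← ^-coprime monic irreducible f∤h k g′
        (∣ᴾ-cancelʳ monic (a , P.trans (P.trans (PR.*-congˡ {a} (PR.*-comm (f ^ k) f)) eq)
          (P.trans (PR.*-congʳ (P.sym g′f≋g)) (solve 3 (λ g f h → g :* f :* h := g :* h :* f) P.refl g′ f h)))) =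
      b , P.trans (solve 3 (λ b f e → b :* (f :* e) := b :* e :* f) P.refl b f (f ^ k)) (P.trans (PR.*-congʳ bfᵏ≋g′) g′f≋g)

  abstract
    _≋?_ : ∀ f g → Dec (f ≋ g)
    f ≋? g = map′ (x∙y⁻¹≈ε⇒x≈y f g) x≈y⇒x∙y⁻¹≈ε ((f +ᴾ (-ᴾ g)) ≋[]?)
      where open import Algebra.Properties.Ring PR.ring using (x∙y⁻¹≈ε⇒x≈y; x≈y⇒x∙y⁻¹≈ε)

  abstract
    irr? : ∀ d i → Dec (Irreducible (mon d i))
    irr? d i = irreducible? (mon-monic d i)

  abstract
    power-∣? : ∀ d i k f → Dec (mon d i ^ k ∣ᴾ f)
    power-∣? d i k f = monic-∣ᴾ? (monic-^ (mon d i) k (mon-monic d i)) f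

  -- Reducible polynomials get weight 0, so sums can run over all coefficient vectors and the
  -- irreducible polynomials need no enumeration of their own.
  weight : ∀ d → Fin (q ℕ.^ d) → ℕ
  weight d i = d ℕ.* 𝟙 (irr? d i)

  multiplicity : ∀ B d → Fin (q ℕ.^ d) → Poly → ℕ
  multiplicity B d i f = sum {B} (λ k → 𝟙 (power-∣? d i (suc (toℕ k)) f))

  -- The Λ(f) of the overview, cut off at degrees below B and exponents up to B. Nothing is lost
  -- when deg f < B.
  valuation : ℕ → Poly → ℕ
  valuation B f = sum {B} (λ d → sum (λ i → weight (toℕ d) i ℕ.* multiplicity B (toℕ d) i f))

  weight-cong : ∀ d i {x y} → (Irreducible (mon d i) → x ≡ y) → weight d i ℕ.* x ≡ weight d i ℕ.* y
  weight-cong d i {x} {y} eq with irr? d i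
  ... | yes irreducible = ≡.cong (d ℕ.* 1 ℕ.*_) (eq irreducible)
  ... | no _ rewrite ℕ.*-zeroʳ d = ≡.refl

  ∣-degree : ∀ {m n f g} → MonicOfDegree m f → MonicOfDegree n g → f ∣ᴾ g → m ℕ.≤ n
  ∣-degree {m} {f = f} f-monic g-monic (h , hf≋g) with k , k+m≡n , _ ← cofactor-monic f h f-monic (monic-resp (P.sym hf≋g) g-monic) =
    ≡.subst (m ℕ.≤_) k+m≡n (ℕ.m≤n+m m k)

  -- For P ≠ h a power of P divides f = g h exactly when it divides g. For P = h, P^(j+1) divides f
  -- exactly when P^j divides g: the range of exponents moves down by one, gaining the exponent 0,
  -- which always counts, and losing the largest.
  multiplicity-factor : ∀ {B n k m f g h} → MonicOfDegree n f → MonicOfDegree k g → MonicOfDegree m h → Irreducible h → g *ᴾ h ≋ f → k ℕ.< B →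
    ∀ d i → Irreducible (mon d i) → multiplicity B d i f ≡ multiplicity B d i g ℕ.+ 𝟙 (mon d i ≋? h)
  multiplicity-factor {suc B} {n} {k} {m} {f} {g} {h} f-monic g-monic h-monic h-irr gh≋f k<B d i P-irr with mon d i ≋? h
  ... | no P≉h = ≡.trans (sum-cong (λ j → 𝟙-⇔ (power-∣? d i (suc (toℕ {suc B} j)) f) (power-∣? d i (suc (toℕ j)) g)
          (λ P∣f → ^-coprime P-monic P-irr (λ P∣h → P≉h (irreducible-∣ P-monic h-monic P-irr h-irr P∣h)) (suc (toℕ j)) g (∣ᴾ-resp (P.sym gh≋f) P∣f))
          (λ P∣g → ∣ᴾ-resp (P.trans (PR.*-comm h g) gh≋f) (∣ᴾ-* h P∣g)))) (≡.sym (ℕ.+-identityʳ _))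
    where
    P-monic = mon-monic d i
  ... | yes P≋h = begin
    sum {suc B} (λ j → 𝟙 (power-∣? d i (suc (toℕ j)) f))          ≡⟨ sum-cong (λ j → 𝟙-⇔ (power-∣? d i (suc (toℕ {suc B} j)) f) (power-∣? d i (toℕ j) g) (lower (toℕ j)) (raise (toℕ j))) ⟩
    𝟙 (power-∣? d i 0 g) ℕ.+ sum {B} (λ j → t (toℕ j))            ≡⟨ ≡.cong (ℕ._+ sum {B} (λ j → t (toℕ j))) (𝟙-yes (power-∣? d i 0 g) (g , PR.*-identityʳ g)) ⟩
    1 ℕ.+ sum {B} (λ j → t (toℕ j))                               ≡⟨ ≡.cong (1 ℕ.+_) (≡.sym (ℕ.+-identityʳ _)) ⟩
    1 ℕ.+ (sum {B} (λ j → t (toℕ j)) ℕ.+ 0)                       ≡⟨ ≡.cong (λ x → 1 ℕ.+ (sum {B} (λ j → t (toℕ j)) ℕ.+ x)) (𝟙-no (power-∣? d i (suc B) g) too-large) ⟨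
    1 ℕ.+ (sum {B} (λ j → t (toℕ j)) ℕ.+ t B)                     ≡⟨ ≡.cong (1 ℕ.+_) (≡.sym split) ⟩
    1 ℕ.+ sum {suc B} (λ j → t (toℕ j))                           ≡⟨ ℕ.+-comm 1 _ ⟩
    sum {suc B} (λ j → t (toℕ j)) ℕ.+ 1                           ∎
    where
    open ≡.≡-Reasoning
    P-monic = mon-monic d i
    t : ℕ → ℕ
    t j = 𝟙 (power-∣? d i (suc j) g)
    split : sum {suc B} (λ j → t (toℕ j)) ≡ sum {B} (λ j → t (toℕ j)) ℕ.+ t B
    split = ≡.trans (sum-init-last (λ (j : Fin (suc B)) → t (toℕ j))) (≡.cong₂ ℕ._+_ (sum-cong {B} (λ j → ≡.cong t (Fin.toℕ-inject₁ j))) (≡.cong t (Fin.toℕ-fromℕ B)))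
    lower : ∀ j → mon d i ^ suc j ∣ᴾ f → mon d i ^ j ∣ᴾ g
    lower j P∣f = ∣ᴾ-cancelʳ P-monic (∣ᴾ-cong (PR.*-comm (mon d i) (mon d i ^ j)) (∣ᴾ-resp (P.sym (P.trans (PR.*-congˡ {g} P≋h) gh≋f)) P∣f))
    raise : ∀ j → mon d i ^ j ∣ᴾ g → mon d i ^ suc j ∣ᴾ f
    raise j (a , eq) = a , P.trans (solve 3 (λ a e f → a :* (e :* f) := a :* f :* e) P.refl a (mon d i) (mon d i ^ j)) (P.trans (PR.*-congʳ eq) (P.trans (PR.*-congˡ {g} P≋h) gh≋f))
    -- The lost exponent contributes nothing: that power has degree at least B + 1, and deg g is
    -- smaller.
    too-large : ¬ mon d i ^ suc B ∣ᴾ g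
    too-large P∣g = ℕ.<⇒≱ k<B (ℕ.≤-trans (ℕ.m≤m*n (suc B) d {{ℕ.≢-nonZero (irreducible-degree P-monic P-irr)}}) (∣-degree (monic-^ (mon d i) (suc B) P-monic) g-monic P∣g))

  sum-weight : ∀ {B m h} → m ℕ.< B → MonicOfDegree m h → Irreducible h → sum {B} (λ d → sum (λ i → weight (toℕ d) i ℕ.* 𝟙 (mon (toℕ d) i ≋? h))) ≡ m
  sum-weight {B} {m} {h} m<B monic irreducible = ≡.trans
    (sum-single {B} _ (Fin.fromℕ< m<B) λ d d≢ → otherwise (toℕ d) λ eq → d≢ (Fin.toℕ-injective (≡.trans eq (≡.sym (Fin.toℕ-fromℕ< m<B)))))
    (at-m (toℕ (Fin.fromℕ< m<B)) (Fin.toℕ-fromℕ< m<B))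
    where
    otherwise : ∀ d → d ≢ m → sum (λ i → weight d i ℕ.* 𝟙 (mon d i ≋? h)) ≡ 0
    otherwise d d≢m = sum-zero λ i → ≡.trans (≡.cong (weight d i ℕ.*_) (𝟙-no (mon d i ≋? h) λ eq → d≢m (monic-degree {f = h} (monic-resp eq (mon-monic d i)) monic))) (ℕ.*-zeroʳ (weight d i))
    at-m : ∀ d → d ≡ m → sum (λ i → weight d i ℕ.* 𝟙 (mon d i ≋? h)) ≡ m
    at-m d ≡.refl = ≡.trans
      (sum-single _ (idx m h) λ i i≢ → ≡.trans (≡.cong (weight m i ℕ.*_) (𝟙-no (mon m i ≋? h) λ eq → i≢ (≡.trans (≡.sym (idx-mon m i)) (idx-cong m eq)))) (ℕ.*-zeroʳ (weight m i)))
      (≡.trans (≡.cong₂ (λ x y → m ℕ.* x ℕ.* y)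
        (𝟙-yes (irr? m (idx m h)) (irreducible-resp (P.sym (mon-idx monic)) irreducible))
        (𝟙-yes (mon m (idx m h) ≋? h) (mon-idx monic)))
        (≡.trans (ℕ.*-identityʳ _) (ℕ.*-identityʳ m)))

  -- Unique factorisation in additive form: removing an irreducible factor lowers the degree and the
  -- valuation by the same amount. The cut-off B stays fixed during the induction.
  valuation≡degree : ∀ B n f → MonicOfDegree n f → n ℕ.< B → valuation B f ≡ n
  valuation≡degree B = <-rec _ step
    where
    step : ∀ n → (∀ {m} → m ℕ.< n → ∀ f → MonicOfDegree m f → m ℕ.< B → valuation B f ≡ m) → ∀ f → MonicOfDegree n f → n ℕ.< B → valuation B f ≡ n
    step zero rec f (top , deg) _ = sum-zero {B} λ d → sum-zero λ i → ≡.trans (weight-cong (toℕ d) i {y = 0} λ irreducible →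
        sum-zero {B} λ k → 𝟙-no (power-∣? (toℕ d) i (suc (toℕ k)) f) λ P∣f →
          ∤1 (monic-^ (mon (toℕ d) i) (suc (toℕ k)) (mon-monic (toℕ d) i)) (λ eq → irreducible-degree (mon-monic (toℕ d) i) irreducible (ℕ.m+n≡0⇒m≡0 (toℕ d) eq))
            (∣ᴾ-resp {h = 1ᴾ} (coeffs λ { zero → top ; (suc j) → deg (suc j) ℕ.z<s }) P∣f))
      (ℕ.*-zeroʳ (weight (toℕ d) i))
    step n@(suc _) rec f monic n<B = begin
      valuation B f
        ≡⟨ sum-cong {B} (λ d → ≡.trans (sum-cong (λ i → ≡.trans (weight-cong (toℕ d) i (multiplicity-factor monic g-monic h-monic h-irreducible gh≋f k<B (toℕ d) i))
             (ℕ.*-distribˡ-+ (weight (toℕ d) i) _ _)))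
             (∑-distrib-+ {q ℕ.^ toℕ d} _ _)) ⟩
      sum {B} (λ d → sum (λ i → weight (toℕ d) i ℕ.* multiplicity B (toℕ d) i g) ℕ.+ sum (λ i → weight (toℕ d) i ℕ.* 𝟙 (mon (toℕ d) i ≋? h)))
        ≡⟨ ∑-distrib-+ {B} _ _ ⟩
      valuation B g ℕ.+ sum {B} (λ d → sum (λ i → weight (toℕ d) i ℕ.* 𝟙 (mon (toℕ d) i ≋? h)))
        ≡⟨ ≡.cong₂ ℕ._+_ (rec k<n g g-monic k<B) (sum-weight m<B h-monic h-irreducible) ⟩
      k ℕ.+ m ≡⟨ k+m≡n ⟩
      n ∎
      where
      open ≡.≡-Reasoning
      open Factorisation (factorise n f monic (λ ()))
      k<n : k ℕ.< n
      k<n = ≡.subst (k ℕ.<_) k+m≡n (ℕ.m<m+n k (ℕ.n≢0⇒n>0 (irreducible-degree h-monic h-irreducible)))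
      k<B = ℕ.<-trans k<n n<B
      m<B : m ℕ.< B
      m<B = ℕ.≤-<-trans (≡.subst (m ℕ.≤_) k+m≡n (ℕ.m≤n+m m k)) n<B

-- Equidistribution of the trace and the key identity

module Counting {c ℓ} (R : CommutativeRing c ℓ) (field? : IsDiscreteField R) (p : ℕ) (p≢0 : NonZero p) (char : HasCharacteristic R p)
  (q : ℕ) (card : HasCardinality (CommutativeRing.setoid R) q) where
  private
    module F where
      open DiscreteField R field? public
      open FiniteField R field? p p≢0 char q card public
  open F using (_≈_; 0#; 1#; _≟_; Tr; Fixed) renaming (Carrier to A)
  open IrreduciblePolynomials R field? q card public
  open ℕSum

  prime-field-sum : ∀ {x} → Fixed x → sum {p} (λ a → 𝟙 (x ≟ fromFin R a)) ≡ 1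
  prime-field-sum {x} fixed with a , x≈a ← F.prime-field fixed = ≡.trans
    (sum-single _ a λ b b≢a → 𝟙-no (x ≟ fromFin R b) λ x≈b → b≢a (F.fromFin-injective b a (F.trans (F.sym x≈b) x≈a)))
    (𝟙-yes (x ≟ fromFin R a) x≈a)

  -- π preserves the weight and raises σ by 1, so the fibres of σ over the p residues have equal
  -- weight. They cover everything, since σ takes values in the prime field.
  equidistribution : ∀ {M} (m : Fin M → ℕ) (σ : Fin M → A) (π : Permutation M M) → (∀ x → Fixed (σ x)) →
    (∀ x → m (π ⟨$⟩ʳ x) ≡ m x) → (∀ x → σ (π ⟨$⟩ʳ x) ≈ 1# F.+ σ x) →
    p ℕ.* sum (λ x → m x ℕ.* 𝟙 (σ x ≟ 0#)) ≡ sum m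
  equidistribution {M} m σ π fixed m-inv σ-shift = begin
    p ℕ.* T 0                                              ≡⟨ sum-const p (T-const ∘ toℕ) ⟨
    sum {p} (λ a → sum (λ x → m x ℕ.* 𝟙 (σ x ≟ fromFin R a)))    ≡⟨ ∑-comm (λ (a : Fin p) x → m x ℕ.* 𝟙 (σ x ≟ fromFin R a)) ⟩
    sum (λ x → sum {p} (λ a → m x ℕ.* 𝟙 (σ x ≟ fromFin R a)))    ≡⟨ sum-cong (λ x → ≡.trans (≡.sym (*-distribˡ-sum (m x) (λ (a : Fin p) → 𝟙 (σ x ≟ fromFin R a))))
                                                                      (≡.trans (≡.cong (m x ℕ.*_) (prime-field-sum (fixed x))) (ℕ.*-identityʳ (m x)))) ⟩
    sum m                                                  ∎
    where
    open ≡.≡-Reasoning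
    T : ℕ → ℕ
    T j = sum (λ x → m x ℕ.* 𝟙 (σ x ≟ (j F.· 1#)))
    T-suc : ∀ j → T (suc j) ≡ T j
    T-suc j = ≡.trans (sum-permute (λ x → m x ℕ.* 𝟙 (σ x ≟ (suc j F.· 1#))) π)
      (sum-cong (λ x → ≡.cong₂ ℕ._*_ (m-inv x) (𝟙-⇔ (σ (π ⟨$⟩ʳ x) ≟ (suc j F.· 1#)) (σ x ≟ (j F.· 1#))
        (λ eq → +-cancelˡ 1# _ _ (F.trans (F.sym (σ-shift x)) eq)) (λ eq → F.trans (σ-shift x) (F.+-congˡ eq)))))
      where open import Algebra.Properties.Group F.+-group using () renaming (∙-cancelˡ to +-cancelˡ)
    T-const : ∀ j → T j ≡ T 0
    T-const zero = ≡.refl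
    T-const (suc j) = ≡.trans (T-suc j) (T-const j)

  monic-+ : ∀ {n f u} → MonicOfDegree n f → Degreeᴾ< n u → MonicOfDegree n (f +ᴾ u)
  monic-+ {n} {f} {u} (top , deg) deg-u = F.trans (coeff-+ f u n) (F.trans (F.+-cong top (deg-u n ℕ.≤-refl)) (F.+-identityʳ 1#))
    , λ i n<i → F.trans (coeff-+ f u i) (F.trans (F.+-cong (deg i n<i) (deg-u i (ℕ.<⇒≤ n<i))) (F.+-identityʳ 0#))

  translate : ∀ n u → Fin (q ℕ.^ n) → Fin (q ℕ.^ n)
  translate n u i = idx n (mon n i +ᴾ u)

  mon-translate : ∀ n u → Degreeᴾ< n u → ∀ i → mon n (translate n u i) ≋ mon n i +ᴾ u
  mon-translate n u deg i = mon-idx {n} {mon n i +ᴾ u} (monic-+ {n} {mon n i} {u} (mon-monic n i) deg)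

  translate-inverse : ∀ n u v → Degreeᴾ< n v → v +ᴾ u ≋ [] → ∀ i → translate n u (translate n v i) ≡ i
  translate-inverse n u v deg v+u≋0 i = ≡.trans (idx-cong n (P.trans (+ᴾ-cong (mon-translate n v deg i) (P.refl {u}))
    (P.trans (+ᴾ-assoc (mon n i) v u) (P.trans (+ᴾ-cong (P.refl {mon n i}) v+u≋0) (+ᴾ-identityʳ _))))) (idx-mon n i)

  translation : ∀ n u → Degreeᴾ< n u → Permutation (q ℕ.^ n) (q ℕ.^ n)
  translation n u deg = permutation (translate n u) (translate n (-ᴾ u))
    (translate-inverse n u (-ᴾ u) (λ i n≤i → F.trans (coeff-neg u i) (F.trans (F.-‿cong (deg i n≤i)) F.-0#≈0#)) (PR.-‿inverseˡ u))
    (translate-inverse n (-ᴾ u) u deg (PR.-‿inverseʳ u))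

  -- The sign of the second coefficient is left out, as only the vanishing of its trace matters
  -- here.
  traceZero? : ∀ n f → Dec (Tr (coeff f (ℕ.pred n)) ≈ 0#)
  traceZero? n f = Tr (coeff f (ℕ.pred n)) ≟ 0#

  -- Adding b x^j g, where j + deg g = n and Tr b = 1, preserves divisibility by g and raises the trace by 1.
  multiples-equidistributed : ∀ {n e} g → MonicOfDegree e g → e ℕ.≤ n → (g∣? : ∀ f → Dec (g ∣ᴾ f)) →
    p ℕ.* sum (λ i → 𝟙 (g∣? (mon (suc n) i)) ℕ.* 𝟙 (traceZero? (suc n) (mon (suc n) i))) ≡ sum (λ i → 𝟙 (g∣? (mon (suc n) i)))
  multiples-equidistributed {n} {e} g g-monic e≤n g∣? = equidistribution
    (λ i → 𝟙 (g∣? (mon N i))) (λ i → Tr (coeff (mon N i) n)) (translation N u deg-u) (λ i → F.Tr-fixed _)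
    (λ i → 𝟙-⇔ (g∣? (mon N (translate N u i))) (g∣? (mon N i))
      (λ g∣ → ∣ᴾ-resp (P.trans (+ᴾ-cong (mon-translate N u deg-u i) (P.refl { -ᴾ u})) (P.trans (+ᴾ-assoc (mon N i) u (-ᴾ u)) (P.trans (+ᴾ-cong (P.refl {mon N i}) (+ᴾ-inverseʳ u)) (+ᴾ-identityʳ _)))) (∣ᴾ-+ g∣ (∣ᴾ-neg g∣u)))
      (λ g∣ → ∣ᴾ-resp (P.sym (mon-translate N u deg-u i)) (∣ᴾ-+ g∣ g∣u)))
    (λ i → F.trans (F.trace-cong F.r (F.trans (mon-translate N u deg-u i at n) (coeff-+ (mon N i) u n)))
      (F.trans (F.trace-+ F.r _ _) (F.trans (F.+-comm _ _) (F.+-congʳ (F.trans (F.trace-cong F.r u-top) Trb≈1)))))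
    where
    N = suc n
    b = proj₁ F.Tr-surjective
    Trb≈1 : Tr b ≈ 1#
    Trb≈1 = proj₂ F.Tr-surjective
    h : Poly
    h = monicPoly {n ℕ.∸ e} (λ _ → 0#)
    hg-monic : MonicOfDegree n (h *ᴾ g)
    hg-monic = ≡.subst (λ k → MonicOfDegree k (h *ᴾ g)) (ℕ.m∸n+n≡m e≤n) (monic-* h g (monicPoly-monic {n ℕ.∸ e} (λ _ → 0#)) g-monic)
    u : Poly
    u = C b *ᴾ (h *ᴾ g)
    coeff-u : ∀ i → coeff u i ≈ b F.* coeff (h *ᴾ g) i
    coeff-u i = F.trans (C-* b (h *ᴾ g) at i) (coeff-• b (h *ᴾ g) i)
    u-top : coeff u n ≈ b
    u-top = F.trans (coeff-u n) (F.trans (F.*-congˡ (proj₁ hg-monic)) (F.*-identityʳ b))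
    deg-u : Degreeᴾ< N u
    deg-u i n<i = F.trans (coeff-u i) (F.trans (F.*-congˡ (proj₂ hg-monic i n<i)) (F.zeroʳ b))
    g∣u : g ∣ᴾ u
    g∣u = ∣ᴾ-* (C b) (∣ᴾ-* h ∣ᴾ-refl)

  -- Up to sign the second coefficient of a monic polynomial is the sum of its roots, so it is
  -- additive; for a k-th power it is multiplied by k, whence the condition k Tr g = 0.
  coeff-*-second : ∀ {m n} f g → MonicOfDegree (suc m) f → MonicOfDegree (suc n) g →
    coeff (f *ᴾ g) (suc m ℕ.+ n) ≈ coeff f m F.+ coeff g n
  coeff-*-second [] g (0≈1 , _) _ = contradiction (F.sym 0≈1) F.1≉0
  coeff-*-second {zero} {n} (a ∷ f) g (top , deg) (top-g , _) = F.trans (coeff-+ (a • g) (x* (f *ᴾ g)) (suc n)) (F.+-cong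
    (F.trans (coeff-• a g (suc n)) (F.trans (F.*-congˡ top-g) (F.*-identityʳ a)))
    (F.trans (PR.*-congʳ {g} f≋1 at n) (PR.*-identityˡ g at n)))
    where
    f≋1 : f ≋ 1ᴾ
    f≋1 = coeffs λ { zero → top ; (suc i) → deg (suc (suc i)) (ℕ.s≤s ℕ.z<s) }
  coeff-*-second {suc m} {n} (a ∷ f) g (top , deg) g-monic@(_ , deg-g) = F.trans (coeff-+ (a • g) (x* (f *ᴾ g)) (suc (suc m ℕ.+ n))) (F.trans (F.+-cong
    (F.trans (coeff-• a g _) (F.trans (F.*-congˡ (deg-g _ (ℕ.s≤s (ℕ.s≤s (ℕ.m≤n+m n m))))) (F.zeroʳ a)))
    (coeff-*-second {m} f g (top , λ i m<i → deg (suc i) (ℕ.s≤s m<i)) g-monic)) (F.+-identityˡ _))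

  coeff-^-second : ∀ {d} f k → MonicOfDegree (suc d) f → coeff (f ^ suc k) (ℕ.pred (suc k ℕ.* suc d)) ≈ suc k F.· coeff f d
  coeff-^-second {d} f zero monic rewrite ℕ.+-identityʳ d = F.trans (PR.*-identityʳ f at d) (F.sym (F.+-identityʳ _))
  coeff-^-second {d} f (suc k) monic = F.trans
    (F.reflexive (≡.cong (coeff (f ^ suc (suc k))) (ℕ.+-suc d (d ℕ.+ k ℕ.* suc d))))
    (F.trans (coeff-*-second f (f ^ suc k) monic (monic-^ f (suc k) monic)) (F.+-congˡ (coeff-^-second f k monic)))

  Tr-· : ∀ m x → Tr (m F.· x) ≈ m F.· Tr x
  Tr-· zero x = F.trace-0 F.r
  Tr-· (suc m) x = F.trans (F.trace-+ F.r x (m F.· x)) (F.+-congˡ (Tr-· m x))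

  abstract
    traceMultiple? : ∀ m d i → Dec (m F.· Tr (coeff (mon d i) (ℕ.pred d)) ≈ 0#)
    traceMultiple? m d i = m F.· Tr (coeff (mon d i) (ℕ.pred d)) ≟ 0#

  multiples zeroTraceMultiples : ∀ N d → Fin (q ℕ.^ d) → ℕ → ℕ
  multiples N d i k = sum (λ x → 𝟙 (power-∣? d i (suc k) (mon N x)))
  zeroTraceMultiples N d i k = sum (λ x → 𝟙 (power-∣? d i (suc k) (mon N x)) ℕ.* 𝟙 (traceZero? N (mon N x)))

  -- Let e = (k + 1) d be the degree of the power. For e < N this is equidistribution, for e > N
  -- there are no multiples, and for e = N the only multiple is the power itself. The `hit` terms
  -- stand on opposite sides so that one equation without subtraction covers all three cases.
  multiples-trace : ∀ {N} → N ≢ 0 → ∀ d i k → p ℕ.* zeroTraceMultiples N d i k ℕ.+ hit N d k ≡ multiples N d i k ℕ.+ p ℕ.* (hit N d k ℕ.* 𝟙 (traceMultiple? (suc k) d i))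
  multiples-trace {zero} N≢0 = contradiction ≡.refl N≢0
  multiples-trace {N@(suc n)} N≢0 d i k with ℕ.<-cmp (suc k ℕ.* d) N
  ... | tri< e<N e≢N _ = ≡.trans (≡.cong (p ℕ.* zeroTraceMultiples N d i k ℕ.+_) (𝟙-no (suc k ℕ.* d ℕ.≟ N) e≢N))
    (≡.cong₂ ℕ._+_ (multiples-equidistributed (mon d i ^ suc k) (monic-^ (mon d i) (suc k) (mon-monic d i)) (ℕ.s≤s⁻¹ e<N) (power-∣? d i (suc k)))
      (≡.sym (≡.trans (≡.cong (λ x → p ℕ.* (x ℕ.* 𝟙 (traceMultiple? (suc k) d i))) (𝟙-no (suc k ℕ.* d ℕ.≟ N) e≢N)) (ℕ.*-zeroʳ p))))
  ... | tri> _ e≢N N<e = ≡.trans (≡.cong₂ (λ x y → p ℕ.* x ℕ.+ y) (sum-zero λ x → ≡.cong (ℕ._* 𝟙 (traceZero? N (mon N x))) (not-multiple x)) (𝟙-no (suc k ℕ.* d ℕ.≟ N) e≢N))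
    (≡.sym (≡.trans (≡.cong₂ (λ x y → x ℕ.+ p ℕ.* (y ℕ.* 𝟙 (traceMultiple? (suc k) d i))) (sum-zero not-multiple) (𝟙-no (suc k ℕ.* d ℕ.≟ N) e≢N)) (≡.sym (ℕ.+-identityʳ _))))
    where
    not-multiple : ∀ x → 𝟙 (power-∣? d i (suc k) (mon N x)) ≡ 0
    not-multiple x = 𝟙-no (power-∣? d i (suc k) (mon N x)) λ g∣ → ℕ.<⇒≱ N<e (∣-degree (monic-^ (mon d i) (suc k) (mon-monic d i)) (mon-monic N x) g∣)
  ... | tri≈ _ e≡N _ = ≡.trans (≡.cong₂ (λ x y → p ℕ.* x ℕ.+ y) W≡Z (𝟙-yes (suc k ℕ.* d ℕ.≟ N) e≡N))
    (≡.trans (ℕ.+-comm (p ℕ.* Z) 1) (≡.sym (≡.cong₂ (λ x y → x ℕ.+ p ℕ.* y) G≡1 (≡.trans (≡.cong (ℕ._* Z) (𝟙-yes (suc k ℕ.* d ℕ.≟ N) e≡N)) (ℕ.+-identityʳ Z)))))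
    where
    g = mon d i ^ suc k
    Z = 𝟙 (traceMultiple? (suc k) d i)
    g-monic : MonicOfDegree N g
    g-monic = ≡.subst (λ e → MonicOfDegree e g) e≡N (monic-^ (mon d i) (suc k) (mon-monic d i))
    x₀ = idx N g
    other : ∀ x → x ≢ x₀ → 𝟙 (power-∣? d i (suc k) (mon N x)) ≡ 0
    other x x≢ = 𝟙-no (power-∣? d i (suc k) (mon N x)) λ g∣ → x≢ (≡.trans (≡.sym (idx-mon N x)) (idx-cong N (monic-∣-≋ g∣)))
      where
      monic-∣-≋ : g ∣ᴾ mon N x → mon N x ≋ g
      monic-∣-≋ (h , hg≋) with cofactor-monic g h g-monic (monic-resp (P.sym hg≋) (mon-monic N x))
      ... | suc k , eq , _ = contradiction (ℕ.+-cancelʳ-≡ N (suc k) 0 eq) λ ()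
      ... | zero , _ , h-top , h-deg = P.trans (P.sym hg≋) (P.trans (PR.*-congʳ {g} {h} {1ᴾ} (coeffs λ { zero → h-top ; (suc j) → h-deg (suc j) ℕ.z<s })) (PR.*-identityˡ g))
    self : 𝟙 (power-∣? d i (suc k) (mon N x₀)) ≡ 1
    self = 𝟙-yes (power-∣? d i (suc k) (mon N x₀)) (∣ᴾ-resp (P.sym (mon-idx {N} {g} g-monic)) ∣ᴾ-refl)
    G≡1 : multiples N d i k ≡ 1
    G≡1 = ≡.trans (sum-single _ x₀ other) self
    coeff≈ : ∀ d i → suc k ℕ.* d ≡ N → coeff (mon d i ^ suc k) (ℕ.pred N) ≈ suc k F.· coeff (mon d i) (ℕ.pred d)
    coeff≈ zero i eq with () ← ≡.trans (≡.sym (ℕ.*-zeroʳ k)) eq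
    coeff≈ (suc d) i eq = F.trans (F.reflexive (≡.cong (λ e → coeff (mon (suc d) i ^ suc k) (ℕ.pred e)) (≡.sym eq))) (coeff-^-second (mon (suc d) i) k (mon-monic (suc d) i))
    Tr≈ : Tr (coeff (mon N x₀) (ℕ.pred N)) ≈ suc k F.· Tr (coeff (mon d i) (ℕ.pred d))
    Tr≈ = F.trans (F.trace-cong F.r (F.trans (mon-idx {N} {g} g-monic at ℕ.pred N) (coeff≈ d i e≡N))) (Tr-· (suc k) _)
    W≡Z : zeroTraceMultiples N d i k ≡ Z
    W≡Z = ≡.trans (sum-single _ x₀ (λ x x≢ → ≡.cong (ℕ._* 𝟙 (traceZero? N (mon N x))) (other x x≢)))
      (≡.trans (≡.cong (ℕ._* 𝟙 (traceZero? N (mon N x₀))) self) (≡.trans (ℕ.+-identityʳ _)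
        (𝟙-⇔ (traceZero? N (mon N x₀)) (traceMultiple? (suc k) d i) (F.trans (F.sym Tr≈)) (F.trans Tr≈))))

  -- Double counting of the pairs (x, gᵏ) with gᵏ dividing mon N x.
  count-valuation : ∀ {N B} → N ℕ.< B → ∀ (v : Fin (q ℕ.^ N) → ℕ) →
    sum v ℕ.* N ≡ sum {B} (λ d → sum (λ i → weight (toℕ d) i ℕ.* sum {B} (λ k → sum (λ x → 𝟙 (power-∣? (toℕ d) i (suc (toℕ k)) (mon N x)) ℕ.* v x))))
  count-valuation {N} {B} N<B v = begin
    sum v ℕ.* N
      ≡⟨ *-distribʳ-sum N v ⟩
    sum (λ x → v x ℕ.* N)
      ≡⟨ sum-cong (λ x → ≡.cong (v x ℕ.*_) (valuation≡degree B N (mon N x) (mon-monic N x) N<B)) ⟨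
    sum (λ x → v x ℕ.* valuation B (mon N x))
      ≡⟨ sum-cong (λ x → ≡.trans (*-distribˡ-sum {B} (v x) _) (sum-cong {B} (λ d → *-distribˡ-sum (v x) (λ i → weight (toℕ d) i ℕ.* multiplicity B (toℕ d) i (mon N x))))) ⟩
    sum (λ x → sum {B} (λ d → sum (λ i → v x ℕ.* (weight (toℕ d) i ℕ.* multiplicity B (toℕ d) i (mon N x)))))
      ≡⟨ ∑-comm {q ℕ.^ N} {B} _ ⟩
    sum {B} (λ d → sum (λ x → sum (λ i → v x ℕ.* (weight (toℕ d) i ℕ.* multiplicity B (toℕ d) i (mon N x)))))
      ≡⟨ sum-cong {B} (λ d → ≡.trans (∑-comm {q ℕ.^ N} {q ℕ.^ toℕ d} _) (sum-cong (λ i → term (toℕ d) i))) ⟩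
    sum {B} (λ d → sum (λ i → weight (toℕ d) i ℕ.* sum {B} (λ k → sum (λ x → 𝟙 (power-∣? (toℕ d) i (suc (toℕ k)) (mon N x)) ℕ.* v x)))) ∎
    where
    open ≡.≡-Reasoning
    open import Algebra.Properties.CommutativeSemigroup ℕ.*-commutativeSemigroup using (x∙yz≈y∙xz)
    term : ∀ d i → sum (λ x → v x ℕ.* (weight d i ℕ.* multiplicity B d i (mon N x))) ≡ weight d i ℕ.* sum {B} (λ k → sum (λ x → 𝟙 (power-∣? d i (suc (toℕ k)) (mon N x)) ℕ.* v x))
    term d i = begin
      sum (λ x → v x ℕ.* (weight d i ℕ.* multiplicity B d i (mon N x)))    ≡⟨ sum-cong (λ x → x∙yz≈y∙xz (v x) (weight d i) _) ⟩
      sum (λ x → weight d i ℕ.* (v x ℕ.* multiplicity B d i (mon N x)))    ≡⟨ *-distribˡ-sum (weight d i) (λ x → v x ℕ.* multiplicity B d i (mon N x)) ⟨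
      weight d i ℕ.* sum (λ x → v x ℕ.* multiplicity B d i (mon N x))      ≡⟨ ≡.cong (weight d i ℕ.*_) (begin
        sum (λ x → v x ℕ.* multiplicity B d i (mon N x))
          ≡⟨ sum-cong (λ x → ≡.trans (ℕ.*-comm (v x) (multiplicity B d i (mon N x))) (*-distribʳ-sum {B} (v x) _)) ⟩
        sum (λ x → sum {B} (λ k → 𝟙 (power-∣? d i (suc (toℕ k)) (mon N x)) ℕ.* v x))
          ≡⟨ ∑-comm {q ℕ.^ N} {B} _ ⟩
        sum {B} (λ k → sum (λ x → 𝟙 (power-∣? d i (suc (toℕ k)) (mon N x)) ℕ.* v x)) ∎) ⟩
      weight d i ℕ.* sum {B} (λ k → sum (λ x → 𝟙 (power-∣? d i (suc (toℕ k)) (mon N x)) ℕ.* v x)) ∎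

  weightedSum : ℕ → (∀ d → Fin (q ℕ.^ d) → ℕ → ℕ) → ℕ
  weightedSum B t = sum {B} (λ d → sum (λ i → weight (toℕ d) i ℕ.* sum {B} (λ k → t (toℕ d) i (toℕ k))))

  weightedSum-cong : ∀ B {s t : ∀ d → Fin (q ℕ.^ d) → ℕ → ℕ} → (∀ d i k → s d i k ≡ t d i k) → weightedSum B s ≡ weightedSum B t
  weightedSum-cong B s≡t = sum-cong {B} λ d → sum-cong λ i → ≡.cong (weight (toℕ d) i ℕ.*_) (sum-cong {B} λ k → s≡t (toℕ d) i (toℕ k))

  weightedSum-+ : ∀ B (s t : ∀ d → Fin (q ℕ.^ d) → ℕ → ℕ) → weightedSum B (λ d i k → s d i k ℕ.+ t d i k) ≡ weightedSum B s ℕ.+ weightedSum B t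
  weightedSum-+ B s t = ≡.trans
    (sum-cong {B} λ d → ≡.trans
      (sum-cong λ i → ≡.trans (≡.cong (weight (toℕ d) i ℕ.*_) (∑-distrib-+ {B} _ _)) (ℕ.*-distribˡ-+ (weight (toℕ d) i) _ _))
      (∑-distrib-+ {q ℕ.^ toℕ d} _ _))
    (∑-distrib-+ {B} _ _)

  weightedSum-* : ∀ B x (t : ∀ d → Fin (q ℕ.^ d) → ℕ → ℕ) → weightedSum B (λ d i k → x ℕ.* t d i k) ≡ x ℕ.* weightedSum B t
  weightedSum-* B x t = ≡.trans
    (sum-cong {B} λ d → ≡.trans
      (sum-cong λ i → ≡.trans (≡.cong (weight (toℕ d) i ℕ.*_) (≡.sym (*-distribˡ-sum {B} x _))) (x∙yz≈y∙xz (weight (toℕ d) i) x _))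
      (≡.sym (*-distribˡ-sum {q ℕ.^ toℕ d} x _)))
    (≡.sym (*-distribˡ-sum {B} x _))
    where open import Algebra.Properties.CommutativeSemigroup ℕ.*-commutativeSemigroup using (x∙yz≈y∙xz)

  irreducibles : ℕ → ℕ
  irreducibles d = sum (λ i → 𝟙 (irr? d i))

  irreduciblesTrace : ℕ → ℕ → ℕ
  irreduciblesTrace m d = sum (λ i → 𝟙 (irr? d i) ℕ.* 𝟙 (traceMultiple? m d i))

  weightedSum-hit : ∀ B N (z : ∀ k d → Fin (q ℕ.^ d) → ℕ) →
    weightedSum B (λ d i k → hit N d k ℕ.* z (suc k) d i) ≡ factorSum B N (λ k d → d ℕ.* sum (λ i → 𝟙 (irr? d i) ℕ.* z k d i))
  weightedSum-hit B N z = sum-cong {B} λ d → begin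
    sum (λ i → weight (toℕ d) i ℕ.* sum {B} (λ k → hit N (toℕ d) (toℕ k) ℕ.* z (suc (toℕ k)) (toℕ d) i))
      ≡⟨ sum-cong (λ i → *-distribˡ-sum {B} (weight (toℕ d) i) _) ⟩
    sum (λ i → sum {B} (λ k → weight (toℕ d) i ℕ.* (hit N (toℕ d) (toℕ k) ℕ.* z (suc (toℕ k)) (toℕ d) i)))
      ≡⟨ ∑-comm {q ℕ.^ toℕ d} {B} _ ⟩
    sum {B} (λ k → sum (λ i → weight (toℕ d) i ℕ.* (hit N (toℕ d) (toℕ k) ℕ.* z (suc (toℕ k)) (toℕ d) i)))
      ≡⟨ sum-cong {B} (λ k → ≡.trans (sum-cong (λ i → rearrange (toℕ d) (𝟙 (irr? (toℕ d) i)) (hit N (toℕ d) (toℕ k)) (z (suc (toℕ k)) (toℕ d) i)))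
           (≡.trans (≡.sym (*-distribˡ-sum {q ℕ.^ toℕ d} (hit N (toℕ d) (toℕ k)) _)) (≡.cong (hit N (toℕ d) (toℕ k) ℕ.*_) (≡.sym (*-distribˡ-sum {q ℕ.^ toℕ d} (toℕ d) _))))) ⟩
    sum {B} (λ k → hit N (toℕ d) (toℕ k) ℕ.* (toℕ d ℕ.* sum (λ i → 𝟙 (irr? (toℕ d) i) ℕ.* z (suc (toℕ k)) (toℕ d) i))) ∎
    where
    open ≡.≡-Reasoning
    open import Data.Nat.Solver using (module +-*-Solver)
    open +-*-Solver
    rearrange : ∀ d a h z → d ℕ.* a ℕ.* (h ℕ.* z) ≡ h ℕ.* (d ℕ.* (a ℕ.* z))
    rearrange = +-*-Solver.solve 4 (λ d a h z → d :* a :* (h :* z) := h :* (d :* (a :* z))) ≡.refl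

  -- The weighted sum of `multiples-trace` contains the powers of every degree; those of
  -- `multiples N` occur on both sides and cancel. Any B above N is allowed, so N and N / p can
  -- later share one range of summation.
  key-identity : ∀ {N B} → N ≢ 0 → N ℕ.< B →
    factorSum B N (λ k d → d ℕ.* irreducibles d) ≡ p ℕ.* factorSum B N (λ k d → d ℕ.* irreduciblesTrace k d)
  key-identity {zero} N≢0 = contradiction ≡.refl N≢0
  key-identity {N@(suc n)} {B} N≢0 N<B = begin
    factorSum B N (λ k d → d ℕ.* irreducibles d)
      ≡⟨ sum-cong {B} (λ d → sum-cong {B} (λ k → ≡.cong (λ x → hit N (toℕ d) (toℕ k) ℕ.* (toℕ d ℕ.* x)) (sum-cong (λ i → ≡.sym (ℕ.*-identityʳ (𝟙 (irr? (toℕ d) i))))))) ⟩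
    factorSum B N (λ k d → d ℕ.* sum (λ i → 𝟙 (irr? d i) ℕ.* 1))
      ≡⟨ weightedSum-hit B N (λ _ _ _ → 1) ⟨
    weightedSum B (λ d i k → hit N d k ℕ.* 1)
      ≡⟨ weightedSum-cong B (λ d i k → ℕ.*-identityʳ (hit N d k)) ⟩
    weightedSum B (λ d i k → hit N d k)
      ≡⟨ ℕ.+-cancelˡ-≡ (weightedSum B (multiples N)) _ _ total ⟩
    p ℕ.* weightedSum B (λ d i k → hit N d k ℕ.* 𝟙 (traceMultiple? (suc k) d i))
      ≡⟨ ≡.cong (p ℕ.*_) (weightedSum-hit B N (λ m d i → 𝟙 (traceMultiple? m d i))) ⟩
    p ℕ.* factorSum B N (λ k d → d ℕ.* irreduciblesTrace k d) ∎
    where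
    open ≡.≡-Reasoning
    W = weightedSum B
    v : Fin (q ℕ.^ N) → ℕ
    v x = 𝟙 (traceZero? N (mon N x))
    -- Equidistribution among the multiples of 1: exactly one in p of the monic polynomials of
    -- degree N has a second coefficient of trace zero.
    half : p ℕ.* sum v ≡ sum (λ (x : Fin (q ℕ.^ N)) → 1)
    half = begin
      p ℕ.* sum v                               ≡⟨ ≡.cong (p ℕ.*_) (sum-cong (λ x → ≡.trans (≡.sym (ℕ.*-identityˡ (v x))) (≡.cong (ℕ._* v x) (≡.sym (𝟙-yes (1∣? (mon N x)) (1∣ (mon N x))))))) ⟩
      p ℕ.* sum (λ x → 𝟙 (1∣? (mon N x)) ℕ.* v x)   ≡⟨ multiples-equidistributed 1ᴾ monic-1 ℕ.z≤n 1∣? ⟩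
      sum (λ x → 𝟙 (1∣? (mon N x)))             ≡⟨ sum-cong (λ x → 𝟙-yes (1∣? (mon N x)) (1∣ (mon N x))) ⟩
      sum (λ (x : Fin (q ℕ.^ N)) → 1)           ∎
      where
      1∣? : ∀ f → Dec (1ᴾ ∣ᴾ f)
      1∣? = monic-∣ᴾ? monic-1
      1∣ : ∀ f → 1ᴾ ∣ᴾ f
      1∣ f = f , PR.*-identityʳ f
    total : W (multiples N) ℕ.+ W (λ d i k → hit N d k) ≡ W (multiples N) ℕ.+ p ℕ.* W (λ d i k → hit N d k ℕ.* 𝟙 (traceMultiple? (suc k) d i))
    total = begin
      W (multiples N) ℕ.+ W (λ d i k → hit N d k)
        ≡⟨ ≡.cong (ℕ._+ W (λ d i k → hit N d k)) (begin
          W (multiples N)                              ≡⟨ weightedSum-cong B (λ d i k → sum-cong (λ x → ≡.sym (ℕ.*-identityʳ (𝟙 (power-∣? d i (suc k) (mon N x)))))) ⟩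
          W (λ d i k → sum (λ x → 𝟙 (power-∣? d i (suc k) (mon N x)) ℕ.* 1))   ≡⟨ count-valuation N<B (λ _ → 1) ⟨
          sum (λ (x : Fin (q ℕ.^ N)) → 1) ℕ.* N        ≡⟨ ≡.cong (ℕ._* N) half ⟨
          p ℕ.* sum v ℕ.* N                            ≡⟨ ℕ.*-assoc p (sum v) N ⟩
          p ℕ.* (sum v ℕ.* N)                          ≡⟨ ≡.cong (p ℕ.*_) (count-valuation N<B v) ⟩
          p ℕ.* W (zeroTraceMultiples N)               ≡⟨ weightedSum-* B p (zeroTraceMultiples N) ⟨
          W (λ d i k → p ℕ.* zeroTraceMultiples N d i k)    ∎) ⟩
      W (λ d i k → p ℕ.* zeroTraceMultiples N d i k) ℕ.+ W (λ d i k → hit N d k)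
        ≡⟨ weightedSum-+ B (λ d i k → p ℕ.* zeroTraceMultiples N d i k) (λ d i k → hit N d k) ⟨
      W (λ d i k → p ℕ.* zeroTraceMultiples N d i k ℕ.+ hit N d k)
        ≡⟨ weightedSum-cong B (multiples-trace N≢0) ⟩
      W (λ d i k → multiples N d i k ℕ.+ p ℕ.* (hit N d k ℕ.* 𝟙 (traceMultiple? (suc k) d i)))
        ≡⟨ weightedSum-+ B (multiples N) (λ d i k → p ℕ.* (hit N d k ℕ.* 𝟙 (traceMultiple? (suc k) d i))) ⟩
      W (multiples N) ℕ.+ W (λ d i k → p ℕ.* (hit N d k ℕ.* 𝟙 (traceMultiple? (suc k) d i)))
        ≡⟨ ≡.cong (W (multiples N) ℕ.+_) (weightedSum-* B p (λ d i k → hit N d k ℕ.* 𝟙 (traceMultiple? (suc k) d i))) ⟩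
      W (multiples N) ℕ.+ p ℕ.* W (λ d i k → hit N d k ℕ.* 𝟙 (traceMultiple? (suc k) d i)) ∎

  irreduciblesTrace-∣ : ∀ m d → p ∣ m → irreduciblesTrace m d ≡ irreducibles d
  irreduciblesTrace-∣ m d p∣m = sum-cong λ i → ≡.trans
    (≡.cong (𝟙 (irr? d i) ℕ.*_) (𝟙-yes (traceMultiple? m d i) (F.∣⇒·≈0 m _ p∣m))) (ℕ.*-identityʳ _)

  -- For p ∤ m the element m · 1 is nonzero and cancels. The case m = 1 serves as the normal form of
  -- trace zero.
  irreduciblesTrace-∤ : ∀ m d → p ∤ m → irreduciblesTrace m d ≡ irreduciblesTrace 1 d
  irreduciblesTrace-∤ m d p∤m = sum-cong λ i → ≡.cong (𝟙 (irr? d i) ℕ.*_) (𝟙-⇔ (traceMultiple? m d i) (traceMultiple? 1 d i)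
    (λ mt≈0 → F.trans (F.+-identityʳ _) (*-cancelˡ-nonZero (F.trans (F.sym (m·≈ _)) mt≈0)))
    (λ t≈0 → F.trans (m·≈ _) (F.trans (F.*-congˡ (F.trans (F.sym (F.+-identityʳ _)) t≈0)) (F.zeroʳ _))))
    where
    open import Algebra.Properties.Semiring.Mult F.semiring using (×-congʳ; ×-assoc-*)
    m·≈ : ∀ x → m F.· x ≈ (m F.· 1#) F.* x
    m·≈ x = F.trans (×-congʳ m (F.sym (F.*-identityˡ x))) (F.sym (×-assoc-* m 1# x))
    *-cancelˡ-nonZero : ∀ {x} → (m F.· 1#) F.* x ≈ 0# → x ≈ 0#
    *-cancelˡ-nonZero {x} eq = F.*-cancelʳ-nonZero x (p∤m ∘ F.·1≈0⇒∣ m) (F.trans (F.*-comm x _) eq)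

-- Inversion of the key identity

module Inversion (p : ℕ) (p≢0 : NonZero p) (p-prime : Prime p) where
  open ℕSum
  open ≡.≡-Reasoning
  private instance
    p-nonZero : NonZero p
    p-nonZero = p≢0

  -- Reindexing along a partial one-to-one correspondence. Both sums run over cut-off ranges that
  -- contain more indices than the matched ones, so a permutation would not do; unmatched terms must
  -- vanish.
  sum-match : ∀ {m n} {f : Fin m → ℕ} {g : Fin n → ℕ} {_~_ : Fin m → Fin n → Set} (_~?_ : ∀ i j → Dec (i ~ j)) →
    (∀ {i j j′} → i ~ j → i ~ j′ → j ≡ j′) → (∀ {i i′ j} → i ~ j → i′ ~ j → i ≡ i′) → (∀ {i j} → i ~ j → f i ≡ g j) →
    (∀ i → f i ≡ 0 ⊎ ∃[ j ] i ~ j) → (∀ j → g j ≡ 0 ⊎ ∃[ i ] i ~ j) → sum f ≡ sum g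
  sum-match {m} {n} {f} {g} {_~_} _~?_ uniqueʳ uniqueˡ f≡g left right = begin
    sum f                                             ≡⟨ sum-cong row ⟨
    sum (λ i → sum (λ j → 𝟙 (i ~? j) ℕ.* f i))        ≡⟨ ∑-comm (λ i j → 𝟙 (i ~? j) ℕ.* f i) ⟩
    sum (λ j → sum (λ i → 𝟙 (i ~? j) ℕ.* f i))        ≡⟨ sum-cong column ⟩
    sum g                                             ∎
    where
    row : ∀ i → sum (λ j → 𝟙 (i ~? j) ℕ.* f i) ≡ f i
    row i with left i
    ... | inj₁ f≡0 = ≡.trans (sum-zero λ j → ≡.trans (≡.cong (𝟙 (i ~? j) ℕ.*_) f≡0) (ℕ.*-zeroʳ (𝟙 (i ~? j)))) (≡.sym f≡0)
    ... | inj₂ (j , i~j) = ≡.trans (sum-single _ j λ j′ j′≢j → ≡.cong (ℕ._* f i) (𝟙-no (i ~? j′) λ i~j′ → j′≢j (uniqueʳ i~j′ i~j)))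
      (≡.trans (≡.cong (ℕ._* f i) (𝟙-yes (i ~? j) i~j)) (ℕ.*-identityˡ (f i)))
    term : ∀ i j → 𝟙 (i ~? j) ℕ.* f i ≡ 𝟙 (i ~? j) ℕ.* g j
    term i j with i ~? j
    ... | yes i~j = ≡.cong (1 ℕ.*_) (f≡g i~j)
    ... | no _ = ≡.refl
    column : ∀ j → sum (λ i → 𝟙 (i ~? j) ℕ.* f i) ≡ g j
    column j with right j
    ... | inj₁ g≡0 = ≡.trans (sum-zero λ i → ≡.trans (term i j) (≡.trans (≡.cong (𝟙 (i ~? j) ℕ.*_) g≡0) (ℕ.*-zeroʳ (𝟙 (i ~? j))))) (≡.sym g≡0)
    ... | inj₂ (i , i~j) = ≡.trans (sum-single _ i λ i′ i′≢i → ≡.cong (ℕ._* f i′) (𝟙-no (i′ ~? j) λ i′~j → i′≢i (uniqueˡ i′~j i~j)))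
      (≡.trans (≡.cong (ℕ._* f i) (𝟙-yes (i ~? j) i~j)) (≡.trans (ℕ.*-identityˡ (f i)) (f≡g i~j)))

  sum-cancel : ∀ {n} (f g : Fin n → ℕ) j → sum f ≡ sum g → (∀ i → i ≢ j → f i ≡ g i) → f j ≡ g j
  sum-cancel f g zero eq else≡ = ℕ.+-cancelʳ-≡ (sum (g ∘ suc)) _ _ (≡.trans (≡.cong (f zero ℕ.+_) (≡.sym (sum-cong (λ i → else≡ (suc i) (λ ()))))) eq)
  sum-cancel f g (suc j) eq else≡ = sum-cancel (f ∘ suc) (g ∘ suc) j
    (ℕ.+-cancelˡ-≡ (g zero) _ _ (≡.trans (≡.cong (ℕ._+ sum (f ∘ suc)) (≡.sym (else≡ zero (λ ())))) eq))
    λ i i≢j → else≡ (suc i) (i≢j ∘ Fin.suc-injective)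

  factorSum-cong : ∀ B N {s t : ℕ → ℕ → ℕ} → (∀ k d → k ℕ.* d ≡ N → s k d ≡ t k d) → factorSum B N s ≡ factorSum B N t
  factorSum-cong B N {s} {t} s≡t = sum-cong {B} λ d → sum-cong {B} λ k → term (toℕ d) (toℕ k)
    where
    term : ∀ d k → hit N d k ℕ.* s (suc k) d ≡ hit N d k ℕ.* t (suc k) d
    term d k with suc k ℕ.* d ℕ.≟ N
    ... | yes eq = ≡.cong (1 ℕ.*_) (s≡t (suc k) d eq)
    ... | no _ = ≡.refl

  factorSum-+ : ∀ B N (s t : ℕ → ℕ → ℕ) → factorSum B N (λ k d → s k d ℕ.+ t k d) ≡ factorSum B N s ℕ.+ factorSum B N t
  factorSum-+ B N s t = ≡.trans
    (sum-cong {B} λ d → ≡.trans (sum-cong {B} λ k → ℕ.*-distribˡ-+ (hit N (toℕ d) (toℕ k)) _ _) (∑-distrib-+ {B} _ _))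
    (∑-distrib-+ {B} _ _)

  factorSum-* : ∀ B N x (t : ℕ → ℕ → ℕ) → factorSum B N (λ k d → x ℕ.* t k d) ≡ x ℕ.* factorSum B N t
  factorSum-* B N x t = ≡.trans
    (sum-cong {B} λ d → ≡.trans (sum-cong {B} λ k → x∙yz≈y∙xz (hit N (toℕ d) (toℕ k)) x _) (≡.sym (*-distribˡ-sum {B} x _)))
    (≡.sym (*-distribˡ-sum {B} x _))
    where open import Algebra.Properties.CommutativeSemigroup ℕ.*-commutativeSemigroup using (x∙yz≈y∙xz)

  factorSum-0 : ∀ B N {t : ℕ → ℕ → ℕ} → (∀ k d → k ℕ.* d ≡ N → t k d ≡ 0) → factorSum B N t ≡ 0
  factorSum-0 B N {t} t≡0 = ≡.trans (factorSum-cong B N {t} {λ _ _ → 0} t≡0)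
    (sum-zero {B} λ d → sum-zero {B} λ k → ℕ.*-zeroʳ (hit N (toℕ d) (toℕ k)))

  ∣𝟙 ∤𝟙 : ℕ → ℕ
  ∣𝟙 k = 𝟙 (p ∣? k)
  ∤𝟙 k = 𝟙 (¬? (p ∣? k))

  ∣𝟙+∤𝟙 : ∀ k x → ∣𝟙 k ℕ.* x ℕ.+ ∤𝟙 k ℕ.* x ≡ x
  ∣𝟙+∤𝟙 k x with p ∣? k
  ... | yes _ = ≡.trans (ℕ.+-identityʳ _) (ℕ.*-identityˡ x)
  ... | no _ = ℕ.*-identityˡ x

  -- The substitution k = p j. As M ≠ 0 forces d ≥ 1, every contributing j is at most M, and p M < B
  -- keeps p j within range.
  factorSum-∣ : ∀ {B M} → M ≢ 0 → p ℕ.* M ℕ.< B → (t : ℕ → ℕ) →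
    factorSum B (p ℕ.* M) (λ k d → ∣𝟙 k ℕ.* t d) ≡ factorSum B M (λ _ d → t d)
  factorSum-∣ {B} {M} M≢0 N<B t = sum-cong {B} λ d → sum-match (λ i j → suc (toℕ i) ℕ.≟ p ℕ.* suc (toℕ j))
    (λ {i} {j} {j′} eq eq′ → Fin.toℕ-injective (ℕ.suc-injective (ℕ.*-cancelˡ-≡ _ _ p (≡.trans (≡.sym eq) eq′))))
    (λ {i} {i′} {j} eq eq′ → Fin.toℕ-injective (ℕ.suc-injective (≡.trans eq (≡.sym eq′))))
    (λ {i} {j} → equal (toℕ d) (toℕ i) (toℕ j))
    (left (toℕ d)) (right (toℕ d))
    where
    equal : ∀ d i j → suc i ≡ p ℕ.* suc j → hit (p ℕ.* M) d i ℕ.* (∣𝟙 (suc i) ℕ.* t d) ≡ hit M d j ℕ.* t d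
    equal d i j eq = ≡.cong₂ ℕ._*_
      (𝟙-⇔ (suc i ℕ.* d ℕ.≟ p ℕ.* M) (suc j ℕ.* d ℕ.≟ M)
        (λ id≡pM → ℕ.*-cancelˡ-≡ _ _ p (≡.trans (≡.sym pjd≡) id≡pM)) (λ jd≡M → ≡.trans pjd≡ (≡.cong (p ℕ.*_) jd≡M)))
      (≡.trans (≡.cong (ℕ._* t d) (𝟙-yes (p ∣? suc i) (≡.subst (p ∣_) (≡.sym eq) (ℕ.m∣m*n (suc j))))) (ℕ.*-identityˡ (t d)))
      where
      pjd≡ : suc i ℕ.* d ≡ p ℕ.* (suc j ℕ.* d)
      pjd≡ = ≡.trans (≡.cong (ℕ._* d) eq) (ℕ.*-assoc p (suc j) d)
    left : ∀ d (i : Fin B) → hit (p ℕ.* M) d (toℕ i) ℕ.* (∣𝟙 (suc (toℕ i)) ℕ.* t d) ≡ 0 ⊎ ∃[ j ] suc (toℕ i) ≡ p ℕ.* suc (toℕ {B} j)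
    left d i with p ∣? suc (toℕ i)
    ... | no _ = inj₁ (ℕ.*-zeroʳ (hit (p ℕ.* M) d (toℕ i)))
    ... | yes (divides (suc j) eq) = inj₂ (fromℕ< j<B , ≡.trans eq (≡.trans (ℕ.*-comm (suc j) p) (≡.cong (λ j → p ℕ.* suc j) (≡.sym (Fin.toℕ-fromℕ< j<B)))))
      where
      j<B : j ℕ.< B
      j<B = ℕ.≤-trans (ℕ.≤-trans (ℕ.m≤m*n (suc j) p) (ℕ.≤-reflexive (≡.sym eq))) (Fin.toℕ<n i)
    right : ∀ d (j : Fin B) → hit M d (toℕ j) ℕ.* t d ≡ 0 ⊎ ∃[ i ] suc (toℕ {B} i) ≡ p ℕ.* suc (toℕ j)
    right d j with suc (toℕ j) ℕ.* d ℕ.≟ M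
    ... | no _ = inj₁ ≡.refl
    ... | yes jd≡M = inj₂ (fromℕ< i<B , ≡.trans (≡.cong suc (Fin.toℕ-fromℕ< i<B)) (ℕ.suc-pred (p ℕ.* suc (toℕ j)) {{ℕ.m*n≢0 p (suc (toℕ j))}}))
      where
      d≢0 : NonZero d
      d≢0 = ℕ.≢-nonZero λ { ≡.refl → M≢0 (≡.trans (≡.sym jd≡M) (ℕ.*-zeroʳ (suc (toℕ j)))) }
      i<B : ℕ.pred (p ℕ.* suc (toℕ j)) ℕ.< B
      i<B = ℕ.≤-<-trans (ℕ.≤-trans (ℕ.pred[n]≤n {p ℕ.* suc (toℕ j)}) (ℕ.*-monoʳ-≤ p (≡.subst (suc (toℕ j) ℕ.≤_) jd≡M (ℕ.m≤m*n (suc (toℕ j)) d {{d≢0}})))) N<B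

  -- The substitution d = p j, possible because `t` is supported on multiples of p. The exponent k,
  -- and any weight on it, is untouched.
  factorSum-∤ : ∀ {B M} → p ℕ.* M ℕ.< B → (w t : ℕ → ℕ) → (∀ d → p ∤ d → t d ≡ 0) →
    factorSum B (p ℕ.* M) (λ k d → w k ℕ.* t d) ≡ factorSum B M (λ k d → w k ℕ.* t (p ℕ.* d))
  factorSum-∤ {B} {M} N<B w t t≡0 = sum-match (λ i j → toℕ i ℕ.≟ p ℕ.* toℕ j)
    (λ {i} {j} {j′} eq eq′ → Fin.toℕ-injective (ℕ.*-cancelˡ-≡ _ _ p (≡.trans (≡.sym eq) eq′)))
    (λ {i} {i′} {j} eq eq′ → Fin.toℕ-injective (≡.trans eq (≡.sym eq′)))
    (λ {i} {j} eq → sum-cong {B} λ k → equal (toℕ i) (toℕ j) (toℕ k) eq)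
    left right
    where
    equal : ∀ i j k → i ≡ p ℕ.* j → hit (p ℕ.* M) i k ℕ.* (w (suc k) ℕ.* t i) ≡ hit M j k ℕ.* (w (suc k) ℕ.* t (p ℕ.* j))
    equal i j k ≡.refl = ≡.cong (ℕ._* (w (suc k) ℕ.* t (p ℕ.* j)))
      (𝟙-⇔ (suc k ℕ.* (p ℕ.* j) ℕ.≟ p ℕ.* M) (suc k ℕ.* j ℕ.≟ M)
        (λ eq → ℕ.*-cancelˡ-≡ _ _ p (≡.trans (x∙yz≈y∙xz p (suc k) j) eq)) (λ eq → ≡.trans (x∙yz≈y∙xz (suc k) p j) (≡.cong (p ℕ.*_) eq)))
      where open import Algebra.Properties.CommutativeSemigroup ℕ.*-commutativeSemigroup using (x∙yz≈y∙xz)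
    left : ∀ i → sum {B} (λ k → hit (p ℕ.* M) (toℕ i) (toℕ k) ℕ.* (w (suc (toℕ k)) ℕ.* t (toℕ i))) ≡ 0 ⊎ ∃[ j ] toℕ i ≡ p ℕ.* toℕ {B} j
    left i with p ∣? toℕ i
    ... | no p∤i = inj₁ (sum-zero {B} λ k → ≡.trans (≡.cong (λ x → hit (p ℕ.* M) (toℕ i) (toℕ k) ℕ.* (w (suc (toℕ k)) ℕ.* x)) (t≡0 (toℕ i) p∤i))
            (≡.trans (≡.cong (hit (p ℕ.* M) (toℕ i) (toℕ k) ℕ.*_) (ℕ.*-zeroʳ (w (suc (toℕ k))))) (ℕ.*-zeroʳ (hit (p ℕ.* M) (toℕ i) (toℕ k)))))
    ... | yes (divides j eq) = inj₂ (fromℕ< j<B , ≡.trans eq (≡.trans (ℕ.*-comm j p) (≡.cong (p ℕ.*_) (≡.sym (Fin.toℕ-fromℕ< j<B)))))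
      where
      j<B : j ℕ.< B
      j<B = ℕ.≤-<-trans (ℕ.≤-trans (ℕ.m≤m*n j p) (ℕ.≤-reflexive (≡.sym eq))) (Fin.toℕ<n i)
    right : ∀ j → sum {B} (λ k → hit M (toℕ j) (toℕ k) ℕ.* (w (suc (toℕ k)) ℕ.* t (p ℕ.* toℕ j))) ≡ 0 ⊎ ∃[ i ] toℕ {B} i ≡ p ℕ.* toℕ j
    right j with p ℕ.* toℕ j ℕ.<? B
    ... | yes pj<B = inj₂ (fromℕ< pj<B , Fin.toℕ-fromℕ< pj<B)
    ... | no pj≮B = inj₁ (sum-zero {B} λ k → ≡.cong (ℕ._* (w (suc (toℕ k)) ℕ.* t (p ℕ.* toℕ j))) (𝟙-no (suc (toℕ k) ℕ.* toℕ j ℕ.≟ M)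
            λ kj≡M → pj≮B (ℕ.≤-<-trans (ℕ.*-monoʳ-≤ p (≡.subst (toℕ j ℕ.≤_) kj≡M (ℕ.m≤m+n (toℕ j) _))) N<B)))

  -- Only arithmetic is left: in degree d, `I` counts the irreducible polynomials, `Z₀` and `Z₁`
  -- those of zero and nonzero trace, and `Z k` those for which k times the trace vanishes.
  module _ (I Z₀ Z₁ : ℕ → ℕ) (Z : ℕ → ℕ → ℕ) (split : ∀ d → Z₀ d ℕ.+ Z₁ d ≡ I d)
    (Z-∣ : ∀ k d → p ∣ k → Z k d ≡ I d) (Z-∤ : ∀ k d → p ∤ k → Z k d ≡ Z₀ d)
    (key : ∀ {N B} → N ≢ 0 → N ℕ.< B → factorSum B N (λ k d → d ℕ.* I d) ≡ p ℕ.* factorSum B N (λ k d → d ℕ.* Z k d)) where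

    -- The correction term of the theorem, by which `I n` differs from `p ℕ.* Z₀ n`.
    E : ℕ → ℕ
    E n = ∣𝟙 n ℕ.* Z₁ (n ℕ./ p)

    E-∣ : ∀ m → E (p ℕ.* m) ≡ Z₁ m
    E-∣ m = ≡.trans (≡.cong₂ ℕ._*_ (𝟙-yes (p ∣? p ℕ.* m) (ℕ.m∣m*n m)) (≡.cong Z₁ (≡.trans (≡.cong (ℕ._/ p) (ℕ.*-comm p m)) (ℕ.m*n/n≡m m p)))) (ℕ.*-identityˡ _)

    E-∤ : ∀ n → p ∤ n → E n ≡ 0
    E-∤ n p∤n = ≡.cong (ℕ._* Z₁ (n ℕ./ p)) (𝟙-no (p ∣? n) p∤n)

    module _ {N B : ℕ} (N≢0 : N ≢ 0) (N<B : N ℕ.< B) where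
      S∣ : ℕ
      S∣ = factorSum B N (λ k d → ∣𝟙 k ℕ.* (d ℕ.* I d))

      S∤ : (ℕ → ℕ) → ℕ
      S∤ t = factorSum B N (λ k d → ∤𝟙 k ℕ.* (d ℕ.* t d))

      -- The surplus (p - 1) S∣ of the terms with p ∣ k equals `S∤ E`. If p ∤ N, all terms vanish.
      -- If N = p M, then S∣ is the full sum SI at M, and S∤ E = p S₁, where S₁ collects the nonzero
      -- traces for p ∤ k. Now SI = S₁ + SZ by splitting and SI = p SZ by the key identity at M, so
      -- p S₁ + SI = p SI.
      E-sum : S∤ E ℕ.+ S∣ ≡ p ℕ.* S∣
      E-sum with p ∣? N
      ... | no p∤N = ≡.trans (≡.cong₂ ℕ._+_ S∤E≡0 S∣≡0) (≡.sym (≡.trans (≡.cong (p ℕ.*_) S∣≡0) (ℕ.*-zeroʳ p)))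
        where
        S∣≡0 : S∣ ≡ 0
        S∣≡0 = factorSum-0 B N λ k d kd≡N → ≡.cong (ℕ._* (d ℕ.* I d)) (𝟙-no (p ∣? k) λ p∣k → p∤N (≡.subst (p ∣_) kd≡N (ℕ.∣m⇒∣m*n d p∣k)))
        S∤E≡0 : S∤ E ≡ 0
        S∤E≡0 = factorSum-0 B N λ k d kd≡N → ≡.trans
          (≡.cong (λ x → ∤𝟙 k ℕ.* (d ℕ.* x)) (E-∤ d λ p∣d → p∤N (≡.subst (p ∣_) kd≡N (ℕ.∣n⇒∣m*n k p∣d))))
          (≡.trans (≡.cong (∤𝟙 k ℕ.*_) (ℕ.*-zeroʳ d)) (ℕ.*-zeroʳ (∤𝟙 k)))
      ... | yes (divides M N≡Mp) = begin
        S∤ E ℕ.+ S∣                          ≡⟨ ≡.cong₂ ℕ._+_ S∤E≡ S∣≡ ⟩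
        p ℕ.* S₁ ℕ.+ SI                       ≡⟨ ≡.cong (p ℕ.* S₁ ℕ.+_) (key M≢0 M<B) ⟩
        p ℕ.* S₁ ℕ.+ p ℕ.* SZ                ≡⟨ ℕ.*-distribˡ-+ p S₁ SZ ⟨
        p ℕ.* (S₁ ℕ.+ SZ)                    ≡⟨ ≡.cong (p ℕ.*_) SI≡ ⟨
        p ℕ.* SI                              ≡⟨ ≡.cong (p ℕ.*_) S∣≡ ⟨
        p ℕ.* S∣                             ∎
        where
        N≡pM : N ≡ p ℕ.* M
        N≡pM = ≡.trans N≡Mp (ℕ.*-comm M p)
        pM<B : p ℕ.* M ℕ.< B
        pM<B = ≡.subst (ℕ._< B) N≡pM N<B
        M≢0 : M ≢ 0
        M≢0 ≡.refl = N≢0 N≡Mp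
        M<B : M ℕ.< B
        M<B = ℕ.≤-<-trans (ℕ.m≤n*m M p) pM<B
        SI = factorSum B M (λ k d → d ℕ.* I d)
        SZ = factorSum B M (λ k d → d ℕ.* Z k d)
        S₁ = factorSum B M (λ k d → ∤𝟙 k ℕ.* (d ℕ.* Z₁ d))
        S∣≡ : S∣ ≡ SI
        S∣≡ = ≡.trans (≡.cong (λ N → factorSum B N (λ k d → ∣𝟙 k ℕ.* (d ℕ.* I d))) N≡pM) (factorSum-∣ M≢0 pM<B (λ d → d ℕ.* I d))
        S∤E≡ : S∤ E ≡ p ℕ.* S₁
        S∤E≡ = begin
          S∤ E                                                                ≡⟨ ≡.cong (λ N → factorSum B N (λ k d → ∤𝟙 k ℕ.* (d ℕ.* E d))) N≡pM ⟩
          factorSum B (p ℕ.* M) (λ k d → ∤𝟙 k ℕ.* (d ℕ.* E d))                ≡⟨ factorSum-∤ pM<B ∤𝟙 (λ d → d ℕ.* E d) (λ d p∤d → ≡.trans (≡.cong (d ℕ.*_) (E-∤ d p∤d)) (ℕ.*-zeroʳ d)) ⟩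
          factorSum B M (λ k d → ∤𝟙 k ℕ.* (p ℕ.* d ℕ.* E (p ℕ.* d)))          ≡⟨ factorSum-cong B M (λ k d _ → ≡.trans (≡.cong (λ x → ∤𝟙 k ℕ.* (p ℕ.* d ℕ.* x)) (E-∣ d)) (≡.trans (≡.cong (∤𝟙 k ℕ.*_) (ℕ.*-assoc p d (Z₁ d))) (x∙yz≈y∙xz (∤𝟙 k) p (d ℕ.* Z₁ d)))) ⟩
          factorSum B M (λ k d → p ℕ.* (∤𝟙 k ℕ.* (d ℕ.* Z₁ d)))               ≡⟨ factorSum-* B M p (λ k d → ∤𝟙 k ℕ.* (d ℕ.* Z₁ d)) ⟩
          p ℕ.* S₁                                                            ∎
          where open import Algebra.Properties.CommutativeSemigroup ℕ.*-commutativeSemigroup using (x∙yz≈y∙xz)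
        I-split : ∀ k d → d ℕ.* I d ≡ ∤𝟙 k ℕ.* (d ℕ.* Z₁ d) ℕ.+ d ℕ.* Z k d
        I-split k d with p ∣? k
        ... | yes p∣k = ≡.cong (d ℕ.*_) (≡.sym (Z-∣ k d p∣k))
        ... | no p∤k = begin
          d ℕ.* I d                               ≡⟨ ≡.cong (d ℕ.*_) (split d) ⟨
          d ℕ.* (Z₀ d ℕ.+ Z₁ d)                   ≡⟨ ≡.cong (d ℕ.*_) (ℕ.+-comm (Z₀ d) (Z₁ d)) ⟩
          d ℕ.* (Z₁ d ℕ.+ Z₀ d)                   ≡⟨ ℕ.*-distribˡ-+ d (Z₁ d) (Z₀ d) ⟩
          d ℕ.* Z₁ d ℕ.+ d ℕ.* Z₀ d               ≡⟨ ≡.cong₂ ℕ._+_ (≡.sym (ℕ.*-identityˡ _)) (≡.cong (d ℕ.*_) (≡.sym (Z-∤ k d p∤k))) ⟩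
          1 ℕ.* (d ℕ.* Z₁ d) ℕ.+ d ℕ.* Z k d      ∎
        SI≡ : SI ≡ S₁ ℕ.+ SZ
        SI≡ = ≡.trans (factorSum-cong B M (λ k d _ → I-split k d)) (factorSum-+ B M (λ k d → ∤𝟙 k ℕ.* (d ℕ.* Z₁ d)) (λ k d → d ℕ.* Z k d))

      -- Sorting the key identity by whether p ∣ k gives S∣ + S∤ I = p S∣ + p S∤ Z₀; replacing p S∣
      -- by means of `E-sum` makes S∣ cancel.
      S∤I : S∤ I ≡ S∤ (λ d → p ℕ.* Z₀ d ℕ.+ E d)
      S∤I = ℕ.+-cancelˡ-≡ S∣ _ _ (begin
        S∣ ℕ.+ S∤ I
          ≡⟨ ≡.trans (factorSum-cong B N (λ k d _ → ≡.sym (∣𝟙+∤𝟙 k (d ℕ.* I d)))) (factorSum-+ B N (λ k d → ∣𝟙 k ℕ.* (d ℕ.* I d)) (λ k d → ∤𝟙 k ℕ.* (d ℕ.* I d))) ⟨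
        factorSum B N (λ k d → d ℕ.* I d)
          ≡⟨ key N≢0 N<B ⟩
        p ℕ.* factorSum B N (λ k d → d ℕ.* Z k d)
          ≡⟨ ≡.cong (p ℕ.*_) (≡.trans (factorSum-cong B N (λ k d _ → Z-split k d)) (factorSum-+ B N (λ k d → ∣𝟙 k ℕ.* (d ℕ.* I d)) (λ k d → ∤𝟙 k ℕ.* (d ℕ.* Z₀ d)))) ⟩
        p ℕ.* (S∣ ℕ.+ S∤ Z₀)
          ≡⟨ ℕ.*-distribˡ-+ p S∣ (S∤ Z₀) ⟩
        p ℕ.* S∣ ℕ.+ p ℕ.* S∤ Z₀
          ≡⟨ ≡.cong (ℕ._+ p ℕ.* S∤ Z₀) (≡.trans (≡.sym E-sum) (ℕ.+-comm (S∤ E) S∣)) ⟩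
        S∣ ℕ.+ S∤ E ℕ.+ p ℕ.* S∤ Z₀
          ≡⟨ ≡.trans (ℕ.+-assoc S∣ (S∤ E) _) (≡.cong (S∣ ℕ.+_) (ℕ.+-comm (S∤ E) _)) ⟩
        S∣ ℕ.+ (p ℕ.* S∤ Z₀ ℕ.+ S∤ E)
          ≡⟨ ≡.cong (S∣ ℕ.+_) (≡.sym S∤pZ₀+E) ⟩
        S∣ ℕ.+ S∤ (λ d → p ℕ.* Z₀ d ℕ.+ E d) ∎)
        where
        Z-split : ∀ k d → d ℕ.* Z k d ≡ ∣𝟙 k ℕ.* (d ℕ.* I d) ℕ.+ ∤𝟙 k ℕ.* (d ℕ.* Z₀ d)
        Z-split k d with p ∣? k
        ... | yes p∣k = ≡.trans (≡.cong (d ℕ.*_) (Z-∣ k d p∣k)) (≡.sym (≡.trans (ℕ.+-identityʳ _) (ℕ.*-identityˡ _)))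
        ... | no p∤k = ≡.trans (≡.cong (d ℕ.*_) (Z-∤ k d p∤k)) (≡.sym (ℕ.*-identityˡ _))
        S∤pZ₀+E : S∤ (λ d → p ℕ.* Z₀ d ℕ.+ E d) ≡ p ℕ.* S∤ Z₀ ℕ.+ S∤ E
        S∤pZ₀+E = ≡.trans
          (factorSum-cong B N (λ k d _ → solve 5 (λ w d p z e → w :* (d :* (p :* z :+ e)) := p :* (w :* (d :* z)) :+ w :* (d :* e)) ≡.refl (∤𝟙 k) d p (Z₀ d) (E d)))
          (≡.trans (factorSum-+ B N (λ k d → p ℕ.* (∤𝟙 k ℕ.* (d ℕ.* Z₀ d))) (λ k d → ∤𝟙 k ℕ.* (d ℕ.* E d)))
            (≡.cong (ℕ._+ S∤ E) (factorSum-* B N p (λ k d → ∤𝟙 k ℕ.* (d ℕ.* Z₀ d)))))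
          where
          open import Data.Nat.Solver using (module +-*-Solver)
          open +-*-Solver

    -- The system is triangular: degree N arises only from k = 1, which p does not divide, with the
    -- nonzero factor N. The choice B = N + 1 makes d = N the last index; at d = 0 the factor d
    -- removes any dependence on X and Y.
    S∤-injective : ∀ {N} (N≢0 : N ≢ 0) (X Y : ℕ → ℕ) → (∀ d → d ≢ 0 → d ℕ.< N → X d ≡ Y d) →
      S∤ N≢0 (ℕ.n<1+n N) X ≡ S∤ N≢0 (ℕ.n<1+n N) Y → X N ≡ Y N
    S∤-injective {N} N≢0 X Y X≡Y eq = ℕ.*-cancelˡ-≡ _ _ N {{ℕ.≢-nonZero N≢0}}
      (≡.trans (≡.sym (at-N X)) (≡.trans (≡.subst (λ d → inner X d ≡ inner Y d) (Fin.toℕ-fromℕ N) inner≡) (at-N Y)))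
      where
      inner : (ℕ → ℕ) → ℕ → ℕ
      inner t d = sum {suc N} (λ k → hit N d (toℕ k) ℕ.* (∤𝟙 (suc (toℕ k)) ℕ.* (d ℕ.* t d)))
      d*X≡ : ∀ d → d ℕ.< N → d ℕ.* X d ≡ d ℕ.* Y d
      d*X≡ zero _ = ≡.refl
      d*X≡ (suc d) d<N = ≡.cong (suc d ℕ.*_) (X≡Y (suc d) (λ ()) d<N)
      inner≡ : inner X (toℕ (fromℕ N)) ≡ inner Y (toℕ (fromℕ N))
      inner≡ = sum-cancel (λ d → inner X (toℕ d)) (λ d → inner Y (toℕ d)) (fromℕ N) eq λ d d≢N →
        sum-cong {suc N} λ k → ≡.cong (λ x → hit N (toℕ d) (toℕ k) ℕ.* (∤𝟙 (suc (toℕ k)) ℕ.* x))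
          (d*X≡ (toℕ d) (ℕ.≤∧≢⇒< (Fin.toℕ≤pred[n] d) λ d≡N → d≢N (Fin.toℕ-injective (≡.trans d≡N (≡.sym (Fin.toℕ-fromℕ N))))))
      at-N : ∀ t → inner t N ≡ N ℕ.* t N
      at-N t = ≡.trans
        (sum-single {suc N} _ zero λ k k≢0 → ≡.cong (ℕ._* (∤𝟙 (suc (toℕ k)) ℕ.* (N ℕ.* t N))) (𝟙-no (suc (toℕ k) ℕ.* N ℕ.≟ N)
          λ eq → k≢0 (Fin.toℕ-injective (ℕ.suc-injective (ℕ.*-cancelʳ-≡ _ 1 N {{ℕ.≢-nonZero N≢0}} (≡.trans eq (≡.sym (ℕ.*-identityˡ N))))))))
        (≡.trans (≡.cong₂ (λ x y → x ℕ.* (y ℕ.* (N ℕ.* t N))) (𝟙-yes (1 ℕ.* N ℕ.≟ N) (ℕ.*-identityˡ N)) (𝟙-yes (¬? (p ∣? 1)) λ p∣1 → ℕ.nonTrivial⇒≢1 {{prime⇒nonTrivial p-prime}} (ℕ.∣1⇒≡1 p∣1)))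
          (≡.trans (ℕ.*-identityˡ _) (ℕ.*-identityˡ _)))

    inversion : ∀ n → n ≢ 0 → I n ≡ p ℕ.* Z₀ n ℕ.+ E n
    inversion = <-rec _ λ n rec n≢0 → S∤-injective n≢0 I (λ d → p ℕ.* Z₀ d ℕ.+ E d) (λ d d≢0 d<n → rec d<n d≢0) (S∤I n≢0 (ℕ.n<1+n n))

-- Cardinalities of the sets of irreducible polynomials with given trace

sum-filter : ∀ {a ℓ} {A : Set a} {P : A → Set ℓ} (P? : Decidable P) (g : A → ℕ) {m} (f : Fin m → A) →
  ListAction.sum (List.map g (List.filter P? (List.tabulate f))) ≡ ℕSum.sum (λ i → ℕSum.𝟙 (P? (f i)) ℕ.* g (f i))
sum-filter P? g {zero} f = ≡.refl
sum-filter P? g {suc m} f with P? (f zero)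
... | yes _ = ≡.cong₂ ℕ._+_ (≡.sym (ℕ.*-identityˡ (g (f zero)))) (sum-filter P? g (f ∘ suc))
... | no _ = sum-filter P? g (f ∘ suc)

sumNonzero-split : ∀ {p} .{{_ : NonZero p}} (g : Fin p → ℕ) → g 𝟎 ℕ.+ sumNonzero g ≡ ℕSum.sum g
sumNonzero-split {p} g = begin
  g 𝟎 ℕ.+ sumNonzero g
    ≡⟨ ≡.cong₂ ℕ._+_ (≡.sym at-𝟎) (sum-filter (λ a → ¬? (a Fin.≟ 𝟎)) g (λ a → a)) ⟩
  sum (λ a → 𝟙 (a Fin.≟ 𝟎) ℕ.* g a) ℕ.+ sum (λ a → 𝟙 (¬? (a Fin.≟ 𝟎)) ℕ.* g a)
    ≡⟨ ∑-distrib-+ (λ a → 𝟙 (a Fin.≟ 𝟎) ℕ.* g a) (λ a → 𝟙 (¬? (a Fin.≟ 𝟎)) ℕ.* g a) ⟨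
  sum (λ a → 𝟙 (a Fin.≟ 𝟎) ℕ.* g a ℕ.+ 𝟙 (¬? (a Fin.≟ 𝟎)) ℕ.* g a)
    ≡⟨ sum-cong both ⟩
  sum g ∎
  where
  open ℕSum
  open ≡.≡-Reasoning
  at-𝟎 : sum (λ a → 𝟙 (a Fin.≟ 𝟎) ℕ.* g a) ≡ g 𝟎
  at-𝟎 = ≡.trans (sum-single _ 𝟎 λ a a≢𝟎 → ≡.cong (ℕ._* g a) (𝟙-no (a Fin.≟ 𝟎) a≢𝟎))
    (≡.trans (≡.cong (ℕ._* g 𝟎) (𝟙-yes (𝟎 {p} Fin.≟ 𝟎) ≡.refl)) (ℕ.*-identityˡ (g 𝟎)))
  both : ∀ a → 𝟙 (a Fin.≟ 𝟎) ℕ.* g a ℕ.+ 𝟙 (¬? (a Fin.≟ 𝟎)) ℕ.* g a ≡ g a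
  both a with a Fin.≟ 𝟎
  ... | yes _ = ≡.trans (ℕ.+-identityʳ _) (ℕ.*-identityˡ (g a))
  ... | no _ = ℕ.*-identityˡ (g a)

module TraceCount {c ℓ₁ ℓ₂} (F : HeytingField c ℓ₁ ℓ₂) (q p : ℕ) (p≢0 : NonZero p)
  (card : HasCardinality (CommutativeRing.setoid (toRing F)) q) (char : HasCharacteristic (toRing F) p) where
  R : CommutativeRing c ℓ₁
  R = toRing F
  F-field : IsDiscreteField R
  F-field = finite⇒discrete F card
  open Counting R F-field p p≢0 char q card
  private
    module F where
      open DiscreteField R F-field public
      open FiniteField R F-field p p≢0 char q card public
  open ℕSum
  private instance
    p-nonZero : NonZero p
    p-nonZero = p≢0

  -- The decidable substitute for `HasTrace`. One direction uses `trace-root` in the given K and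
  -- injectivity of ι; the other supplies the field F[x]/(f) with the class of x as root.
  traceIs : ℕ → Poly → Fin p → Set ℓ₁
  traceIs n f a = F.Tr (F.- coeff f (ℕ.pred n)) F.≈ fromFin R a

  hasTrace⇒traceIs : ∀ {n f a} → MonicOfDegree n f → Irreducible f → HasTrace F q p n f a → traceIs n f a
  hasTrace⇒traceIs {n} {f} {a} monic irreducible h = F.x-y≈0⇒x≈y _ _ (ι-injective (begin
    ι (t F.- fromFin R a)         ≈⟨ +-homo t (F.- fromFin R a) ⟩
    ι t + ι (F.- fromFin R a)     ≈⟨ +-cong (trans (sym (trace-root n f monic irreducible α α-root k [K:𝔽ₚ])) tr) (trans (-‿homo (fromFin R a)) (-‿cong (ι-· (toℕ a)))) ⟩
    fromFin R′ a - fromFin R′ a   ≈⟨ -‿inverseʳ _ ⟩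
    0#                            ∎))
    where
    open HasTrace h renaming (trace to tr)
    open CommutativeRing R′ hiding (Carrier)
    open import Relation.Binary.Reasoning.Setoid setoid
    open IsRingHomomorphism ι-hom using (+-homo; -‿homo)
    K-field = finite⇒discrete K K-card
    open TraceOfRoot R F-field p p≢0 char q card R′ K-field ι ι-hom using (trace-root)
    open FieldExtension R F-field R′ K-field ι ι-hom using (ι-injective; ι-·)
    t = F.Tr (F.- coeff f (ℕ.pred n))

  traceIs⇒hasTrace : ∀ {n f a} → MonicOfDegree n f → Irreducible f → traceIs n f a → HasTrace F q p n f a
  traceIs⇒hasTrace {n} {f} {a} monic irreducible Tr≈a = record
    { K = K
    ; K-card = quotient-cardinality q card
    ; ι = C
    ; ι-hom = C-homomorphism
    ; α = X
    ; α-root = X-root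
    ; k = n ℕ.* F.r
    ; [K:𝔽ₚ] = q^≡ n
    ; trace = K.trans (trace-root n f monic irreducible X X-root (n ℕ.* F.r) (q^≡ n)) (K.trans (ι-cong Tr≈a) (ι-· (toℕ a)))
    }
    where
    open QuotientField R F-field f n monic irreducible
    K = quotientField ℓ₂
    module K = CommutativeRing (toRing K)
    K-field = finite⇒discrete K (quotient-cardinality q card)
    open IsRingHomomorphism C-homomorphism using () renaming (⟦⟧-cong to ι-cong)
    open TraceOfRoot R F-field p p≢0 char q card (toRing K) K-field C C-homomorphism using (trace-root; q^≡)
    open FieldExtension R F-field (toRing K) K-field C C-homomorphism using (ι-·)

  member? : ∀ a n i → Dec (Irreducible (mon n i) × traceIs n (mon n i) a)
  member? a n i = irr? n i ×-dec (F.Tr (F.- coeff (mon n i) (ℕ.pred n)) F.≟ fromFin R a)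

  ∣S∣ : Fin p → ℕ → ℕ
  ∣S∣ a n = sum (λ i → 𝟙 (member? a n i))

  -- The code of an element is the coefficient vector of its polynomial, which ignores the witnesses
  -- for the trace just as the equality of `S` does.
  S-cardinality : ∀ a n → HasCardinality (S F q p a n) (∣S∣ a n)
  S-cardinality a n = subset-cardinality (S F q p a n) (member? a n) (idx n ∘ proj₁)
    (λ {(f , _)} {(g , _)} f≈g → idx-cong n {f} {g} (coeffs f≈g))
    (λ {(f , f-monic , _)} {(g , g-monic , _)} eq →
      P.trans (P.sym (mon-idx {n} {f} f-monic)) (P.trans (P.reflexive (≡.cong (mon n) eq)) (mon-idx {n} {g} g-monic)) at_)
    (λ (f , monic , irreducible , h) → let mon≋f = mon-idx {n} {f} monic in
      irreducible-resp (P.sym mon≋f) irreducible ,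
      F.trans (F.trace-cong F.r (F.-‿cong (mon≋f at ℕ.pred n))) (hasTrace⇒traceIs {n} {f} monic irreducible h))
    λ i (irreducible , tr) → (mon n i , mon-monic n i , irreducible , traceIs⇒hasTrace (mon-monic n i) irreducible tr) , idx-mon n i

  ∑∣S∣ : ∀ n → sum (λ a → ∣S∣ a n) ≡ irreducibles n
  ∑∣S∣ n = ≡.trans (∑-comm (λ (a : Fin p) i → 𝟙 (member? a n i))) (sum-cong λ i → ≡.trans
    (sum-cong {p} (λ a → 𝟙-× (irr? n i) (tr i F.≟ fromFin R a)))
    (≡.trans (≡.sym (*-distribˡ-sum (𝟙 (irr? n i)) (λ (a : Fin p) → 𝟙 (tr i F.≟ fromFin R a))))
      (≡.trans (≡.cong (𝟙 (irr? n i) ℕ.*_) (prime-field-sum (F.Tr-fixed _))) (ℕ.*-identityʳ _))))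
    where
    tr = λ i → F.Tr (F.- coeff (mon n i) (ℕ.pred n))

  fromFin-𝟎 : fromFin R (𝟎 {p}) F.≈ F.0#
  fromFin-𝟎 = F.reflexive (≡.cong (F._· F.1#) (≡.trans (Fin.toℕ-fromℕ< (ℕ.m%n<n 0 p)) (ℕ.m<n⇒m%n≡m (ℕ.>-nonZero⁻¹ p))))

  Tr-neg : ∀ x → F.Tr (F.- x) F.≈ F.- F.Tr x
  Tr-neg x = inverseˡ-unique _ _ (F.trans (F.sym (F.trace-+ F.r (F.- x) x)) (F.trans (F.trace-cong F.r (F.-‿inverseˡ x)) (F.trace-0 F.r)))
    where open import Algebra.Properties.Group F.+-group using (inverseˡ-unique)

  ∣S∣-𝟎 : ∀ n → ∣S∣ 𝟎 n ≡ irreduciblesTrace 1 n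
  ∣S∣-𝟎 n = sum-cong λ i → let x = coeff (mon n i) (ℕ.pred n) in ≡.trans (𝟙-× (irr? n i) (F.Tr (F.- x) F.≟ fromFin R 𝟎))
    (≡.cong (𝟙 (irr? n i) ℕ.*_) (𝟙-⇔ (F.Tr (F.- x) F.≟ fromFin R 𝟎) (traceMultiple? 1 n i)
      (λ eq → F.trans (F.+-identityʳ _) (F.trans (F.sym (F.-‿involutive _)) (F.trans (F.-‿cong (F.trans (F.sym (Tr-neg x)) (F.trans eq fromFin-𝟎))) F.-0#≈0#)))
      (λ eq → F.trans (Tr-neg x) (F.trans (F.-‿cong (F.trans (F.sym (F.+-identityʳ _)) eq)) (F.trans F.-0#≈0# (F.sym fromFin-𝟎))))))

  Σ* : ℕ → ℕ
  Σ* n = sumNonzero (λ a → ∣S∣ a n)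

  open Inversion p p≢0 F.p-prime

  ∣S∣-split : ∀ n → irreduciblesTrace 1 n ℕ.+ Σ* n ≡ irreducibles n
  ∣S∣-split n = ≡.trans (≡.cong (ℕ._+ Σ* n) (≡.sym (∣S∣-𝟎 n))) (≡.trans (sumNonzero-split (λ a → ∣S∣ a n)) (∑∣S∣ n))

  -- The theorem before subtraction: both sides count all irreducible polynomials of degree n, so
  -- the identity still makes sense in ℕ.
  Σ*-formula : ∀ n → n ≢ 0 → ∣S∣ 𝟎 n ℕ.+ Σ* n ≡ p ℕ.* ∣S∣ 𝟎 n ℕ.+ ∣𝟙 n ℕ.* Σ* (n ℕ./ p)
  Σ*-formula n n≢0 = ≡.trans (≡.trans (sumNonzero-split (λ a → ∣S∣ a n)) (∑∣S∣ n))
    (≡.trans (inversion irreducibles (irreduciblesTrace 1) Σ* irreduciblesTrace ∣S∣-split irreduciblesTrace-∣ irreduciblesTrace-∤ key-identity n n≢0)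
      (≡.cong (λ x → p ℕ.* x ℕ.+ ∣𝟙 n ℕ.* Σ* (n ℕ./ p)) (≡.sym (∣S∣-𝟎 n))))

-- Passage to the integers

open import Data.Integer using (ℤ; +_; 0ℤ; 1ℤ; _-_; _*_)
open import Data.Nat using (_/_)

ℕ⇒ℤ : ∀ p {z₀ z₁ e} → z₀ ℕ.+ z₁ ≡ p ℕ.* z₀ ℕ.+ e → + z₁ - (+ p - 1ℤ) * (+ z₀) ≡ + e
ℕ⇒ℤ p {z₀} {z₁} {e} eq = begin
  + z₁ - (+ p - 1ℤ) * (+ z₀)                        ≡⟨ solve 3 (λ x y z → y :- (z :- con 1ℤ) :* x := (x :+ y) :- z :* x) ≡.refl (+ z₀) (+ z₁) (+ p) ⟩
  (+ z₀ ℤ.+ + z₁) - + p * + z₀                      ≡⟨ ≡.cong (_- + p * + z₀) (≡.trans (≡.sym (ℤ.pos-+ z₀ z₁)) (≡.trans (≡.cong +_ eq) (≡.trans (ℤ.pos-+ (p ℕ.* z₀) e) (≡.cong (ℤ._+ + e) (ℤ.pos-* p z₀))))) ⟩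
  (+ p * + z₀ ℤ.+ + e) - + p * + z₀                 ≡⟨ solve 2 (λ x y → (x :+ y) :- x := y) ≡.refl (+ p * + z₀) (+ e) ⟩
  + e                                               ∎
  where
  open ≡.≡-Reasoning
  import Data.Integer as ℤ
  import Data.Integer.Properties as ℤ
  open import Data.Integer.Solver using (module +-*-Solver)
  open +-*-Solver

theorem1 :
  ∀ {c ℓ₁ ℓ₂} (F : HeytingField c ℓ₁ ℓ₂) (q p : ℕ) .{{_ : NonZero p}} →
  HasCardinality (CommutativeRing.setoid (toRing F)) q →
  HasCharacteristic (toRing F) p →
  Σ[ ∣S∣ ∈ (Fin p → ℕ → ℕ) ]
    (∀ a n .{{_ : NonZero n}} → HasCardinality (S F q p a n) (∣S∣ a n)) ×
    (∀ n .{{_ : NonZero n}} →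
      let Σ* = λ m → + sumNonzero (λ a → ∣S∣ a m)
          lhs = Σ* n - (+ p - 1ℤ) * (+ ∣S∣ 𝟎 n)
      in (p ∤ n → lhs ≡ 0ℤ) × (p ∣ n → lhs ≡ Σ* (n / p)))
theorem1 F q p card char = ∣S∣ , (λ a n → S-cardinality a n) , λ n →
  (λ p∤n → ≡.trans (lhs≡ n) (≡.cong (λ x → + (x ℕ.* Σ* (n / p))) (ℕSum.𝟙-no (p ∣? n) p∤n))) ,
  (λ p∣n → ≡.trans (lhs≡ n) (≡.cong +_ (≡.trans (≡.cong (ℕ._* Σ* (n / p)) (ℕSum.𝟙-yes (p ∣? n) p∣n)) (ℕ.*-identityˡ _))))
  where
  open TraceCount F q p (ℕ.≢-nonZero (ℕ.≢-nonZero⁻¹ p)) card char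
  lhs≡ : ∀ n .{{_ : NonZero n}} → + Σ* n - (+ p - 1ℤ) * (+ ∣S∣ 𝟎 n) ≡ + (ℕSum.𝟙 (p ∣? n) ℕ.* Σ* (n / p))
  lhs≡ n = ℕ⇒ℤ p (Σ*-formula n (ℕ.≢-nonZero⁻¹ n))
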